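{- Fix an integer $k\ge 5$. Suppose that $r(k,n)=\Theta_k\big(n^{k-1}/(\log n)^{k-2}\big)$, i.e. there are constants $b_1,b_2>0$ (depending only on $k$) such that $b_1 n^{k-1}/(\log n)^{k-2}\le r(k,n)\le b_2 n^{k-1}/(\log n)^{k-2}$ for all sufficiently large $n$. Then there exist constants $a_1,a_2>0$ (depending only on $k$ and $b_1,b_2$) such that for all integers $n\ge 2$ and $N\ge 1$: (i) if $N\le a_1 n^{k-1}/(\log n)^{k-2}$, then $f(N,k,n)=0$; and (ii) if $N\ge a_1 n^{k-1}/(\log n)^{k-2}$, then $$f(N,k,n)\le a_2\binom{N}{k}\Big(\frac{\log n}{n}\Big)^{\binom{k}{2}}\cdot\frac{1}{\log n}.$$
   Context: Graphs are finite and simple. $r(k,n)$ is the off-diagonal Ramsey number: the least $N$ such that every $N$-vertex graph contains a clique of size $k$ or an independent set of size $n$. $f(N,k,n)$ denotes the minimum number of (unlabeled) cliques of size $k$ in an $N$-vertex graph with no independent set of size $n$. $\log$ is the natural logarithm. -}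

module Defs where

import Algebra.Definitions.RawSemiring as RawSemiring
open import Data.Bool using (Bool; true; false; T; not; _∧_)
open import Data.Bool.Properties using (∧-comm; ∧-idem)
open import Data.Fin using (Fin; zero; suc)
import Data.Fin.Properties as Fin
open import Data.Fin.Subset using (Subset; inside; outside; _∈_; _∉_; _⊆_; _∪_; _∩_; ∁; ⁅_⁆; Nonempty)
  renaming (∣_∣ to card; ⊥ to ∅; ⊤ to full)
open import Data.Fin.Subset.Properties
import Data.Integer as ℤ
import Data.Integer.Properties as ℤ
open import Data.List using (List; []; _∷_; _++_; map; filter; length)
import Data.List.Properties as List
open import Data.Nat using (ℕ; zero; suc; _+_; _*_; _∸_; _^_; _≤_; _<_; z≤n; s≤s; NonZero; NonTrivial; nonTrivial⇒n>1)
import Data.Nat.Properties as ℕ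
open import Data.Product using (∃; _×_; _,_; proj₁; proj₂)
open import Data.Rational using (ℚ; mkℚ; 0ℚ; 1ℚ; ½)
import Data.Rational as ℚ
import Data.Rational.Properties as ℚ
import Data.Rational.Unnormalised as ℚᵘ
import Data.Rational.Unnormalised.Properties as ℚᵘ
open import Data.Rational.Solver using (module +-*-Solver)
open import Data.Sum using (_⊎_; inj₁; inj₂)
open import Data.Vec using (Vec; []; _∷_; lookup; tabulate; here; there)
open import Data.Vec.Properties using (lookup∘tabulate)
open import Function using (_∘_)
open import Relation.Binary.PropositionalEquality
  using (_≡_; _≢_; refl; sym; trans; cong; cong₂; subst; subst₂; module ≡-Reasoning)
open import Relation.Nullary using (¬_; Dec; yes; no; contradiction)
open import Relation.Nullary.Decidable
  using (_×-dec_; _→-dec_; _⊎-dec_; ¬?; T?; map′; decidable-stable; ⌊_⌋)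
open import Relation.Unary using (Decidable)

open RawSemiring ℚ.+-*-rawSemiring using () renaming (_^_ to _^ℚ_)

record Graph (N : ℕ) : Set where
  field
    adj    : Fin N → Fin N → Bool
    symm   : ∀ i j → adj i j ≡ adj j i
    irrefl : ∀ i → adj i i ≡ false

  Adjacent : Fin N → Fin N → Set
  Adjacent i j = T (adj i j)

open Graph public using (adj; Adjacent)

private variable
  N : ℕ

IsClique : Graph N → Subset N → Set
IsClique G S = ∀ i j → i ∈ S → j ∈ S → i ≢ j → Adjacent G i j

IsIndependent : Graph N → Subset N → Set
IsIndependent G S = ∀ i j → i ∈ S → j ∈ S → ¬ Adjacent G i j

IsKClique : ℕ → Graph N → Subset N → Set
IsKClique k G S = card S ≡ k × IsClique G S

HasClique : ℕ → Graph N → Set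
HasClique k G = ∃ (IsKClique k G)

HasIndependent : ℕ → Graph N → Set
HasIndependent n G = ∃ λ S → card S ≡ n × IsIndependent G S

isKClique? : ∀ k (G : Graph N) → Decidable (IsKClique k G)
isKClique? k G S = (card S ℕ.≟ k) ×-dec
  Fin.all? λ i → Fin.all? λ j →
    (i ∈? S) →-dec (j ∈? S) →-dec ¬? (i Fin.≟ j) →-dec T? (adj G i j)

module Searching where
  hasClique? : ∀ k (G : Graph N) → Dec (HasClique k G)
  hasClique? k G = anySubset? (isKClique? k G)

  hasIndependent? : ∀ n (G : Graph N) → Dec (HasIndependent n G)
  hasIndependent? n G = anySubset? λ S → (card S ℕ.≟ n) ×-dec
    Fin.all? λ i → Fin.all? λ j →
      (i ∈? S) →-dec (j ∈? S) →-dec ¬? (T? (adj G i j))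

open Searching

subsets : ∀ N → List (Subset N)
subsets zero    = [] ∷ []
subsets (suc N) = map (outside ∷_) (subsets N) ++ map (inside ∷_) (subsets N)

cliqueCount : ℕ → Graph N → ℕ
cliqueCount k G = length (filter (isKClique? k G) (subsets _))

IsLeast : (ℕ → Set) → ℕ → Set
IsLeast P m = P m × (∀ m′ → P m′ → m ≤ m′)

module GraphSearch where
  least : {P : ℕ → Set} → Decidable P → ∃ P → ∃ (IsLeast P)
  least {P} P? (m , pm) = go m P P? pm
    where
    go : ∀ m (P : ℕ → Set) → Decidable P → P m → ∃ (IsLeast P)
    go zero    P P? p = zero , p , λ _ _ → z≤n
    go (suc m) P P? p with P? zero
    ... | yes p₀ = zero , p₀ , λ _ _ → z≤n
    ... | no ¬p₀ with go m (P ∘ suc) (P? ∘ suc) p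
    ...   | l , pl , lb = suc l , pl , λ where
      zero     q → contradiction q ¬p₀
      (suc m′) q → s≤s (lb m′ q)

  Searchable : Set → Set₁
  Searchable A = {P : A → Set} → Decidable P → Dec (∃ P)

  searchVec : ∀ {A : Set} → Searchable A → ∀ n → Searchable (Vec A n)
  searchVec sA zero    P? = map′ ([] ,_) (λ { ([] , p) → p }) (P? [])
  searchVec sA (suc n) P? =
    map′ (λ { (x , xs , p) → x ∷ xs , p }) (λ { (x ∷ xs , p) → x , xs , p })
      (sA λ x → searchVec sA n λ xs → P? (x ∷ xs))

  record _≗ᴳ_ (G H : Graph N) : Set where
    constructor pointwise
    field at : ∀ i j → adj G i j ≡ adj H i j

  open _≗ᴳ_

  ≗ᴳ-sym : {G H : Graph N} → G ≗ᴳ H → H ≗ᴳ G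
  ≗ᴳ-sym e = pointwise λ i j → sym (at e i j)

  IsKClique-resp : ∀ {k} {G H : Graph N} → G ≗ᴳ H → ∀ {S} → IsKClique k G S → IsKClique k H S
  IsKClique-resp e (c , q) = c , λ i j i∈ j∈ i≢j → subst T (at e i j) (q i j i∈ j∈ i≢j)

  HasIndependent-resp : ∀ {n} {G H : Graph N} → G ≗ᴳ H → HasIndependent n G → HasIndependent n H
  HasIndependent-resp e (S , c , q) = S , c , λ i j i∈ j∈ a → q i j i∈ j∈ (subst T (sym (at e i j)) a)

  cliqueCount-resp : ∀ k {G H : Graph N} → G ≗ᴳ H → cliqueCount k G ≡ cliqueCount k H
  cliqueCount-resp k {G} {H} e = cong length
    (List.filter-≐ (isKClique? k G) (isKClique? k H)
      (IsKClique-resp e , IsKClique-resp (≗ᴳ-sym e)) (subsets _))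

  distinct : Fin N → Fin N → Bool
  distinct i j = not ⌊ i Fin.≟ j ⌋

  distinct-irrefl : (i : Fin N) → distinct i i ≡ false
  distinct-irrefl i with i Fin.≟ i
  ... | yes _  = refl
  ... | no i≢i = contradiction refl i≢i

  distinct-sym : (i j : Fin N) → distinct i j ≡ distinct j i
  distinct-sym i j with i Fin.≟ j | j Fin.≟ i
  ... | yes _   | yes _   = refl
  ... | no _    | no _    = refl
  ... | yes i≡j | no j≢i  = contradiction (sym i≡j) j≢i
  ... | no i≢j  | yes j≡i = contradiction (sym j≡i) i≢j

  fromMatrix : Vec (Subset N) N → Graph N
  fromMatrix M = record
    { adj    = λ i j → distinct i j ∧ (entry i j ∧ entry j i)
    ; symm   = λ i j → cong₂ _∧_ (distinct-sym i j) (∧-comm (entry i j) (entry j i))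
    ; irrefl = λ i → cong (_∧ (entry i i ∧ entry i i)) (distinct-irrefl i)
    }
    where entry = λ i j → lookup (lookup M i) j

  toMatrix : Graph N → Vec (Subset N) N
  toMatrix G = tabulate λ i → tabulate λ j → adj G i j

  fromMatrix∘toMatrix : (G : Graph N) → G ≗ᴳ fromMatrix (toMatrix G)
  fromMatrix∘toMatrix G = pointwise agree
   where
   agree : ∀ i j → adj G i j ≡ adj (fromMatrix (toMatrix G)) i j
   agree i j
    rewrite lookup∘tabulate (λ i → tabulate (adj G i)) i
          | lookup∘tabulate (λ i → tabulate (adj G i)) j
          | lookup∘tabulate (adj G i) j
          | lookup∘tabulate (adj G j) i
          | Graph.symm G j i
          | ∧-idem (adj G i j)
    with i Fin.≟ j
   ... | no _     = refl
   ... | yes refl = Graph.irrefl G i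

  searchGraph : {P : Graph N → Set} → (∀ {G H} → G ≗ᴳ H → P G → P H) →
                Decidable P → Dec (∃ P)
  searchGraph resp P? =
    map′ (λ { (M , p) → fromMatrix M , p })
         (λ { (G , p) → toMatrix G , resp (fromMatrix∘toMatrix G) p })
         (searchVec anySubset? _ (P? ∘ fromMatrix))

open GraphSearch

RamseyProperty : ℕ → ℕ → ℕ → Set
RamseyProperty k n N = (G : Graph N) → HasClique k G ⊎ HasIndependent n G

module RamseyTheorem where
  ramseyProperty? : ∀ k n → Decidable (RamseyProperty k n)
  ramseyProperty? k n N =
    map′ (λ none G → decidable-stable (good? G) λ bad → none (G , bad))
         (λ all (G , bad) → bad (all G))
         (¬? (searchGraph resp λ G → ¬? (good? G)))
    where
    good? : (G : Graph N) → Dec (HasClique k G ⊎ HasIndependent n G)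
    good? G = hasClique? k G ⊎-dec hasIndependent? n G
    resp : ∀ {G H : Graph N} → G ≗ᴳ H → ¬ (HasClique k G ⊎ HasIndependent n G) →
           ¬ (HasClique k H ⊎ HasIndependent n H)
    resp {G} {H} e bad (inj₁ (S , c)) = bad (inj₁ (S , IsKClique-resp (≗ᴳ-sym e) c))
    resp {G} {H} e bad (inj₂ I)       = bad (inj₂ (HasIndependent-resp (≗ᴳ-sym e) I))

  card-split : (p q : Subset N) → card (p ∩ q) + card (p ∩ ∁ q) ≡ card p
  card-split []            []            = refl
  card-split (outside ∷ p) (_ ∷ q)       = card-split p q
  card-split (inside ∷ p)  (inside ∷ q)  = cong suc (card-split p q)
  card-split (inside ∷ p)  (outside ∷ q) = trans (ℕ.+-suc _ _) (cong suc (card-split p q))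

  nonempty : (p : Subset N) → 1 ≤ card p → Nonempty p
  nonempty (inside ∷ p)  _ = zero , here
  nonempty (outside ∷ p) c with nonempty p c
  ... | i , i∈p = suc i , there i∈p

  card-insert : ∀ v (p : Subset N) → v ∉ p → card (⁅ v ⁆ ∪ p) ≡ suc (card p)
  card-insert zero    (inside ∷ p)  v∉p = contradiction here v∉p
  card-insert zero    (outside ∷ p) v∉p = cong (suc ∘ card) (∪-identityˡ p)
  card-insert (suc v) (inside ∷ p)  v∉p = cong suc (card-insert v p (v∉p ∘ there))
  card-insert (suc v) (outside ∷ p) v∉p = card-insert v p (v∉p ∘ there)

  lookup⇒∈ : ∀ (p : Subset N) i → T (lookup p i) → i ∈ p
  lookup⇒∈ (inside ∷ p) zero    _ = here
  lookup⇒∈ (_ ∷ p)      (suc i) t = there (lookup⇒∈ p i t)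

  ∈⇒lookup : ∀ (p : Subset N) i → i ∈ p → T (lookup p i)
  ∈⇒lookup (_ ∷ p) zero    here      = _
  ∈⇒lookup (_ ∷ p) (suc i) (there m) = ∈⇒lookup p i m

  module _ (G : Graph N) where
    nbrs : Fin N → Subset N
    nbrs v = tabulate (adj G v)

    ∈nbrs⇒ : ∀ {v i} → i ∈ nbrs v → Adjacent G v i
    ∈nbrs⇒ {v} {i} m = subst T (lookup∘tabulate (adj G v) i) (∈⇒lookup (nbrs v) i m)

    ⇒∈nbrs : ∀ {v i} → Adjacent G v i → i ∈ nbrs v
    ⇒∈nbrs {v} {i} a = lookup⇒∈ (nbrs v) i (subst T (sym (lookup∘tabulate (adj G v) i)) a)

    ¬loop : ∀ v → ¬ Adjacent G v v
    ¬loop v a = subst T (Graph.irrefl G v) a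

    flipAdj : ∀ {i j} → Adjacent G i j → Adjacent G j i
    flipAdj {i} {j} = subst T (Graph.symm G i j)

    insertElim : ∀ {v i} {p : Subset N} → i ∈ ⁅ v ⁆ ∪ p → i ≡ v ⊎ i ∈ p
    insertElim {v} {p = p} m with x∈p∪q⁻ ⁅ v ⁆ p m
    ... | inj₁ s = inj₁ (x∈⁅y⁆⇒x≡y v s)
    ... | inj₂ q = inj₂ q

    CliqueIn IndependentIn : ℕ → Subset N → Set
    CliqueIn      k U = ∃ λ S → S ⊆ U × card S ≡ k × IsClique G S
    IndependentIn n U = ∃ λ S → S ⊆ U × card S ≡ n × IsIndependent G S

    extendClique : ∀ {k v U W} → v ∈ U → W ⊆ U → W ⊆ nbrs v → CliqueIn k W → CliqueIn (suc k) U
    extendClique {v = v} {U} {W} v∈U W⊆U W⊆nbrs (S , S⊆W , c , q) =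
      ⁅ v ⁆ ∪ S , sub , trans (card-insert v S v∉S) (cong suc c) , clique
      where
      near : ∀ {i} → i ∈ S → Adjacent G v i
      near i∈S = ∈nbrs⇒ (W⊆nbrs (S⊆W i∈S))
      v∉S : v ∉ S
      v∉S v∈S = ¬loop v (near v∈S)
      sub : ⁅ v ⁆ ∪ S ⊆ U
      sub m with insertElim {p = S} m
      ... | inj₁ refl = v∈U
      ... | inj₂ i∈S  = W⊆U (S⊆W i∈S)
      clique : IsClique G (⁅ v ⁆ ∪ S)
      clique i j i∈ j∈ i≢j with insertElim {p = S} i∈ | insertElim {p = S} j∈
      ... | inj₁ refl | inj₁ refl = contradiction refl i≢j
      ... | inj₁ refl | inj₂ j∈S  = near j∈S
      ... | inj₂ i∈S  | inj₁ refl = flipAdj (near i∈S)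
      ... | inj₂ i∈S  | inj₂ j∈S  = q i j i∈S j∈S i≢j

    extendIndependent : ∀ {n v U W} → v ∈ U → W ⊆ U → v ∉ W → W ⊆ ∁ (nbrs v) →
                        IndependentIn n W → IndependentIn (suc n) U
    extendIndependent {v = v} {U} {W} v∈U W⊆U v∉W W⊆far (S , S⊆W , c , q) =
      ⁅ v ⁆ ∪ S , sub , trans (card-insert v S (v∉W ∘ S⊆W)) (cong suc c) , indep
      where
      far : ∀ {i} → i ∈ S → ¬ Adjacent G v i
      far i∈S a = x∈∁p⇒x∉p (W⊆far (S⊆W i∈S)) (⇒∈nbrs a)
      sub : ⁅ v ⁆ ∪ S ⊆ U
      sub m with insertElim {p = S} m
      ... | inj₁ refl = v∈U
      ... | inj₂ i∈S  = W⊆U (S⊆W i∈S)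
      indep : IsIndependent G (⁅ v ⁆ ∪ S)
      indep i j i∈ j∈ a with insertElim {p = S} i∈ | insertElim {p = S} j∈
      ... | inj₁ refl | inj₁ refl = ¬loop v a
      ... | inj₁ refl | inj₂ j∈S  = far j∈S a
      ... | inj₂ i∈S  | inj₁ refl = far i∈S (flipAdj a)
      ... | inj₂ i∈S  | inj₂ j∈S  = q i j i∈S j∈S a

    ramseyIn : ∀ k n (U : Subset N) → 2 ^ (k + n) ≤ card U → CliqueIn k U ⊎ IndependentIn n U
    ramseyIn zero    n       U c = inj₁ (∅ , ⊥⊆ , ∣⊥∣≡0 N , λ i j i∈ → contradiction i∈ ∉⊥)
    ramseyIn (suc k) zero    U c = inj₂ (∅ , ⊥⊆ , ∣⊥∣≡0 N , λ i j i∈ → contradiction i∈ ∉⊥)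
    ramseyIn (suc k) (suc n) U c with nonempty U (ℕ.≤-trans (ℕ.m^n>0 2 (suc k + suc n)) c)
    ... | v , v∈U = choose (ℕ.≤-<-connex X (card near))
      where
      X = 2 ^ (k + suc n)
      near = U ∩ nbrs v
      far′ = U ∩ ∁ (nbrs v)
      far  = far′ ∩ ∁ ⁅ v ⁆
      far⊆far′ : far ⊆ far′
      far⊆far′ m = p∩q⊆p far′ (∁ ⁅ v ⁆) m
      split : card near + card far′ ≡ card U
      split = card-split U (nbrs v)
      single : card (far′ ∩ ⁅ v ⁆) ≤ 1
      single = subst (card (far′ ∩ ⁅ v ⁆) ≤_) (∣⁅x⁆∣≡1 v) (∣p∩q∣≤∣q∣ far′ ⁅ v ⁆)
      far′≤ : card far′ ≤ suc (card far)
      far′≤ = subst (_≤ suc (card far)) (card-split far′ ⁅ v ⁆) (ℕ.+-monoˡ-≤ (card far) single)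
      X+X≤ : X + X ≤ card U
      X+X≤ = subst (_≤ card U) (cong (X +_) (ℕ.+-identityʳ X)) c
      v∉far : v ∉ far
      v∉far m = x∈∁p⇒x∉p (p∩q⊆q far′ (∁ ⁅ v ⁆) m) (x∈⁅x⁆ v)
      choose : X ≤ card near ⊎ card near < X → CliqueIn (suc k) U ⊎ IndependentIn (suc n) U
      choose (inj₁ big) with ramseyIn k (suc n) near big
      ... | inj₁ q           = inj₁ (extendClique v∈U (p∩q⊆p U _) (p∩q⊆q U _) q)
      ... | inj₂ (S , s , r) = inj₂ (S , p∩q⊆p U _ ∘ s , r)
      choose (inj₂ small) with ramseyIn (suc k) n far (subst (_≤ card far) (cong (2 ^_) (ℕ.+-suc k n)) X≤far)
        where
        X≤far : X ≤ card far
        X≤far = ℕ.+-cancelˡ-≤ X X (card far) (begin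
          X + X                   ≤⟨ X+X≤ ⟩
          card U                  ≡⟨ split ⟨
          card near + card far′   ≤⟨ ℕ.+-monoʳ-≤ (card near) far′≤ ⟩
          card near + suc (card far) ≡⟨ ℕ.+-suc _ _ ⟩
          suc (card near) + card far ≤⟨ ℕ.+-monoˡ-≤ (card far) small ⟩
          X + card far            ∎)
          where open ℕ.≤-Reasoning
      ... | inj₁ (S , s , r) = inj₁ (S , p∩q⊆p U _ ∘ far⊆far′ ∘ s , r)
      ... | inj₂ q = inj₂ (extendIndependent v∈U (p∩q⊆p U _ ∘ far⊆far′) v∉far (p∩q⊆q U _ ∘ far⊆far′) q)

  ramsey : ∀ k n → RamseyProperty k n (2 ^ (k + n))
  ramsey k n G with ramseyIn G k n full (ℕ.≤-reflexive (sym (∣⊤∣≡n _)))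
  ... | inj₁ (S , _ , c) = inj₁ (S , c)
  ... | inj₂ (S , _ , c) = inj₂ (S , c)

open RamseyTheorem

opaque
  ramseyNumber : ∀ k n → ∃ (IsLeast (RamseyProperty k n))
  ramseyNumber k n = least (ramseyProperty? k n) (2 ^ (k + n) , ramsey k n)

r : ℕ → ℕ → ℕ
r k n = proj₁ (ramseyNumber k n)

Attained : ℕ → ℕ → ℕ → ℕ → Set
Attained N k n m = ∃ λ (G : Graph N) → ¬ HasIndependent n G × cliqueCount k G ≡ m

module CompleteGraph where
  attained? : ∀ N k n → Decidable (Attained N k n)
  attained? N k n m = searchGraph {N}
    (λ {G} {H} e (¬I , c) → ¬I ∘ HasIndependent-resp (≗ᴳ-sym e)
                          , trans (sym (cliqueCount-resp k e)) c)
    (λ G → ¬? (hasIndependent? n G) ×-dec (cliqueCount k G ℕ.≟ m))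

  complete : ∀ N → Graph N
  complete N = record { adj = distinct ; symm = distinct-sym ; irrefl = distinct-irrefl }

  distinct-≢ : {i j : Fin N} → i ≢ j → T (distinct i j)
  distinct-≢ {i = i} {j} i≢j with i Fin.≟ j
  ... | yes i≡j = contradiction i≡j i≢j
  ... | no _    = _

  complete-independent : ∀ n .{{_ : NonTrivial n}} → ¬ HasIndependent n (complete N)
  complete-independent {N} n (S , c , q) with nonempty S (ℕ.≤-trans (s≤s z≤n) 2≤S)
    where
    2≤S : 2 ≤ card S
    2≤S = subst (2 ≤_) (sym c) (nonTrivial⇒n>1 n)
  ... | i , i∈S with nonempty (S ∩ ∁ ⁅ i ⁆) rest
    where
    rest : 1 ≤ card (S ∩ ∁ ⁅ i ⁆)
    rest = ℕ.+-cancelˡ-≤ 1 1 _ (begin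
      2                                                     ≤⟨ nonTrivial⇒n>1 n ⟩
      n                                                     ≡⟨ c ⟨
      card S                                                ≡⟨ card-split S ⁅ i ⁆ ⟨
      card (S ∩ ⁅ i ⁆) + card (S ∩ ∁ ⁅ i ⁆)                 ≤⟨ ℕ.+-monoˡ-≤ (card (S ∩ ∁ ⁅ i ⁆)) (∣p∩q∣≤∣q∣ S ⁅ i ⁆) ⟩
      card ⁅ i ⁆ + card (S ∩ ∁ ⁅ i ⁆)                       ≡⟨ cong (_+ card (S ∩ ∁ ⁅ i ⁆)) (∣⁅x⁆∣≡1 i) ⟩
      1 + card (S ∩ ∁ ⁅ i ⁆)                                ∎)
      where open ℕ.≤-Reasoning
  ...   | j , j∈ = q i j i∈S (p∩q⊆p S _ j∈) (distinct-≢ i≢j)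
    where
    i≢j : i ≢ j
    i≢j refl = x∈∁p⇒x∉p (p∩q⊆q S _ j∈) (x∈⁅x⁆ i)

open CompleteGraph

-- NonTrivial n, i.e. n ≥ 2, makes the complete graph a competitor, so that the
-- minimum is over a nonempty family.
opaque
  minimumCliqueCount : ∀ N k n .{{_ : NonTrivial n}} → ∃ (IsLeast (Attained N k n))
  minimumCliqueCount N k n =
    least (attained? N k n) (_ , complete N , complete-independent n , refl)

f : ∀ N k n .{{_ : NonTrivial n}} → ℕ
f N k n = proj₁ (minimumCliqueCount N k n)

IsCauchy : (ℕ → ℚ) → Set
IsCauchy x = ∀ ε → 0ℚ ℚ.< ε → ∃ λ M → ∀ m n → M ≤ m → M ≤ n → ℚ.∣ x m ℚ.- x n ∣ ℚ.≤ ε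

-- Cauchy reals.  They are only ever compared through _≤ℝ_ and _<ℝ_ below,
-- which do not depend on the representing sequence, so no quotient is needed.
record ℝ : Set where
  no-eta-equality
  field
    seq    : ℕ → ℚ
    cauchy : IsCauchy seq

open ℝ public

infix 4 _≤ℝ_ _<ℝ_

_≤ℝ_ : ℝ → ℝ → Set
x ≤ℝ y = ∀ ε → 0ℚ ℚ.< ε → ∃ λ M → ∀ n → M ≤ n → seq x n ℚ.≤ seq y n ℚ.+ ε

_<ℝ_ : ℝ → ℝ → Set
x <ℝ y = ∃ λ δ → 0ℚ ℚ.< δ × (∃ λ M → ∀ n → M ≤ n → seq x n ℚ.+ δ ℚ.≤ seq y n)

module Tolerance where
  const-cauchy : ∀ q → IsCauchy (λ _ → q)
  const-cauchy q ε 0<ε = 0 , λ _ _ _ _ →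
    subst (λ z → ℚ.∣ z ∣ ℚ.≤ ε) (sym (ℚ.+-inverseʳ q)) (ℚ.<⇒≤ 0<ε)

  ∣∣-bound : ∀ {p b} → p ℚ.≤ b → ℚ.- p ℚ.≤ b → ℚ.∣ p ∣ ℚ.≤ b
  ∣∣-bound {p} {b} p≤b -p≤b with ℚ.∣p∣≡p∨∣p∣≡-p p
  ... | inj₁ e = subst (ℚ._≤ b) (sym e) p≤b
  ... | inj₂ e = subst (ℚ._≤ b) (sym e) -p≤b

  p≤∣p∣ : ∀ p → p ℚ.≤ ℚ.∣ p ∣
  p≤∣p∣ p with ℚ.≤-total 0ℚ p
  ... | inj₁ 0≤p = ℚ.≤-reflexive (sym (ℚ.0≤p⇒∣p∣≡p 0≤p))
  ... | inj₂ p≤0 = ℚ.≤-trans p≤0 (ℚ.0≤∣p∣ p)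

  ≤⇒-≤ : ∀ {p q b} → p ℚ.≤ q ℚ.+ b → p ℚ.- q ℚ.≤ b
  ≤⇒-≤ {p} {q} {b} h = subst (p ℚ.- q ℚ.≤_) lemma (ℚ.+-monoˡ-≤ (ℚ.- q) h)
    where
    open +-*-Solver
    lemma : q ℚ.+ b ℚ.- q ≡ b
    lemma = solve 2 (λ q b → (q :+ b) :- q := b) refl q b

  ∣-∣-bound : ∀ {p q b} → p ℚ.≤ q ℚ.+ b → q ℚ.≤ p ℚ.+ b → ℚ.∣ p ℚ.- q ∣ ℚ.≤ b
  ∣-∣-bound {p} {q} {b} h k = ∣∣-bound (≤⇒-≤ h) (subst (ℚ._≤ b) lemma (≤⇒-≤ k))
    where
    open +-*-Solver
    lemma : q ℚ.- p ≡ ℚ.- (p ℚ.- q)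
    lemma = solve 2 (λ p q → q :- p := :- (p :- q)) refl p q

  *-mono-≤ : ∀ {p q r s} → 0ℚ ℚ.≤ p → 0ℚ ℚ.≤ r → p ℚ.≤ q → r ℚ.≤ s → p ℚ.* r ℚ.≤ q ℚ.* s
  *-mono-≤ {p} {q} {r} {s} 0≤p 0≤r p≤q r≤s = ℚ.≤-trans
    (ℚ.*-monoʳ-≤-nonNeg r {{ℚ.nonNegative 0≤r}} p≤q)
    (ℚ.*-monoˡ-≤-nonNeg q {{ℚ.nonNegative (ℚ.≤-trans 0≤p p≤q)}} r≤s)

  *-pos : ∀ {p q} → 0ℚ ℚ.< p → 0ℚ ℚ.< q → 0ℚ ℚ.< p ℚ.* q
  *-pos {p} {q} 0<p 0<q =
    ℚ.positive⁻¹ (p ℚ.* q) {{ℚ.pos*pos⇒pos p {{ℚ.positive 0<p}} q {{ℚ.positive 0<q}}}}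

  shrink : ∀ B ε → 0ℚ ℚ.< B → 0ℚ ℚ.< ε → ∃ λ η → 0ℚ ℚ.< η × B ℚ.* η ≡ ε
  shrink B ε 0<B 0<ε = 1/B ℚ.* ε , *-pos 0<1/B 0<ε , (begin
      B ℚ.* (1/B ℚ.* ε)   ≡⟨ ℚ.*-assoc B 1/B ε ⟨
      (B ℚ.* 1/B) ℚ.* ε   ≡⟨ cong (ℚ._* ε) (ℚ.*-inverseʳ B {{B≢0}}) ⟩
      1ℚ ℚ.* ε            ≡⟨ ℚ.*-identityˡ ε ⟩
      ε                   ∎)
    where
    open ≡-Reasoning
    B≢0 = ℚ.pos⇒nonZero B {{ℚ.positive 0<B}}
    1/B = (ℚ.1/ B) {{B≢0}}
    0<1/B : 0ℚ ℚ.< 1/B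
    0<1/B = ℚ.positive⁻¹ 1/B {{ℚ.1/pos⇒pos B {{ℚ.positive 0<B}}}}

  p-q+q : ∀ p q → (p ℚ.- q) ℚ.+ q ≡ p
  p-q+q p q = trans (ℚ.+-assoc p (ℚ.- q) q)
    (trans (cong (p ℚ.+_) (ℚ.+-inverseˡ q)) (ℚ.+-identityʳ p))

  0<1 : 0ℚ ℚ.< 1ℚ
  0<1 = ℚ.positive⁻¹ 1ℚ

  bounded : ∀ x → IsCauchy x → ∃ λ B → 0ℚ ℚ.< B × (∃ λ M → ∀ n → M ≤ n → ℚ.∣ x n ∣ ℚ.≤ B)
  bounded x c with c 1ℚ 0<1
  ... | M , close = 1ℚ ℚ.+ ℚ.∣ x M ∣ , 0<B , M , λ n M≤n → begin
      ℚ.∣ x n ∣                              ≡⟨ cong ℚ.∣_∣ (p-q+q (x n) (x M)) ⟨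
      ℚ.∣ (x n ℚ.- x M) ℚ.+ x M ∣            ≤⟨ ℚ.∣p+q∣≤∣p∣+∣q∣ (x n ℚ.- x M) (x M) ⟩
      ℚ.∣ x n ℚ.- x M ∣ ℚ.+ ℚ.∣ x M ∣        ≤⟨ ℚ.+-monoˡ-≤ ℚ.∣ x M ∣ (close n M M≤n ℕ.≤-refl) ⟩
      1ℚ ℚ.+ ℚ.∣ x M ∣                       ∎
    where
    open ℚ.≤-Reasoning
    0<B = ℚ.+-mono-<-≤ 0<1 (ℚ.0≤∣p∣ (x M))

  *-cauchy : ∀ x y → IsCauchy x → IsCauchy y → IsCauchy (λ n → x n ℚ.* y n)
  *-cauchy x y cx cy ε 0<ε = go (bounded x cx) (bounded y cy)
   where
   Bound : (ℕ → ℚ) → Set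
   Bound x = ∃ λ B → 0ℚ ℚ.< B × (∃ λ M → ∀ n → M ≤ n → ℚ.∣ x n ∣ ℚ.≤ B)
   go : Bound x → Bound y → ∃ λ M → ∀ m n → M ≤ m → M ≤ n → ℚ.∣ x m ℚ.* y m ℚ.- x n ℚ.* y n ∣ ℚ.≤ ε
   go (A , 0<A , M₁ , x≤A) (B , 0<B , M₂ , y≤B) = M , close
    where
    small = shrink (A ℚ.+ B) ε (ℚ.+-mono-< 0<A 0<B) 0<ε
    η = proj₁ small
    0<η = proj₁ (proj₂ small)
    [A+B]η≡ε = proj₂ (proj₂ small)
    M₃ = proj₁ (cx η 0<η)
    closex = proj₂ (cx η 0<η)
    M₄ = proj₁ (cy η 0<η)
    closey = proj₂ (cy η 0<η)
    open ℚ.≤-Reasoning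
    split : ∀ a b c d → a ℚ.* b ℚ.- c ℚ.* d ≡ a ℚ.* (b ℚ.- d) ℚ.+ (a ℚ.- c) ℚ.* d
    split a b c d = sym (begin-equality
      a ℚ.* (b ℚ.- d) ℚ.+ (a ℚ.- c) ℚ.* d
        ≡⟨ cong₂ ℚ._+_ (ℚ.*-distribˡ-+ a b (ℚ.- d)) (ℚ.*-distribʳ-+ d a (ℚ.- c)) ⟩
      (a ℚ.* b ℚ.+ a ℚ.* (ℚ.- d)) ℚ.+ (a ℚ.* d ℚ.+ (ℚ.- c) ℚ.* d)
        ≡⟨ ℚ.+-assoc (a ℚ.* b ℚ.+ a ℚ.* (ℚ.- d)) (a ℚ.* d) ((ℚ.- c) ℚ.* d) ⟨
      ((a ℚ.* b ℚ.+ a ℚ.* (ℚ.- d)) ℚ.+ a ℚ.* d) ℚ.+ (ℚ.- c) ℚ.* d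
        ≡⟨ cong₂ (λ u v → ((a ℚ.* b ℚ.+ u) ℚ.+ a ℚ.* d) ℚ.+ v)
             (sym (ℚ.neg-distribʳ-* a d)) (sym (ℚ.neg-distribˡ-* c d)) ⟩
      ((a ℚ.* b ℚ.- a ℚ.* d) ℚ.+ a ℚ.* d) ℚ.- c ℚ.* d
        ≡⟨ cong (ℚ._- c ℚ.* d) (p-q+q (a ℚ.* b) (a ℚ.* d)) ⟩
      a ℚ.* b ℚ.- c ℚ.* d ∎)
    factor : ∀ a b e → a ℚ.* e ℚ.+ e ℚ.* b ≡ (a ℚ.+ b) ℚ.* e
    factor a b e = trans (cong (a ℚ.* e ℚ.+_) (ℚ.*-comm e b)) (sym (ℚ.*-distribʳ-+ e a b))
    M = M₁ + M₂ + M₃ + M₄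
    M₃≤ : M₁ + M₂ + M₃ ≤ M
    M₃≤ = ℕ.m≤m+n _ M₄
    M₂≤ : M₁ + M₂ ≤ M
    M₂≤ = ℕ.≤-trans (ℕ.m≤m+n _ M₃) M₃≤
    close : ∀ m n → M ≤ m → M ≤ n → ℚ.∣ x m ℚ.* y m ℚ.- x n ℚ.* y n ∣ ℚ.≤ ε
    close m n M≤m M≤n = begin
      ℚ.∣ x m ℚ.* y m ℚ.- x n ℚ.* y n ∣
        ≡⟨ cong ℚ.∣_∣ (split (x m) (y m) (x n) (y n)) ⟩
      ℚ.∣ x m ℚ.* (y m ℚ.- y n) ℚ.+ (x m ℚ.- x n) ℚ.* y n ∣
        ≤⟨ ℚ.∣p+q∣≤∣p∣+∣q∣ (x m ℚ.* (y m ℚ.- y n)) ((x m ℚ.- x n) ℚ.* y n) ⟩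
      ℚ.∣ x m ℚ.* (y m ℚ.- y n) ∣ ℚ.+ ℚ.∣ (x m ℚ.- x n) ℚ.* y n ∣
        ≡⟨ cong₂ ℚ._+_ (ℚ.∣p*q∣≡∣p∣*∣q∣ (x m) (y m ℚ.- y n)) (ℚ.∣p*q∣≡∣p∣*∣q∣ (x m ℚ.- x n) (y n)) ⟩
      ℚ.∣ x m ∣ ℚ.* ℚ.∣ y m ℚ.- y n ∣ ℚ.+ ℚ.∣ x m ℚ.- x n ∣ ℚ.* ℚ.∣ y n ∣
        ≤⟨ ℚ.+-mono-≤
             (*-mono-≤ (ℚ.0≤∣p∣ (x m)) (ℚ.0≤∣p∣ (y m ℚ.- y n))
               (x≤A m (ℕ.≤-trans (ℕ.m≤m+n M₁ M₂) (ℕ.≤-trans M₂≤ M≤m)))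
               (closey m n (ℕ.≤-trans (ℕ.m≤n+m M₄ _) M≤m) (ℕ.≤-trans (ℕ.m≤n+m M₄ _) M≤n)))
             (*-mono-≤ (ℚ.0≤∣p∣ (x m ℚ.- x n)) (ℚ.0≤∣p∣ (y n))
               (closex m n (ℕ.≤-trans (ℕ.m≤n+m M₃ _) (ℕ.≤-trans M₃≤ M≤m))
                           (ℕ.≤-trans (ℕ.m≤n+m M₃ _) (ℕ.≤-trans M₃≤ M≤n)))
               (y≤B n (ℕ.≤-trans (ℕ.m≤n+m M₂ M₁) (ℕ.≤-trans M₂≤ M≤n)))) ⟩
      A ℚ.* η ℚ.+ η ℚ.* B
        ≡⟨ factor A B η ⟩
      (A ℚ.+ B) ℚ.* η
        ≡⟨ [A+B]η≡ε ⟩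
      ε ∎

  ^-cauchy : ∀ x k → IsCauchy x → IsCauchy (λ n → x n ^ℚ k)
  ^-cauchy x zero    c = const-cauchy 1ℚ
  ^-cauchy x (suc k) c = *-cauchy x (λ n → x n ^ℚ k) c (^-cauchy x k c)

open Tolerance

ℕ→ℚ : ℕ → ℚ
ℕ→ℚ n = ℤ.+ n ℚ./ 1

fromℚ : ℚ → ℝ
fromℚ q .seq _  = q
fromℚ q .cauchy = const-cauchy q

fromℕ : ℕ → ℝ
fromℕ n .seq _  = ℕ→ℚ n
fromℕ n .cauchy = const-cauchy (ℕ→ℚ n)

0ℝ : ℝ
0ℝ = fromℚ 0ℚ

infixl 7 _*ℝ_ _/ℝ_
infixr 8 _^ℝ_

_*ℝ_ : ℝ → ℝ → ℝ
(x *ℝ y) .seq n  = seq x n ℚ.* seq y n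
(x *ℝ y) .cauchy = *-cauchy (seq x) (seq y) (cauchy x) (cauchy y)

_^ℝ_ : ℝ → ℕ → ℝ
(x ^ℝ k) .seq n  = seq x n ^ℚ k
(x ^ℝ k) .cauchy = ^-cauchy (seq x) k (cauchy x)

record Positive (x : ℝ) : Set where
  constructor positive
  field 0<x : 0ℝ <ℝ x

-- The value at 0 is immaterial: in x /ℝ y it can only occur in finitely many
-- terms, because y is positive.
1/₀_ : ℚ → ℚ
1/₀ q with q ℚ.≟ 0ℚ
... | yes _  = 0ℚ
... | no q≢0 = (ℚ.1/ q) {{ℚ.≢-nonZero q≢0}}

module Reciprocal where
  inverseʳ : ∀ {q} → 0ℚ ℚ.< q → q ℚ.* (1/₀ q) ≡ 1ℚ
  inverseʳ {q} 0<q with q ℚ.≟ 0ℚ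
  ... | yes q≡0 = contradiction (sym q≡0) (ℚ.<⇒≢ 0<q)
  ... | no q≢0  = ℚ.*-inverseʳ q {{ℚ.≢-nonZero q≢0}}

  1/₀-pos : ∀ {q} → 0ℚ ℚ.< q → 0ℚ ℚ.< 1/₀ q
  1/₀-pos {q} 0<q = ℚ.*-cancelˡ-<-nonNeg q {{ℚ.nonNegative (ℚ.<⇒≤ 0<q)}}
    (subst₂ ℚ._<_ (sym (ℚ.*-zeroʳ q)) (sym (inverseʳ 0<q)) 0<1)

  1/₀-antimono : ∀ {p q} → 0ℚ ℚ.< p → p ℚ.≤ q → 1/₀ q ℚ.≤ 1/₀ p
  1/₀-antimono {p} {q} 0<p p≤q = ℚ.*-cancelˡ-≤-pos p {{ℚ.positive 0<p}} (begin
    p ℚ.* (1/₀ q)  ≤⟨ ℚ.*-monoʳ-≤-nonNeg (1/₀ q) {{ℚ.nonNegative (ℚ.<⇒≤ (1/₀-pos 0<q))}} p≤q ⟩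
    q ℚ.* (1/₀ q)  ≡⟨ inverseʳ 0<q ⟩
    1ℚ             ≡⟨ inverseʳ 0<p ⟨
    p ℚ.* (1/₀ p)  ∎)
    where
    open ℚ.≤-Reasoning
    0<q = ℚ.<-≤-trans 0<p p≤q

  reciprocal-gap : ∀ {p q u v w η} → p ℚ.* u ≡ 1ℚ → q ℚ.* v ≡ 1ℚ → 0ℚ ℚ.≤ u → 0ℚ ℚ.≤ v →
    u ℚ.≤ w → v ℚ.≤ w → ℚ.∣ q ℚ.- p ∣ ℚ.≤ η → ℚ.∣ u ℚ.- v ∣ ℚ.≤ (w ℚ.* w) ℚ.* η
  reciprocal-gap {p} {q} {u} {v} {w} {η} pu≡1 qv≡1 0≤u 0≤v u≤w v≤w close = begin
    ℚ.∣ u ℚ.- v ∣                          ≡⟨ cong ℚ.∣_∣ difference ⟩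
    ℚ.∣ (u ℚ.* v) ℚ.* (q ℚ.- p) ∣          ≡⟨ ℚ.∣p*q∣≡∣p∣*∣q∣ (u ℚ.* v) (q ℚ.- p) ⟩
    ℚ.∣ u ℚ.* v ∣ ℚ.* ℚ.∣ q ℚ.- p ∣        ≡⟨ cong (ℚ._* ℚ.∣ q ℚ.- p ∣) (ℚ.0≤p⇒∣p∣≡p 0≤uv) ⟩
    (u ℚ.* v) ℚ.* ℚ.∣ q ℚ.- p ∣            ≤⟨ *-mono-≤ 0≤uv (ℚ.0≤∣p∣ (q ℚ.- p)) (*-mono-≤ 0≤u 0≤v u≤w v≤w) close ⟩
    (w ℚ.* w) ℚ.* η                        ∎
    where
    open ℚ.≤-Reasoning
    0≤uv : 0ℚ ℚ.≤ u ℚ.* v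
    0≤uv = ℚ.nonNegative⁻¹ (u ℚ.* v)
      {{ℚ.nonNeg*nonNeg⇒nonNeg u {{ℚ.nonNegative 0≤u}} v {{ℚ.nonNegative 0≤v}}}}
    pull : ∀ u q v → u ℚ.* (q ℚ.* v) ≡ (u ℚ.* v) ℚ.* q
    pull u q v = trans (cong (u ℚ.*_) (ℚ.*-comm q v)) (sym (ℚ.*-assoc u v q))
    left : u ≡ (u ℚ.* v) ℚ.* q
    left = trans (sym (ℚ.*-identityʳ u)) (trans (cong (u ℚ.*_) (sym qv≡1)) (pull u q v))
    right : v ≡ (u ℚ.* v) ℚ.* p
    right = trans (sym (ℚ.*-identityʳ v)) (trans (cong (v ℚ.*_) (sym pu≡1))
      (trans (pull v p u) (cong (ℚ._* p) (ℚ.*-comm v u))))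
    difference : u ℚ.- v ≡ (u ℚ.* v) ℚ.* (q ℚ.- p)
    difference = trans (cong₂ ℚ._-_ left right)
      (trans (cong ((u ℚ.* v) ℚ.* q ℚ.+_) (ℚ.neg-distribʳ-* (u ℚ.* v) p))
             (sym (ℚ.*-distribˡ-+ (u ℚ.* v) q (ℚ.- p))))

  1/₀-cauchy : ∀ x → IsCauchy x → (∃ λ δ → 0ℚ ℚ.< δ × (∃ λ M → ∀ n → M ≤ n → 0ℚ ℚ.+ δ ℚ.≤ x n)) →
               IsCauchy (λ n → 1/₀ (x n))
  1/₀-cauchy x c (δ , 0<δ , M₁ , low) ε 0<ε
    = M₁ + M₂ , gap
    where
    small = shrink (1/₀ δ ℚ.* (1/₀ δ)) ε (*-pos (1/₀-pos 0<δ) (1/₀-pos 0<δ)) 0<ε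
    η = proj₁ small
    M₂ = proj₁ (c η (proj₁ (proj₂ small)))
    close = proj₂ (c η (proj₁ (proj₂ small)))
    δ≤ : ∀ n → M₁ + M₂ ≤ n → δ ℚ.≤ x n
    δ≤ n M≤n = subst (ℚ._≤ x n) (ℚ.+-identityˡ δ) (low n (ℕ.≤-trans (ℕ.m≤m+n M₁ M₂) M≤n))
    gap : ∀ m n → M₁ + M₂ ≤ m → M₁ + M₂ ≤ n → ℚ.∣ 1/₀ (x m) ℚ.- (1/₀ (x n)) ∣ ℚ.≤ ε
    gap m n M≤m M≤n = subst (ℚ.∣ 1/₀ (x m) ℚ.- (1/₀ (x n)) ∣ ℚ.≤_) (proj₂ (proj₂ small))
      (reciprocal-gap {p = x m} {q = x n} {u = 1/₀ (x m)} {v = 1/₀ (x n)} {w = 1/₀ δ} {η = η}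
        (inverseʳ 0<m) (inverseʳ 0<n) (ℚ.<⇒≤ (1/₀-pos 0<m)) (ℚ.<⇒≤ (1/₀-pos 0<n))
        (1/₀-antimono 0<δ (δ≤ m M≤m)) (1/₀-antimono 0<δ (δ≤ n M≤n))
        (close n m (ℕ.≤-trans (ℕ.m≤n+m M₂ M₁) M≤n) (ℕ.≤-trans (ℕ.m≤n+m M₂ M₁) M≤m)))
      where
      0<m = ℚ.<-≤-trans 0<δ (δ≤ m M≤m)
      0<n = ℚ.<-≤-trans 0<δ (δ≤ n M≤n)

open Reciprocal

_/ℝ_ : (x y : ℝ) {{_ : Positive y}} → ℝ
(x /ℝ y) .seq n                   = seq x n ℚ.* (1/₀ seq y n)
_/ℝ_ x y {{positive 0<y}} .cauchy =
  *-cauchy (seq x) (λ n → 1/₀ seq y n) (cauchy x) (1/₀-cauchy (seq y) (cauchy y) 0<y)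

∑ : ℕ → (ℕ → ℚ) → ℚ
∑ zero    a = 0ℚ
∑ (suc l) a = ∑ l a ℚ.+ a l

module RiemannSums where
  ∑-mono : ∀ l {a b : ℕ → ℚ} → (∀ i → i < l → a i ℚ.≤ b i) → ∑ l a ℚ.≤ ∑ l b
  ∑-mono zero    a≤b = ℚ.≤-refl
  ∑-mono (suc l) a≤b = ℚ.+-mono-≤ (∑-mono l λ i i<l → a≤b i (ℕ.m<n⇒m<1+n i<l)) (a≤b l ℕ.≤-refl)

  ∑-cong : ∀ l {a b : ℕ → ℚ} → (∀ i → a i ≡ b i) → ∑ l a ≡ ∑ l b
  ∑-cong zero    a≡b = refl
  ∑-cong (suc l) a≡b = cong₂ ℚ._+_ (∑-cong l a≡b) (a≡b l)

  ∑-++ : ∀ k l (a : ℕ → ℚ) → ∑ (k + l) a ≡ ∑ k a ℚ.+ ∑ l (λ i → a (k + i))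
  ∑-++ k zero    a = trans (cong (λ z → ∑ z a) (ℕ.+-identityʳ k)) (sym (ℚ.+-identityʳ (∑ k a)))
  ∑-++ k (suc l) a = begin
    ∑ (k + suc l) a                                       ≡⟨ cong (λ z → ∑ z a) (ℕ.+-suc k l) ⟩
    ∑ (k + l) a ℚ.+ a (k + l)                             ≡⟨ cong (ℚ._+ a (k + l)) (∑-++ k l a) ⟩
    ∑ k a ℚ.+ ∑ l (λ i → a (k + i)) ℚ.+ a (k + l)         ≡⟨ ℚ.+-assoc (∑ k a) _ _ ⟩
    ∑ k a ℚ.+ (∑ l (λ i → a (k + i)) ℚ.+ a (k + l))       ∎
    where open ≡-Reasoning

  ∑-blocks : ∀ l k (a : ℕ → ℚ) → ∑ (l * k) a ≡ ∑ l (λ i → ∑ k (λ j → a (i * k + j)))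
  ∑-blocks zero    k a = refl
  ∑-blocks (suc l) k a = begin
    ∑ (k + l * k) a                                  ≡⟨ cong (λ z → ∑ z a) (ℕ.+-comm k (l * k)) ⟩
    ∑ (l * k + k) a                                  ≡⟨ ∑-++ (l * k) k a ⟩
    ∑ (l * k) a ℚ.+ ∑ k (λ j → a (l * k + j))        ≡⟨ cong (ℚ._+ ∑ k (λ j → a (l * k + j))) (∑-blocks l k a) ⟩
    ∑ (suc l) (λ i → ∑ k (λ j → a (i * k + j)))      ∎
    where open ≡-Reasoning

  ℕ→ℚ-suc : ∀ l → ℕ→ℚ l ℚ.+ 1ℚ ≡ ℕ→ℚ (suc l)
  ℕ→ℚ-suc l = ℚ.toℚᵘ-injective (begin-equality
    ℚ.toℚᵘ (ℕ→ℚ l ℚ.+ 1ℚ)              ≃⟨ ℚ.toℚᵘ-homo-+ (ℕ→ℚ l) 1ℚ ⟩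
    ℚ.toℚᵘ (ℕ→ℚ l) ℚᵘ.+ ℚᵘ.1ℚᵘ         ≃⟨ ℚᵘ.+-congˡ ℚᵘ.1ℚᵘ (ℚ.toℚᵘ-fromℚᵘ (ℚᵘ.mkℚᵘ (ℤ.+ l) 0)) ⟩
    ℚᵘ.mkℚᵘ (ℤ.+ l) 0 ℚᵘ.+ ℚᵘ.1ℚᵘ      ≃⟨ ℚᵘ.*≡* (cong (ℤ._* ℤ.+ 1) (lemma l)) ⟩
    ℚᵘ.mkℚᵘ (ℤ.+ suc l) 0              ≃⟨ ℚ.toℚᵘ-fromℚᵘ (ℚᵘ.mkℚᵘ (ℤ.+ suc l) 0) ⟨
    ℚ.toℚᵘ (ℕ→ℚ (suc l))               ∎)
    where
    open ℚᵘ.≤-Reasoning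
    lemma : ∀ l → ℤ.+ l ℤ.* ℤ.+ 1 ℤ.+ ℤ.+ 1 ≡ ℤ.+ suc l
    lemma l = trans (cong (ℤ._+ ℤ.+ 1) (ℤ.*-identityʳ (ℤ.+ l))) (cong ℤ.+_ (ℕ.+-comm l 1))

  ∑-const : ∀ l q → ∑ l (λ _ → q) ≡ ℕ→ℚ l ℚ.* q
  ∑-const zero    q = sym (ℚ.*-zeroˡ q)
  ∑-const (suc l) q = begin
    ∑ l (λ _ → q) ℚ.+ q           ≡⟨ cong (ℚ._+ q) (∑-const l q) ⟩
    ℕ→ℚ l ℚ.* q ℚ.+ q             ≡⟨ cong (ℕ→ℚ l ℚ.* q ℚ.+_) (ℚ.*-identityˡ q) ⟨
    ℕ→ℚ l ℚ.* q ℚ.+ 1ℚ ℚ.* q      ≡⟨ ℚ.*-distribʳ-+ q (ℕ→ℚ l) 1ℚ ⟨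
    (ℕ→ℚ l ℚ.+ 1ℚ) ℚ.* q          ≡⟨ cong (ℚ._* q) (ℕ→ℚ-suc l) ⟩
    ℕ→ℚ (suc l) ℚ.* q             ∎
    where
    open ≡-Reasoning

  unit : ℕ → ℚ
  unit zero    = 0ℚ
  unit (suc s) = ℤ.+ 1 ℚ./ suc s

  unit-nonNeg : ∀ s → 0ℚ ℚ.≤ unit s
  unit-nonNeg zero    = ℚ.≤-refl
  unit-nonNeg (suc s) = ℚ.nonNegative⁻¹ (unit (suc s)) {{ℚ.normalize-nonNeg 1 (suc s)}}

  unit-antimono : ∀ {s t} .{{_ : NonZero s}} → s ≤ t → unit t ℚ.≤ unit s
  unit-antimono {suc s} {suc t} s≤t = ℚ.toℚᵘ-cancel-≤
    (ℚᵘ.≤-respˡ-≃ (ℚᵘ.≃-sym (ℚ.toℚᵘ-fromℚᵘ (ℚᵘ.mkℚᵘ (ℤ.+ 1) t)))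
      (ℚᵘ.≤-respʳ-≃ (ℚᵘ.≃-sym (ℚ.toℚᵘ-fromℚᵘ (ℚᵘ.mkℚᵘ (ℤ.+ 1) s)))
        (ℚᵘ.*≤* (ℤ.*-monoˡ-≤-nonNeg (ℤ.+ 1) (ℤ.+≤+ s≤t)))))

  unit-scale : ∀ s k .{{_ : NonZero s}} .{{_ : NonZero k}} → ℕ→ℚ k ℚ.* unit (s * k) ≡ unit s
  unit-scale (suc s) (suc k) = ℚ.toℚᵘ-injective (begin-equality
    ℚ.toℚᵘ (ℕ→ℚ (suc k) ℚ.* unit (suc s * suc k))              ≃⟨ ℚ.toℚᵘ-homo-* (ℕ→ℚ (suc k)) (unit (suc s * suc k)) ⟩
    ℚ.toℚᵘ (ℕ→ℚ (suc k)) ℚᵘ.* ℚ.toℚᵘ (unit (suc s * suc k))    ≃⟨ ℚᵘ.*-cong (ℚ.toℚᵘ-fromℚᵘ (ℚᵘ.mkℚᵘ (ℤ.+ suc k) 0)) (ℚ.toℚᵘ-fromℚᵘ (ℚᵘ.mkℚᵘ (ℤ.+ 1) (k + s * suc k))) ⟩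
    ℚᵘ.mkℚᵘ (ℤ.+ suc k) 0 ℚᵘ.* ℚᵘ.mkℚᵘ (ℤ.+ 1) (k + s * suc k) ≃⟨ ℚᵘ.*≡* (cong ℤ.+_ lemma) ⟩
    ℚᵘ.mkℚᵘ (ℤ.+ 1) s                                          ≃⟨ ℚ.toℚᵘ-fromℚᵘ (ℚᵘ.mkℚᵘ (ℤ.+ 1) s) ⟨
    ℚ.toℚᵘ (unit (suc s))                                      ∎)
    where
    open ℚᵘ.≤-Reasoning
    lemma : suc k * 1 * suc s ≡ 1 * (1 * (suc s * suc k))
    lemma = trans (cong (_* suc s) (ℕ.*-identityʳ (suc k)))
      (trans (ℕ.*-comm (suc k) (suc s))
        (sym (trans (ℕ.*-identityˡ _) (ℕ.*-identityˡ _))))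

  archimedean : ∀ ε → 0ℚ ℚ.< ε → ∃ λ K → unit (suc K) ℚ.≤ ε
  archimedean ε@(mkℚ (ℤ.+ zero)  d c) (ℚ.*<* (ℤ.+<+ ()))
  archimedean ε@(mkℚ ℤ.-[1+ _ ]  d c) (ℚ.*<* ())
  archimedean ε@(mkℚ ℤ.+[1+ a ]  d c) 0<ε = d , ℚ.toℚᵘ-cancel-≤
    (ℚᵘ.≤-respˡ-≃ (ℚᵘ.≃-sym (ℚ.toℚᵘ-fromℚᵘ (ℚᵘ.mkℚᵘ (ℤ.+ 1) d)))
      (ℚᵘ.*≤* (ℤ.*-monoʳ-≤-nonNeg (ℤ.+ suc d) {ℤ.+ 1} {ℤ.+ suc a} (ℤ.+≤+ (s≤s z≤n)))))

  +-nonZeroˡ : ∀ m n .{{_ : NonZero m}} → NonZero (m + n)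
  +-nonZeroˡ (suc m) n = _

  riemann : ℕ → ℕ → ℚ
  riemann n M = ∑ ((n ∸ 1) * M) (λ i → unit (M + i))

  module _ (n M K : ℕ) .{{_ : NonZero M}} .{{_ : NonZero K}} where
    private
      l = (n ∸ 1) * M

      nonZero : ∀ i → NonZero (M + i)
      nonZero i = +-nonZeroˡ M i

      block : ℕ → ℚ
      block i = ∑ K (λ j → unit (M * K + (i * K + j)))

      refined : riemann n (M * K) ≡ ∑ l block
      refined = trans (cong (λ z → ∑ z (λ i → unit (M * K + i))) (sym (ℕ.*-assoc (n ∸ 1) M K)))
                      (∑-blocks l K (λ i → unit (M * K + i)))

      constant : ∀ s .{{_ : NonZero s}} → ∑ K (λ _ → unit (s * K)) ≡ unit s
      constant s = trans (∑-const K (unit (s * K))) (unit-scale s K)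

      regroup : ∀ i j → M * K + (i * K + j) ≡ (M + i) * K + j
      regroup i j = trans (sym (ℕ.+-assoc (M * K) (i * K) j)) (cong (_+ j) (sym (ℕ.*-distribʳ-+ K M i)))

      block-upper : ∀ i → block i ℚ.≤ unit (M + i)
      block-upper i = subst (block i ℚ.≤_) (constant (M + i) {{nonZero i}})
        (∑-mono K λ j _ → unit-antimono {{ℕ.m*n≢0 (M + i) K {{nonZero i}}}}
          (ℕ.≤-trans (ℕ.m≤m+n ((M + i) * K) j) (ℕ.≤-reflexive (sym (regroup i j)))))

      block-lower : ∀ i → unit (M + suc i) ℚ.≤ block i
      block-lower i = subst (ℚ._≤ block i) (constant (M + suc i) {{nonZero (suc i)}})
        (∑-mono K λ j j<K → unit-antimono {{subst NonZero (sym (regroup i j)) (+-nonZeroˡ ((M + i) * K) j {{ℕ.m*n≢0 (M + i) K {{nonZero i}}}})}}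
          (bound j j<K))
        where
        bound : ∀ j → j < K → M * K + (i * K + j) ≤ (M + suc i) * K
        bound j j<K = begin
          M * K + (i * K + j)    ≡⟨ regroup i j ⟩
          (M + i) * K + j        ≤⟨ ℕ.+-monoʳ-≤ ((M + i) * K) (ℕ.<⇒≤ j<K) ⟩
          (M + i) * K + K        ≡⟨ ℕ.+-comm ((M + i) * K) K ⟩
          suc (M + i) * K        ≡⟨ cong (_* K) (ℕ.+-suc M i) ⟨
          (M + suc i) * K        ∎
          where open ℕ.≤-Reasoning

      shift : ∀ l → ∑ l (λ i → unit (M + i)) ℚ.≤ ∑ l (λ i → unit (M + suc i)) ℚ.+ unit M
      shift l = begin
        ∑ l (λ i → unit (M + i))                                       ≡⟨ ℚ.+-identityʳ _ ⟨
        ∑ l (λ i → unit (M + i)) ℚ.+ 0ℚ                                ≤⟨ ℚ.+-monoʳ-≤ (∑ l (λ i → unit (M + i))) (unit-nonNeg (M + l)) ⟩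
        ∑ (1 + l) (λ i → unit (M + i))                                 ≡⟨ ∑-++ 1 l (λ i → unit (M + i)) ⟩
        (0ℚ ℚ.+ unit (M + 0)) ℚ.+ ∑ l (λ i → unit (M + suc i))         ≡⟨ cong (ℚ._+ ∑ l (λ i → unit (M + suc i))) (trans (ℚ.+-identityˡ _) (cong unit (ℕ.+-identityʳ M))) ⟩
        unit M ℚ.+ ∑ l (λ i → unit (M + suc i))                        ≡⟨ ℚ.+-comm (unit M) _ ⟩
        ∑ l (λ i → unit (M + suc i)) ℚ.+ unit M                        ∎
        where open ℚ.≤-Reasoning

    refine-≤ : riemann n (M * K) ℚ.≤ riemann n M
    refine-≤ = subst (ℚ._≤ riemann n M) (sym refined) (∑-mono l λ i _ → block-upper i)

    refine-≥ : riemann n M ℚ.≤ riemann n (M * K) ℚ.+ unit M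
    refine-≥ = ℚ.≤-trans (shift l) (ℚ.+-monoˡ-≤ (unit M)
      (subst (∑ l (λ i → unit (M + suc i)) ℚ.≤_) (sym refined) (∑-mono l λ i _ → block-lower i)))

  riemann-close : ∀ n M K .{{_ : NonZero M}} .{{_ : NonZero K}} →
                  riemann n M ℚ.≤ riemann n K ℚ.+ unit M
  riemann-close n M K = ℚ.≤-trans (refine-≥ n M K)
    (ℚ.+-monoˡ-≤ (unit M) (subst (λ z → riemann n z ℚ.≤ riemann n K) (ℕ.*-comm K M) (refine-≤ n K M)))

  riemann-cauchy : ∀ n → IsCauchy (λ m → riemann n (suc m))
  riemann-cauchy n ε 0<ε = K , λ m p K≤m K≤p → ∣-∣-bound (one-sided m p K≤m) (one-sided p m K≤p)
    where
    K = proj₁ (archimedean ε 0<ε)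
    one-sided : ∀ m p → K ≤ m → riemann n (suc m) ℚ.≤ riemann n (suc p) ℚ.+ ε
    one-sided m p K≤m = ℚ.≤-trans (riemann-close n (suc m) (suc p))
      (ℚ.+-monoʳ-≤ (riemann n (suc p))
        (ℚ.≤-trans (unit-antimono (s≤s K≤m)) (proj₂ (archimedean ε 0<ε))))

  riemann-pos : ∀ c M .{{_ : NonZero M}} → unit 2 ℚ.≤ riemann (2 + c) M
  riemann-pos c M = begin
    unit 2                                            ≡⟨ unit-scale 2 M ⟨
    ℕ→ℚ M ℚ.* unit (2 * M)                            ≡⟨ ∑-const M (unit (2 * M)) ⟨
    ∑ M (λ _ → unit (2 * M))                          ≤⟨ ∑-mono M (λ i i<M → unit-antimono {{+-nonZeroˡ M i}} (ℕ.+-monoʳ-≤ M (ℕ.≤-trans (ℕ.<⇒≤ i<M) (ℕ.m≤m+n M 0)))) ⟩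
    ∑ M (λ i → unit (M + i))                          ≡⟨ ℚ.+-identityʳ _ ⟨
    ∑ M (λ i → unit (M + i)) ℚ.+ 0ℚ                   ≤⟨ ℚ.+-monoʳ-≤ (∑ M (λ i → unit (M + i))) tail ⟩
    ∑ M (λ i → unit (M + i)) ℚ.+ ∑ (c * M) (λ i → unit (M + (M + i)))  ≡⟨ ∑-++ M (c * M) (λ i → unit (M + i)) ⟨
    riemann (2 + c) M                                 ∎
    where
    open ℚ.≤-Reasoning
    tail : 0ℚ ℚ.≤ ∑ (c * M) (λ i → unit (M + (M + i)))
    tail = subst (ℚ._≤ ∑ (c * M) (λ i → unit (M + (M + i)))) (trans (∑-const (c * M) 0ℚ) (ℚ.*-zeroʳ (ℕ→ℚ (c * M))))
      (∑-mono (c * M) λ i _ → unit-nonNeg (M + (M + i)))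

open RiemannSums

-- The natural logarithm as ∫₁ⁿ dx/x.  With M = suc m, term m of the sequence is
-- the left Riemann sum of mesh 1/M: the node x = 1 + i/M, for 0 ≤ i < (n - 1)M,
-- contributes (1/M) · 1/x = 1/(M + i).  Only used for n ≥ 1.
log : ℕ → ℝ
log n .seq m  = ∑ ((n ∸ 1) * suc m) (λ i → ℤ.+ 1 ℚ./ (suc m + i))
log n .cauchy = riemann-cauchy n

module Powers where
  ^ℚ-pos : ∀ k {q} → 0ℚ ℚ.< q → 0ℚ ℚ.< q ^ℚ k
  ^ℚ-pos zero    0<q = 0<1
  ^ℚ-pos (suc k) 0<q = *-pos 0<q (^ℚ-pos k 0<q)

  ^ℚ-mono : ∀ k {p q} → 0ℚ ℚ.< p → p ℚ.≤ q → p ^ℚ k ℚ.≤ q ^ℚ k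
  ^ℚ-mono zero    0<p p≤q = ℚ.≤-refl
  ^ℚ-mono (suc k) 0<p p≤q = *-mono-≤ (ℚ.<⇒≤ 0<p) (ℚ.<⇒≤ (^ℚ-pos k 0<p)) p≤q (^ℚ-mono k 0<p p≤q)

open Powers

instance
  fromℕ-positive : ∀ {n} .{{_ : NonTrivial n}} → Positive (fromℕ n)
  fromℕ-positive {suc n} = positive (ℕ→ℚ (suc n) , ℚ.positive⁻¹ (ℕ→ℚ (suc n)) {{ℚ.normalize-pos (suc n) 1}} , 0 , λ _ _ →
    ℚ.≤-reflexive (ℚ.+-identityˡ (ℕ→ℚ (suc n))))

  log-positive : ∀ {n} .{{_ : NonTrivial n}} → Positive (log n)
  log-positive {suc (suc c)} = positive (½ , ℚ.positive⁻¹ ½ , 0 , λ m _ → riemann-pos c (suc m))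

  ^-positive : ∀ {x k} {{_ : Positive x}} → Positive (x ^ℝ k)
  ^-positive {x} {k} {{positive (δ , 0<δ , M , low)}} =
    positive (δ ^ℚ k , ^ℚ-pos k 0<δ , M , λ n M≤n →
      subst (ℚ._≤ seq x n ^ℚ k) (sym (ℚ.+-identityˡ (δ ^ℚ k)))
        (^ℚ-mono k 0<δ (subst (ℚ._≤ seq x n) (ℚ.+-identityˡ δ) (low n M≤n))))

{-# OPTIONS --safe #-}
module Submission where

-- For N < r(k,n) we have f(N,k,n) = 0, so only N ≥ r(k,n) needs an upper bound.
-- Take a K_k-free graph H on M = r(k,n) - 1 vertices without independent n-sets,
-- and replace each vertex by a clique of size about N/M.  Choose the vertices of a
-- k-clique of the blow-up one at a time.  The image in H of a new vertex either
-- repeats one of the images chosen so far (at most k choices) or is a common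
-- neighbour of them; j distinct images leave a K_{k-j}-free set of common
-- neighbours, so at least one repetition must occur.  Hence the number of
-- k-cliques is O((N/M)^k ρ_k ⋯ ρ_2), where ρ_j bounds the size of a K_j-free set
-- of vertices of H.
--
-- The bound ρ_j = O(n^(j-1) / (log n)^(j-2)) of Ajtai, Komlós and Szemerédi is
-- obtained from the hard-core model.  Let W be a random independent subset of a
-- K_j-free set U, with weight proportional to λ^|W|, where 1/λ is of the order
-- of ρ_{j-2}, a bound for the codegrees in U.  Given W away from v and its
-- neighbours, either few neighbours of v are still available, and then v itself
-- is likely to be in W, or many are, and then W contains many of them.  Hence
-- D P(v ∈ W) + E|W ∩ N(v)| ≥ c log n with D = ρ_{j-1}, and summing over v ∈ U
-- gives |U| log n = O(D n).

open import Defs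
import Algebra.Definitions.RawSemiring as RawSemiring
open import Data.Bool using (true; false; _∧_; _∨_)
open import Data.Fin using (Fin; zero; suc; inject≤; remQuot; combine)
import Data.Fin.Properties as Fin
open import Data.Fin.Subset using (Subset; inside; outside; _∈_; _∉_; _⊆_; _∪_; _∩_; ∁; ⁅_⁆)
  renaming (∣_∣ to card; ⊥ to ∅; ⊤ to full)
open import Data.Fin.Subset.Properties
open import Data.List using (List; []; _∷_; _++_; map; filter; length)
import Data.List.Properties as List
open import Data.Nat
  using (ℕ; zero; suc; _+_; _*_; _∸_; _^_; _/_; _%_; _≤_; _<_; z≤n; s≤s; NonZero; NonTrivial;
         >-nonZero; >-nonZero⁻¹; nonTrivial⇒n>1)
open import Data.Nat.Combinatorics using (_C_; nCk+nC[k+1]≡[n+1]C[k+1]; k>n⇒nCk≡0; nC1≡n)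
open import Data.Nat.DivMod using (m≡m%n+[m/n]*n; m%n<n; m/n*n≤m)
import Data.Nat.Properties as ℕ
open import Data.Nat.Solver using (module +-*-Solver)
open import Data.Product using (∃; _×_; _,_; proj₁; proj₂; uncurry)
open import Data.Rational using (ℚ; 0ℚ; 1ℚ; ½)
import Data.Rational as ℚ
import Data.Rational.Properties as ℚ
open import Data.Rational.Solver using () renaming (module +-*-Solver to ℚ-Solver)
open import Data.Sum using (_⊎_; inj₁; inj₂)
open import Data.Vec using ([]; _∷_; lookup; tabulate; here; there; _[_]≔_)
open import Data.Vec.Properties
  using (lookup∘update; lookup∘update′; lookup∘tabulate; []=⇒lookup; lookup⇒[]=; []≔-updates)
open import Function using (_∘_)
open import Relation.Binary.PropositionalEquality
  using (_≡_; _≢_; refl; sym; trans; cong; cong₂; subst; subst₂; module ≡-Reasoning)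
open import Relation.Nullary using (¬_; Dec; yes; no; does; contradiction)
open import Relation.Nullary.Decidable
  using (_×-dec_; _→-dec_; ¬?; T?; ⌊_⌋; decidable-stable; dec-true)
open import Relation.Unary using (Decidable)

open import Algebra.Properties.Semiring.Sum ℕ.+-*-semiring
  using (sum; sum-cong-≗; ∑-comm; ∑-distrib-+; *-distribˡ-sum; *-distribʳ-sum)
open +-*-Solver using (solve; _:+_; _:*_; _:=_; con)
open RawSemiring ℚ.+-*-rawSemiring using () renaming (_^_ to _^ℚ_)

open Searching
open GraphSearch using
  (searchGraph; _≗ᴳ_; ≗ᴳ-sym; IsKClique-resp; HasIndependent-resp; distinct; distinct-sym; distinct-irrefl)
open RamseyTheorem
open CompleteGraph using (complete; complete-independent)
open Tolerance
open Reciprocal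
open RiemannSums
open Powers

-- The powers of the logarithm balance exactly. With `Q` of order n / log n the bounds are ρ_j = n
-- Q^(j-2), so ρ_k ⋯ ρ_2 = n^(k-1) Q^C(k-1,2). By the lower bound on r(k,n), dividing by M^k leaves
-- n^(-C(k,2)) and the exponent k(k-2) - C(k-1,2) = C(k,2) - 1 on the logarithm: this is the extra
-- factor 1 / log n. Each step from ρ_(j-1) to ρ_j gains a logarithm because the degree bound
-- exceeds the codegree bound by a power of n. The threshold between few and many available
-- neighbours is proportional to τ times the codegree bound; below it, v is chosen with probability
-- at least 2^(-τ) divided by that bound. Both cases yield τ as long as τ 2^τ is at most the ratio
-- of the two bounds, up to a constant. Until the very end all inequalities are between natural
-- numbers, with τ = ⌊log_8 n⌋ in place of log n and probabilities cleared of their denominators.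

private variable
  Φ Ψ : Set
  M N : ℕ

-- Weighted sums over the subsets of a finite set

⟦_⟧ : Dec Φ → ℕ
⟦ yes _ ⟧ = 1
⟦ no  _ ⟧ = 0

⟦⟧-yes : (a? : Dec Φ) → Φ → ⟦ a? ⟧ ≡ 1
⟦⟧-yes (yes _) a = refl
⟦⟧-yes (no ¬a) a = contradiction a ¬a

⟦⟧-no : (a? : Dec Φ) → ¬ Φ → ⟦ a? ⟧ ≡ 0
⟦⟧-no (yes a) ¬a = contradiction a ¬a
⟦⟧-no (no _)  ¬a = refl

1≤⟦⟧ : (a? : Dec Φ) → Φ → 1 ≤ ⟦ a? ⟧
1≤⟦⟧ a? a = ℕ.≤-reflexive (sym (⟦⟧-yes a? a))

⟦⟧≤1 : (a? : Dec Φ) → ⟦ a? ⟧ ≤ 1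
⟦⟧≤1 (yes _) = s≤s z≤n
⟦⟧≤1 (no _)  = z≤n

⟦⟧-≤ : ∀ {m} (a? : Dec Φ) → (Φ → 1 ≤ m) → ⟦ a? ⟧ ≤ m
⟦⟧-≤ (yes a) h = h a
⟦⟧-≤ (no _)  h = z≤n

⟦⟧-mono : (a? : Dec Φ) (b? : Dec Ψ) → (Φ → Ψ) → ⟦ a? ⟧ ≤ ⟦ b? ⟧
⟦⟧-mono a? b? a⇒b = ⟦⟧-≤ a? λ a → 1≤⟦⟧ b? (a⇒b a)

⟦⟧-cong : (a? : Dec Φ) (b? : Dec Ψ) → (Φ → Ψ) → (Ψ → Φ) → ⟦ a? ⟧ ≡ ⟦ b? ⟧
⟦⟧-cong a? b? a⇒b b⇒a = ℕ.≤-antisym (⟦⟧-mono a? b? a⇒b) (⟦⟧-mono b? a? b⇒a)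

sum-mono : {f g : Fin N → ℕ} → (∀ i → f i ≤ g i) → sum f ≤ sum g
sum-mono {zero}  f≤g = z≤n
sum-mono {suc N} f≤g = ℕ.+-mono-≤ (f≤g zero) (sum-mono (f≤g ∘ suc))

card≡sum : (S : Subset N) → card S ≡ sum (λ i → ⟦ i ∈? S ⟧)
card≡sum []            = refl
card≡sum (inside ∷ S)  = cong suc (trans (card≡sum S)
  (sum-cong-≗ λ i → ⟦⟧-cong (i ∈? S) (suc i ∈? (inside ∷ S)) there drop-there))
card≡sum (outside ∷ S) = trans (card≡sum S)
  (sum-cong-≗ λ i → ⟦⟧-cong (i ∈? S) (suc i ∈? (outside ∷ S)) there drop-there)

-- Every element outside the subset has weight Δ: up to normalisation, this is the
-- product measure of the hard-core model with fugacity 1/Δ.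
wsum : ℕ → (Subset N → ℕ) → ℕ
wsum {zero}  Δ g = g []
wsum {suc N} Δ g = Δ * wsum Δ (g ∘ (outside ∷_)) + wsum Δ (g ∘ (inside ∷_))

AgreeOff : Subset N → Subset N → Subset N → Set
AgreeOff P W W′ = ∀ i → i ∉ P → lookup W i ≡ lookup W′ i

private
  keep : ∀ {P W W′ : Subset N} {b} → AgreeOff P W W′ → AgreeOff (outside ∷ P) (b ∷ W) (b ∷ W′)
  keep a zero    _   = refl
  keep a (suc i) i∉P = a i (i∉P ∘ there)

  change : ∀ {P W W′ : Subset N} {b c} → AgreeOff P W W′ → AgreeOff (inside ∷ P) (b ∷ W) (c ∷ W′)
  change a zero    i∉P = contradiction here i∉P
  change a (suc i) i∉P = a i (i∉P ∘ there)

module _ (Δ : ℕ) where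
  wsum-mono : {g h : Subset N → ℕ} → (∀ S → g S ≤ h S) → wsum Δ g ≤ wsum Δ h
  wsum-mono {zero}  g≤h = g≤h []
  wsum-mono {suc N} g≤h = ℕ.+-mono-≤ (ℕ.*-monoʳ-≤ Δ (wsum-mono (g≤h ∘ (outside ∷_)))) (wsum-mono (g≤h ∘ (inside ∷_)))

  wsum-cong : {g h : Subset N → ℕ} → (∀ S → g S ≡ h S) → wsum Δ g ≡ wsum Δ h
  wsum-cong {zero}  g≡h = g≡h []
  wsum-cong {suc N} g≡h = cong₂ _+_ (cong (Δ *_) (wsum-cong (g≡h ∘ (outside ∷_)))) (wsum-cong (g≡h ∘ (inside ∷_)))

  wsum-+ : (g h : Subset N → ℕ) → wsum Δ (λ S → g S + h S) ≡ wsum Δ g + wsum Δ h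
  wsum-+ {zero}  g h = refl
  wsum-+ {suc N} g h
    rewrite wsum-+ (g ∘ (outside ∷_)) (h ∘ (outside ∷_)) | wsum-+ (g ∘ (inside ∷_)) (h ∘ (inside ∷_)) =
    solve 5 (λ d a b c e → d :* (a :+ b) :+ (c :+ e) := (d :* a :+ c) :+ (d :* b :+ e)) refl Δ
      (wsum Δ (g ∘ (outside ∷_))) (wsum Δ (h ∘ (outside ∷_))) (wsum Δ (g ∘ (inside ∷_))) (wsum Δ (h ∘ (inside ∷_)))

  wsum-* : ∀ c (g : Subset N → ℕ) → wsum Δ (λ S → c * g S) ≡ c * wsum Δ g
  wsum-* {zero}  c g = refl
  wsum-* {suc N} c g
    rewrite wsum-* c (g ∘ (outside ∷_)) | wsum-* c (g ∘ (inside ∷_)) =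
    solve 4 (λ d c a b → d :* (c :* a) :+ c :* b := c :* (d :* a :+ b)) refl Δ c
      (wsum Δ (g ∘ (outside ∷_))) (wsum Δ (g ∘ (inside ∷_)))

  wsum-zero : wsum {N} Δ (λ _ → 0) ≡ 0
  wsum-zero {N} = wsum-* {N} 0 (λ _ → 0)

  wsum-sum : ∀ {M} (g : Fin M → Subset N → ℕ) → wsum Δ (λ S → sum (λ i → g i S)) ≡ sum (λ i → wsum Δ (g i))
  wsum-sum {N} {zero}  g = wsum-zero {N}
  wsum-sum {M = suc M} g = trans (wsum-+ (g zero) (λ S → sum (λ i → g (suc i) S)))
    (cong (wsum Δ (g zero) +_) (wsum-sum (g ∘ suc)))

  -- Adding `v` is injective on the sets without `v` and turns one weight `Δ` into 1.
  wsum-insert : ∀ v {g h : Subset N → ℕ} → (∀ S → v ∉ S → g S ≤ h (S [ v ]≔ inside)) →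
                (∀ S → v ∈ S → g S ≡ 0) → wsum Δ g ≤ Δ * wsum Δ h
  wsum-insert {suc N} zero {g} {h} g≤h g≡0 = begin
    Δ * wsum Δ (g ∘ (outside ∷_)) + wsum Δ (g ∘ (inside ∷_))
      ≡⟨ cong (Δ * wsum Δ (g ∘ (outside ∷_)) +_) (trans (wsum-cong (λ S → g≡0 (inside ∷ S) here)) (wsum-zero {N})) ⟩
    Δ * wsum Δ (g ∘ (outside ∷_)) + 0
      ≡⟨ ℕ.+-identityʳ _ ⟩
    Δ * wsum Δ (g ∘ (outside ∷_))
      ≤⟨ ℕ.*-monoʳ-≤ Δ (ℕ.≤-trans (wsum-mono (λ S → g≤h (outside ∷ S) λ ())) (ℕ.m≤n+m _ (Δ * wsum Δ (h ∘ (outside ∷_))))) ⟩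
    Δ * wsum Δ h ∎
    where open ℕ.≤-Reasoning
  wsum-insert {suc N} (suc v) {g} {h} g≤h g≡0 = begin
    Δ * wsum Δ (g ∘ (outside ∷_)) + wsum Δ (g ∘ (inside ∷_))
      ≤⟨ ℕ.+-mono-≤ (ℕ.*-monoʳ-≤ Δ (rec outside)) (rec inside) ⟩
    Δ * (Δ * wsum Δ (h ∘ (outside ∷_))) + Δ * wsum Δ (h ∘ (inside ∷_))
      ≡⟨ ℕ.*-distribˡ-+ Δ (Δ * wsum Δ (h ∘ (outside ∷_))) _ ⟨
    Δ * wsum Δ h ∎
    where
    open ℕ.≤-Reasoning
    rec : ∀ b → wsum Δ (g ∘ (b ∷_)) ≤ Δ * wsum Δ (h ∘ (b ∷_))
    rec b = wsum-insert v (λ S v∉S → g≤h (b ∷ S) (v∉S ∘ drop-there)) (λ S v∈S → g≡0 (b ∷ S) (there v∈S))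

  wsum-delete : ∀ v {g h : Subset N → ℕ} → (∀ S → v ∈ S → g S ≤ h (S [ v ]≔ outside)) →
                (∀ S → v ∉ S → g S ≡ 0) → Δ * wsum Δ g ≤ wsum Δ h
  wsum-delete {suc N} zero {g} {h} g≤h g≡0 = begin
    Δ * (Δ * wsum Δ (g ∘ (outside ∷_)) + wsum Δ (g ∘ (inside ∷_)))
      ≡⟨ cong (λ z → Δ * (z + wsum Δ (g ∘ (inside ∷_))))
           (trans (cong (Δ *_) (trans (wsum-cong (λ S → g≡0 (outside ∷ S) λ ())) (wsum-zero {N}))) (ℕ.*-zeroʳ Δ)) ⟩
    Δ * wsum Δ (g ∘ (inside ∷_))
      ≤⟨ ℕ.*-monoʳ-≤ Δ (wsum-mono (λ S → g≤h (inside ∷ S) here)) ⟩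
    Δ * wsum Δ (h ∘ (outside ∷_))
      ≤⟨ ℕ.m≤m+n _ _ ⟩
    wsum Δ h ∎
    where open ℕ.≤-Reasoning
  wsum-delete {suc N} (suc v) {g} {h} g≤h g≡0 = begin
    Δ * (Δ * wsum Δ (g ∘ (outside ∷_)) + wsum Δ (g ∘ (inside ∷_)))
      ≡⟨ ℕ.*-distribˡ-+ Δ (Δ * wsum Δ (g ∘ (outside ∷_))) _ ⟩
    Δ * (Δ * wsum Δ (g ∘ (outside ∷_))) + Δ * wsum Δ (g ∘ (inside ∷_))
      ≤⟨ ℕ.+-mono-≤ (ℕ.*-monoʳ-≤ Δ (rec outside)) (rec inside) ⟩
    wsum Δ h ∎
    where
    open ℕ.≤-Reasoning
    rec : ∀ b → Δ * wsum Δ (g ∘ (b ∷_)) ≤ wsum Δ (h ∘ (b ∷_))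
    rec b = wsum-delete v (λ S v∈S → g≤h (b ∷ S) (there v∈S)) (λ S v∉S → g≡0 (b ∷ S) (v∉S ∘ drop-there))

  -- Up to normalisation, the conditional expectation of `g` under the product measure given `W`
  -- outside `P`: the coordinates in `P` are summed out, and what `W` does there is ignored.
  resample : Subset N → (Subset N → ℕ) → Subset N → ℕ
  resample []            g []      = g []
  resample (outside ∷ P) g (b ∷ W) = resample P (g ∘ (b ∷_)) W
  resample (inside ∷ P)  g (b ∷ W) = Δ * resample P (g ∘ (outside ∷_)) W + resample P (g ∘ (inside ∷_)) W

  -- Each coordinate in `P` is summed twice; the second time it contributes only its total mass
  -- `Δ + 1`.
  wsum-resample : (P : Subset N) (g : Subset N → ℕ) → wsum Δ (resample P g) ≡ suc Δ ^ card P * wsum Δ g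
  wsum-resample []            g = sym (ℕ.*-identityˡ (g []))
  wsum-resample (outside ∷ P) g
    rewrite wsum-resample P (g ∘ (outside ∷_)) | wsum-resample P (g ∘ (inside ∷_)) =
    solve 4 (λ d c a b → d :* (c :* a) :+ c :* b := c :* (d :* a :+ b)) refl Δ (suc Δ ^ card P)
      (wsum Δ (g ∘ (outside ∷_))) (wsum Δ (g ∘ (inside ∷_)))
  wsum-resample (inside ∷ P)  g
    rewrite wsum-+ (λ W → Δ * resample P (g ∘ (outside ∷_)) W) (resample P (g ∘ (inside ∷_)))
          | wsum-* Δ (resample P (g ∘ (outside ∷_)))
          | wsum-resample P (g ∘ (outside ∷_)) | wsum-resample P (g ∘ (inside ∷_)) =
    solve 4 (λ d c a b → d :* (d :* (c :* a) :+ c :* b) :+ (d :* (c :* a) :+ c :* b)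
                           := ((con 1 :+ d) :* c) :* (d :* a :+ b)) refl Δ (suc Δ ^ card P)
      (wsum Δ (g ∘ (outside ∷_))) (wsum Δ (g ∘ (inside ∷_)))

  resample-zero : ∀ (P : Subset N) {g} W → (∀ W′ → AgreeOff P W W′ → g W′ ≡ 0) → resample P g W ≡ 0
  resample-zero []            []      g≡0 = g≡0 [] λ ()
  resample-zero (outside ∷ P) (b ∷ W) g≡0 = resample-zero P W λ W′ a → g≡0 (b ∷ W′) (keep a)
  resample-zero (inside ∷ P)  (b ∷ W) g≡0
    rewrite resample-zero P W (λ W′ a → g≡0 (outside ∷ W′) (change a))
          | resample-zero P W (λ W′ a → g≡0 (inside ∷ W′) (change a)) =
    trans (ℕ.+-identityʳ (Δ * 0)) (ℕ.*-zeroʳ Δ)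

  -- A nonzero term contains no element of `P` outside `X`, so such a coordinate contributes `Δ`
  -- alone, while one in `P ∩ X` contributes at most `Δ + 1`.
  resample-upper : ∀ (P X : Subset N) {g} W → (∀ W′ → g W′ ≤ 1) →
    (∀ W′ u → AgreeOff P W W′ → u ∈ W′ → u ∈ P → u ∉ X → g W′ ≡ 0) →
    resample P g W ≤ Δ ^ card (P ∩ ∁ X) * suc Δ ^ card (P ∩ X)
  resample-upper []            []            []      g≤1 g≡0 = g≤1 []
  resample-upper (outside ∷ P) (_ ∷ X)       (b ∷ W) g≤1 g≡0 =
    resample-upper P X W (λ W′ → g≤1 (b ∷ W′)) λ W′ u a u∈W u∈P u∉X →
      g≡0 (b ∷ W′) (suc u) (keep a) (there u∈W) (there u∈P) (u∉X ∘ drop-there)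
  resample-upper (inside ∷ P)  (inside ∷ X)  {g} (b ∷ W) g≤1 g≡0 = begin
    Δ * resample P (g ∘ (outside ∷_)) W + resample P (g ∘ (inside ∷_)) W
      ≤⟨ ℕ.+-mono-≤ (ℕ.*-monoʳ-≤ Δ (rec outside)) (rec inside) ⟩
    Δ * (Δ ^ card (P ∩ ∁ X) * suc Δ ^ card (P ∩ X)) + Δ ^ card (P ∩ ∁ X) * suc Δ ^ card (P ∩ X)
      ≡⟨ solve 3 (λ d a b → d :* (a :* b) :+ a :* b := a :* ((con 1 :+ d) :* b)) refl Δ (Δ ^ card (P ∩ ∁ X)) (suc Δ ^ card (P ∩ X)) ⟩
    Δ ^ card (P ∩ ∁ X) * suc Δ ^ suc (card (P ∩ X)) ∎
    where
    open ℕ.≤-Reasoning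
    rec : ∀ c → resample P (g ∘ (c ∷_)) W ≤ Δ ^ card (P ∩ ∁ X) * suc Δ ^ card (P ∩ X)
    rec c = resample-upper P X W (λ W′ → g≤1 (c ∷ W′)) λ W′ u a u∈W u∈P u∉X →
      g≡0 (c ∷ W′) (suc u) (change a) (there u∈W) (there u∈P) (u∉X ∘ drop-there)
  resample-upper (inside ∷ P)  (outside ∷ X) {g} (b ∷ W) g≤1 g≡0 = begin
    Δ * resample P (g ∘ (outside ∷_)) W + resample P (g ∘ (inside ∷_)) W
      ≡⟨ cong (Δ * resample P (g ∘ (outside ∷_)) W +_)
           (resample-zero P W λ W′ a → g≡0 (inside ∷ W′) zero (change a) here here λ ()) ⟩
    Δ * resample P (g ∘ (outside ∷_)) W + 0
      ≡⟨ ℕ.+-identityʳ _ ⟩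
    Δ * resample P (g ∘ (outside ∷_)) W
      ≤⟨ ℕ.*-monoʳ-≤ Δ (resample-upper P X W (λ W′ → g≤1 (outside ∷ W′)) λ W′ u a u∈W u∈P u∉X →
           g≡0 (outside ∷ W′) (suc u) (change a) (there u∈W) (there u∈P) (u∉X ∘ drop-there)) ⟩
    Δ * (Δ ^ card (P ∩ ∁ X) * suc Δ ^ card (P ∩ X))
      ≡⟨ ℕ.*-assoc Δ (Δ ^ card (P ∩ ∁ X)) (suc Δ ^ card (P ∩ X)) ⟨
    Δ ^ suc (card (P ∩ ∁ X)) * suc Δ ^ card (P ∩ X) ∎
    where open ℕ.≤-Reasoning

  -- The term of `W′` alone; its weight on `P` is one `Δ` for each element of `P` missing from `W′`.
  resample-lower : ∀ (P : Subset N) {g} W W′ → AgreeOff P W W′ →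
                   Δ ^ card (P ∩ ∁ W′) * g W′ ≤ resample P g W
  resample-lower []            {g} []      []       a = ℕ.≤-reflexive (ℕ.*-identityˡ (g []))
  resample-lower (outside ∷ P) (b ∷ W) (c ∷ W′) a with a zero (λ ())
  ... | refl = resample-lower P W W′ λ i i∉P → a (suc i) (i∉P ∘ drop-there)
  resample-lower (inside ∷ P) {g} (b ∷ W) (inside ∷ W′) a =
    ℕ.≤-trans (resample-lower P W W′ λ i i∉P → a (suc i) (i∉P ∘ drop-there)) (ℕ.m≤n+m _ _)
  resample-lower (inside ∷ P) {g} (b ∷ W) (outside ∷ W′) a = begin
    Δ * Δ ^ card (P ∩ ∁ W′) * g (outside ∷ W′)   ≡⟨ ℕ.*-assoc Δ _ _ ⟩
    Δ * (Δ ^ card (P ∩ ∁ W′) * g (outside ∷ W′)) ≤⟨ ℕ.*-monoʳ-≤ Δ (resample-lower P W W′ λ i i∉P → a (suc i) (i∉P ∘ drop-there)) ⟩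
    Δ * resample P (g ∘ (outside ∷_)) W          ≤⟨ ℕ.m≤m+n _ _ ⟩
    resample (inside ∷ P) g (b ∷ W)              ∎
    where open ℕ.≤-Reasoning

-- Membership in selected and modified subsets

select : {P : Fin N → Set} → Decidable P → Subset N
select P? = tabulate (does ∘ P?)

∈-select⁺ : ∀ {P : Fin N → Set} (P? : Decidable P) {i} → P i → i ∈ select P?
∈-select⁺ P? {i} p = lookup⇒[]= i (select P?) (trans (lookup∘tabulate (does ∘ P?) i) (dec-true (P? i) p))

∈-select⁻ : ∀ {P : Fin N → Set} (P? : Decidable P) {i} → i ∈ select P? → P i
∈-select⁻ P? {i} i∈ with P? i | trans (sym (lookup∘tabulate (does ∘ P?) i)) ([]=⇒lookup i∈)
... | yes p | _ = p
... | no _  | ()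

∈-insert⁻ : ∀ {u i} (S : Subset N) → i ∈ S [ u ]≔ inside → i ≡ u ⊎ i ∈ S
∈-insert⁻ {u = u} {i} S i∈ with i Fin.≟ u
... | yes i≡u = inj₁ i≡u
... | no  i≢u = inj₂ (lookup⇒[]= i S (trans (sym (lookup∘update′ i≢u S inside)) ([]=⇒lookup i∈)))

∈-delete⁻ : ∀ {u i} (S : Subset N) → i ∈ S [ u ]≔ outside → i ≢ u × i ∈ S
∈-delete⁻ {u = u} {i} S i∈ with i Fin.≟ u
... | yes refl = contradiction (trans (sym ([]=⇒lookup i∈)) (lookup∘update u S outside)) λ ()
... | no  i≢u = i≢u , lookup⇒[]= i S (trans (sym (lookup∘update′ i≢u S outside)) ([]=⇒lookup i∈))

subset-of-card : ∀ n (S : Subset N) → n ≤ card S → ∃ λ R → R ⊆ S × card R ≡ n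
subset-of-card {N} zero S n≤ = ∅ , (λ i∈ → contradiction i∈ ∉⊥) , ∣⊥∣≡0 N
subset-of-card (suc n) (outside ∷ S) n≤ with subset-of-card (suc n) S n≤
... | R , R⊆S , c = outside ∷ R , out⊆ R⊆S , c
subset-of-card (suc n) (inside ∷ S) (s≤s n≤) with subset-of-card n S n≤
... | R , R⊆S , c = inside ∷ R , in⊆in R⊆S , cong suc c

∈-agree : ∀ {P W W′ : Subset N} {i} → AgreeOff P W W′ → i ∉ P → i ∈ W → i ∈ W′
∈-agree {W′ = W′} {i} a i∉P i∈W = lookup⇒[]= i W′ (trans (sym (a i i∉P)) ([]=⇒lookup i∈W))

agree-sym : ∀ {P W W′ : Subset N} → AgreeOff P W W′ → AgreeOff P W′ W
agree-sym a i i∉P = sym (a i i∉P)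

agree-insert : ∀ {P : Subset N} {u b} W → u ∈ P → AgreeOff P W (W [ u ]≔ b)
agree-insert {u = u} {b} W u∈P i i∉P = sym (lookup∘update′ (λ { refl → i∉P u∈P }) W b)

≤-sum : (g : Fin N → ℕ) → ∀ i → g i ≤ sum g
≤-sum g zero    = ℕ.m≤m+n _ _
≤-sum g (suc i) = ℕ.≤-trans (≤-sum (g ∘ suc) i) (ℕ.m≤n+m _ _)

⟦⟧*-≤ : ∀ {A : Set} (a? : Dec A) {m p} → (A → m ≤ p) → ⟦ a? ⟧ * m ≤ ⟦ a? ⟧ * p
⟦⟧*-≤ (yes a) h = ℕ.*-monoʳ-≤ 1 (h a)
⟦⟧*-≤ (no _)  h = z≤n

⟦⟧-×≤ : ∀ {A B C : Set} (a? : Dec A) (b? : Dec B) (c? : Dec C) → (A → B → C) → ⟦ a? ⟧ * ⟦ b? ⟧ ≤ ⟦ c? ⟧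
⟦⟧-×≤ (no _)  b? c? h = z≤n
⟦⟧-×≤ (yes a) b? c? h = ℕ.≤-trans (ℕ.≤-reflexive (ℕ.*-identityˡ _)) (⟦⟧-mono b? c? (h a))

-- Bernoulli's inequality (1 + 1/2δ)^i ≤ 1/(1 - i/2δ), with j = δ - i.
bernoulli : ∀ δ i j → i + j ≡ δ → (1 + 2 * δ) ^ i * (δ + j) ≤ (2 * δ) ^ i * (2 * δ)
bernoulli δ zero    j refl = ℕ.≤-reflexive (cong (λ z → z + 0) (cong (j +_) (sym (ℕ.+-identityʳ j))))
bernoulli δ (suc i) j e = begin
  (1 + 2 * δ) * (1 + 2 * δ) ^ i * (δ + j)
    ≡⟨ solve 3 (λ d x j → (con 1 :+ con 2 :* d) :* x :* (d :+ j) := x :* ((d :+ j) :+ con 2 :* d :* (d :+ j))) refl δ ((1 + 2 * δ) ^ i) j ⟩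
  (1 + 2 * δ) ^ i * ((δ + j) + 2 * δ * (δ + j))
    ≤⟨ ℕ.*-monoʳ-≤ ((1 + 2 * δ) ^ i) (ℕ.+-monoˡ-≤ (2 * δ * (δ + j)) (ℕ.+-monoʳ-≤ δ j≤δ)) ⟩
  (1 + 2 * δ) ^ i * ((δ + δ) + 2 * δ * (δ + j))
    ≡⟨ solve 3 (λ d x j → x :* ((d :+ d) :+ con 2 :* d :* (d :+ j)) := (con 2 :* d) :* (x :* (d :+ (con 1 :+ j)))) refl δ ((1 + 2 * δ) ^ i) j ⟩
  2 * δ * ((1 + 2 * δ) ^ i * (δ + suc j))
    ≤⟨ ℕ.*-monoʳ-≤ (2 * δ) (bernoulli δ i (suc j) (trans (ℕ.+-suc i j) e)) ⟩
  2 * δ * ((2 * δ) ^ i * (2 * δ))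
    ≡⟨ ℕ.*-assoc (2 * δ) ((2 * δ) ^ i) (2 * δ) ⟨
  2 * δ * (2 * δ) ^ i * (2 * δ) ∎
  where
  open ℕ.≤-Reasoning
  j≤δ : j ≤ δ
  j≤δ = ℕ.≤-trans (ℕ.m≤n+m j (suc i)) (ℕ.≤-reflexive e)

growth₁ : ∀ δ .{{_ : NonZero δ}} x → x ≤ δ → (1 + 2 * δ) ^ x ≤ 2 * (2 * δ) ^ x
growth₁ δ x x≤δ = ℕ.*-cancelʳ-≤ _ _ δ (begin
  (1 + 2 * δ) ^ x * δ             ≤⟨ ℕ.*-monoʳ-≤ ((1 + 2 * δ) ^ x) (ℕ.m≤m+n δ (δ ∸ x)) ⟩
  (1 + 2 * δ) ^ x * (δ + (δ ∸ x)) ≤⟨ bernoulli δ x (δ ∸ x) (ℕ.m+[n∸m]≡n x≤δ) ⟩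
  (2 * δ) ^ x * (2 * δ)           ≡⟨ solve 2 (λ y d → y :* (con 2 :* d) := con 2 :* y :* d) refl ((2 * δ) ^ x) δ ⟩
  2 * (2 * δ) ^ x * δ             ∎)
  where
  open ℕ.≤-Reasoning

-- By `growth₁` each block of `δ` factors 1 + 1/2δ at most doubles the product, and `x` factors fill
-- at most `T` blocks.
growth : ∀ δ .{{_ : NonZero δ}} T x → x ≤ T * δ → (1 + 2 * δ) ^ x ≤ 2 ^ T * (2 * δ) ^ x
growth δ zero    zero z≤n = ℕ.≤-refl
growth δ (suc T) x x≤ with ℕ.≤-total x δ
... | inj₁ x≤δ = begin
  (1 + 2 * δ) ^ x           ≤⟨ growth₁ δ x x≤δ ⟩
  2 * (2 * δ) ^ x           ≤⟨ ℕ.*-monoˡ-≤ ((2 * δ) ^ x) (ℕ.*-monoʳ-≤ 2 (ℕ.m^n>0 2 T)) ⟩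
  2 ^ suc T * (2 * δ) ^ x   ∎
  where open ℕ.≤-Reasoning
... | inj₂ δ≤x with ℕ.m≤n⇒∃[o]m+o≡n δ≤x
...   | x′ , refl = begin
  (1 + 2 * δ) ^ (δ + x′)                          ≡⟨ ℕ.^-distribˡ-+-* (1 + 2 * δ) δ x′ ⟩
  (1 + 2 * δ) ^ δ * (1 + 2 * δ) ^ x′              ≤⟨ ℕ.*-mono-≤ (growth₁ δ δ ℕ.≤-refl) (growth δ T x′ (ℕ.+-cancelˡ-≤ δ _ _ x≤)) ⟩
  2 * (2 * δ) ^ δ * (2 ^ T * (2 * δ) ^ x′)
      ≡⟨ solve 3 (λ a t b → con 2 :* a :* (t :* b) := con 2 :* t :* (a :* b)) refl ((2 * δ) ^ δ) (2 ^ T) ((2 * δ) ^ x′) ⟩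
  2 ^ suc T * ((2 * δ) ^ δ * (2 * δ) ^ x′)        ≡⟨ cong (2 ^ suc T *_) (ℕ.^-distribˡ-+-* (2 * δ) δ x′) ⟨
  2 ^ suc T * (2 * δ) ^ (δ + x′)                  ∎
  where
  open ℕ.≤-Reasoning

-- The hard-core model

-- The `2 +` in `codegree` stands for the endpoints `v` and `w`, which `reach` counts along with
-- their common neighbours. `sparse` says that a probability of 1 / (2^τ · 2δ) for `v`, multiplied
-- by `4 * D`, is at least `τ`.
module HardCore (G : Graph N) (U : Subset N) (n D δ τ : ℕ)
  .{{_ : NonZero D}} .{{_ : NonZero δ}}
  (¬indep : ¬ HasIndependent n G)
  (degree : ∀ {v} → v ∈ U → card (U ∩ nbrs G v) ≤ D)
  (codegree : ∀ {v w} → v ∈ U → w ∈ U → Adjacent G v w → 2 + card (U ∩ nbrs G v ∩ nbrs G w) ≤ 2 * δ)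
  (sparse : τ * 2 ^ τ * (2 * δ) ≤ 4 * D)
  where

  private
    Δ = 2 * δ

    adjacent? : ∀ i j → Dec (Adjacent G i j)
    adjacent? i j = T? (adj G i j)

  Indep : Subset N → Set
  Indep W = W ⊆ U × IsIndependent G W

  indep? : Decidable Indep
  indep? W = (W ⊆? U) ×-dec
    Fin.all? λ i → Fin.all? λ j → (i ∈? W) →-dec (j ∈? W) →-dec ¬? (adjacent? i j)

  indep-⊆ : ∀ {W W′} → W ⊆ W′ → Indep W′ → Indep W
  indep-⊆ W⊆W′ (W′⊆U , q) = W′⊆U ∘ W⊆W′ , λ i j i∈ j∈ → q i j (W⊆W′ i∈) (W⊆W′ j∈)

  indep-insert : ∀ {u W W′} → Indep W → u ∈ U → (∀ w → w ∈ W → ¬ Adjacent G u w) →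
                 (∀ {i} → i ∈ W′ → i ≡ u ⊎ i ∈ W) → Indep W′
  indep-insert {u} {W} {W′} (W⊆U , q) u∈U far split = sub , indep
    where
    sub : W′ ⊆ U
    sub i∈ with split i∈
    ... | inj₁ refl = u∈U
    ... | inj₂ i∈W  = W⊆U i∈W
    indep : IsIndependent G W′
    indep i j i∈ j∈ a with split i∈ | split j∈
    ... | inj₁ refl | inj₁ refl = ¬loop G u a
    ... | inj₁ refl | inj₂ j∈W  = far j j∈W a
    ... | inj₂ i∈W  | inj₁ refl = far i i∈W (flipAdj G a)
    ... | inj₂ i∈W  | inj₂ j∈W  = q i j i∈W j∈W a

  indep-card : ∀ {W} → Indep W → card W ≤ n
  indep-card {W} (_ , q) with ℕ.≤-total n (card W)
  ... | inj₂ ≤n = ≤n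
  ... | inj₁ n≤ with subset-of-card n W n≤
  ...   | R , R⊆W , c = contradiction (R , c , λ i j i∈ j∈ → q i j (R⊆W i∈) (R⊆W j∈)) ¬indep

  module Around (v : Fin N) (v∈U : v ∈ U) where
    P : Subset N
    P = ⁅ v ⁆ ∪ (U ∩ nbrs G v)

    P⊆U : P ⊆ U
    P⊆U u∈P with insertElim G u∈P
    ... | inj₁ refl = v∈U
    ... | inj₂ u∈   = p∩q⊆p U _ u∈

    v∈P : v ∈ P
    v∈P = x∈p∪q⁺ (inj₁ (x∈⁅x⁆ v))

    ∈P⇒adjacent : ∀ {u} → u ∈ P → u ≢ v → Adjacent G v u
    ∈P⇒adjacent u∈P u≢v with insertElim G u∈P
    ... | inj₁ u≡v = contradiction u≡v u≢v
    ... | inj₂ u∈  = ∈nbrs⇒ G (p∩q⊆q U _ u∈)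

    -- Only neighbours outside `P` can block `u`, so this depends on `W` only off `P`, and `Small`
    -- is decided before `P` is resampled.
    Open : Subset N → Fin N → Set
    Open W u = u ∈ P × (∀ w → w ∈ W × w ∉ P → ¬ Adjacent G u w)

    open? : ∀ W → Decidable (Open W)
    open? W u = (u ∈? P) ×-dec Fin.all? λ w → ((w ∈? W) ×-dec ¬? (w ∈? P)) →-dec ¬? (adjacent? u w)

    X : Subset N → Subset N
    X W = select (open? W)

    X-agree : ∀ {W W′} → AgreeOff P W W′ → card (X W) ≤ card (X W′)
    X-agree {W} {W′} a = p⊆q⇒∣p∣≤∣q∣ λ {u} u∈ →
      let (u∈P , far) = ∈-select⁻ (open? W) u∈ in
      ∈-select⁺ (open? W′) (u∈P , λ w (w∈ , w∉P) →
        far w (∈-agree {P = P} {W′} {W} (agree-sym {P = P} {W} {W′} a) w∉P w∈ , w∉P))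

    -- Since Δ = 2δ, for small W the weights of the subsets of X W add up to at most
    -- 2^τ times the weight of the empty one.
    Small : Subset N → Set
    Small W = card (X W) ≤ τ * δ

    small? : Decidable Small
    small? W = card (X W) ℕ.≤? τ * δ

    small-agree : ∀ {W W′} → AgreeOff P W W′ → Small W → Small W′
    small-agree {W} {W′} a s = ℕ.≤-trans (X-agree {W′} {W} (agree-sym {P = P} {W} {W′} a)) s

    IndepSmall IndepLarge : Subset N → Set
    IndepSmall W = Indep W × Small W
    IndepLarge W = Indep W × ¬ Small W

    indepSmall? : Decidable IndepSmall
    indepSmall? W = indep? W ×-dec small? W

    indepLarge? : Decidable IndepLarge
    indepLarge? W = indep? W ×-dec ¬? (small? W)

    module _ (W : Subset N) where
      private
        g h : Subset N → ℕ
        g W′ = ⟦ indepSmall? W′ ⟧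
        h W′ = ⟦ indepSmall? W′ ×-dec (v ∈? W′) ⟧

        W₀ W₁ : Subset N
        W₀ = W ∩ ∁ P
        W₁ = ⁅ v ⁆ ∪ W₀

        W₀⊆ : ∀ {W′} → AgreeOff P W W′ → W₀ ⊆ W′
        W₀⊆ {W′} a i∈ = let (i∈W , i∈∁P) = x∈p∩q⁻ W (∁ P) i∈ in
          ∈-agree {P = P} {W} {W′} a (x∈∁p⇒x∉p i∈∁P) i∈W

        agree₁ : AgreeOff P W W₁
        agree₁ i i∉P with i ∈? W
        ... | yes i∈W = trans ([]=⇒lookup i∈W)
                (sym ([]=⇒lookup (x∈p∪q⁺ {p = ⁅ v ⁆} (inj₂ (x∈p∩q⁺ (i∈W , x∉p⇒x∈∁p i∉P))))))
        ... | no  i∉W = trans (∉⇒lookup i∉W) (sym (∉⇒lookup i∉W₁))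
          where
          ∉⇒lookup : ∀ {S : Subset N} {i} → i ∉ S → lookup S i ≡ outside
          ∉⇒lookup {S} {i} i∉S with lookup S i in eq
          ... | inside  = contradiction (lookup⇒[]= i S eq) i∉S
          ... | outside = refl
          i∉W₁ : i ∉ W₁
          i∉W₁ i∈ with insertElim G i∈
          ... | inj₁ refl = i∉P v∈P
          ... | inj₂ i∈W₀ = i∉W (p∩q⊆p W _ i∈W₀)

        indep₁ : Indep W₀ → Indep W₁
        indep₁ I₀ = indep-insert I₀ v∈U far (insertElim G)
          where
          far : ∀ w → w ∈ W₀ → ¬ Adjacent G v w
          far w w∈ a = x∈∁p⇒x∉p (p∩q⊆q W (∁ P) w∈)
            (x∈p∪q⁺ {p = ⁅ v ⁆} (inj₂ (x∈p∩q⁺ (proj₁ I₀ w∈ , ⇒∈nbrs G a))))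

        P∩W₁≤1 : card (P ∩ W₁) ≤ 1
        P∩W₁≤1 = ℕ.≤-trans (p⊆q⇒∣p∣≤∣q∣ sub) (ℕ.≤-reflexive (∣⁅x⁆∣≡1 v))
          where
          sub : P ∩ W₁ ⊆ ⁅ v ⁆
          sub i∈ with x∈p∩q⁻ P W₁ i∈
          ... | i∈P , i∈W₁ with insertElim G i∈W₁
          ...   | inj₁ refl = x∈⁅x⁆ v
          ...   | inj₂ i∈W₀ = contradiction i∈P (x∈∁p⇒x∉p (p∩q⊆q W (∁ P) i∈W₀))

        blocked : ∀ W′ u → AgreeOff P W W′ → u ∈ W′ → u ∈ P → u ∉ X W → g W′ ≡ 0
        blocked W′ u a u∈W′ u∈P u∉X = ⟦⟧-no (indepSmall? W′) λ ((_ , q) , _) →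
          u∉X (∈-select⁺ (open? W) (u∈P , λ w (w∈W , w∉P) →
            q u w u∈W′ (∈-agree {P = P} {W} {W′} a w∉P w∈W)))

        trivial : (∀ W′ → AgreeOff P W W′ → ¬ IndepSmall W′) →
                  τ * resample Δ P g W ≤ 4 * D * resample Δ P h W
        trivial none = ℕ.≤-trans (ℕ.≤-reflexive (trans
          (cong (τ *_) (resample-zero Δ P W λ W′ a → ⟦⟧-no (indepSmall? W′) (none W′ a)))
          (ℕ.*-zeroʳ τ))) z≤n

      -- Given `W` off `P`, the sets counted by `g` meet `P` within `X W` and weigh at most
      -- `2 ^ τ * Δ ^ card P` in all, whereas the single set `W₁`, which meets `P` in `v` only,
      -- already weighs `Δ ^ (card P ∸ 1)`. `sparse` pays for the ratio.
      resample-small : τ * resample Δ P g W ≤ 4 * D * resample Δ P h W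
      resample-small with indep? W₀ | small? W
      -- If the part off `P` is already dependent, no independent set agrees with it and the left
      -- side vanishes.
      ... | no ¬I₀ | _     = trivial λ W′ a (I , _) → ¬I₀ (indep-⊆ (W₀⊆ {W′} a) I)
      ... | yes _  | no ¬s = trivial λ W′ a (_ , s) → ¬s (small-agree {W′} {W} (agree-sym {P = P} {W} {W′} a) s)
      ... | yes I₀ | yes s = begin
        τ * resample Δ P g W
          ≤⟨ ℕ.*-monoʳ-≤ τ (resample-upper Δ P (X W) W (λ W′ → ⟦⟧≤1 (indepSmall? W′)) blocked) ⟩
        τ * (Δ ^ p * suc Δ ^ x)
          ≤⟨ ℕ.*-monoʳ-≤ τ (ℕ.*-monoʳ-≤ (Δ ^ p) (growth δ τ x (ℕ.≤-trans (∣p∩q∣≤∣q∣ P (X W)) s))) ⟩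
        τ * (Δ ^ p * (2 ^ τ * Δ ^ x))
          ≡⟨ solve 4 (λ t a b c → t :* (a :* (b :* c)) := t :* b :* (c :* a)) refl τ (Δ ^ p) (2 ^ τ) (Δ ^ x) ⟩
        τ * 2 ^ τ * (Δ ^ x * Δ ^ p)
          ≡⟨ cong (τ * 2 ^ τ *_) (ℕ.^-distribˡ-+-* Δ x p) ⟨
        τ * 2 ^ τ * Δ ^ (x + p)
          -- `P` contains at most one element of `W₁`, so a single factor `Δ` makes up for the
          -- passage from `card P` to `y`.
          ≤⟨ ℕ.*-monoʳ-≤ (τ * 2 ^ τ) (ℕ.^-monoʳ-≤ Δ {{ℕ.m*n≢0 2 δ}} x+p≤) ⟩
        τ * 2 ^ τ * (Δ * Δ ^ y)
          ≡⟨ ℕ.*-assoc (τ * 2 ^ τ) Δ (Δ ^ y) ⟨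
        τ * 2 ^ τ * Δ * Δ ^ y
          ≤⟨ ℕ.*-monoˡ-≤ (Δ ^ y) sparse ⟩
        4 * D * Δ ^ y
          ≡⟨ cong (4 * D *_) (trans (cong (Δ ^ y *_) (⟦⟧-yes (indepSmall? W₁ ×-dec (v ∈? W₁)) good)) (ℕ.*-identityʳ _)) ⟨
        4 * D * (Δ ^ y * h W₁)
          ≤⟨ ℕ.*-monoʳ-≤ (4 * D) (resample-lower Δ P W W₁ agree₁) ⟩
        4 * D * resample Δ P h W ∎
        where
        open ℕ.≤-Reasoning
        x = card (P ∩ X W)
        p = card (P ∩ ∁ (X W))
        y = card (P ∩ ∁ W₁)
        good : IndepSmall W₁ × v ∈ W₁
        good = (indep₁ I₀ , small-agree {W} {W₁} agree₁ s) , x∈p∪q⁺ (inj₁ (x∈⁅x⁆ v))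
        x+p≤ : x + p ≤ suc y
        x+p≤ = begin
          x + p                 ≡⟨ card-split P (X W) ⟩
          card P                ≡⟨ card-split P W₁ ⟨
          card (P ∩ W₁) + y     ≤⟨ ℕ.+-monoˡ-≤ y P∩W₁≤1 ⟩
          suc y                 ∎

    -- `resample-small` summed over all `W`: both sides acquire the factor `suc Δ ^ card P`, which
    -- cancels.
    small-bound : τ * wsum Δ (λ W → ⟦ indepSmall? W ⟧) ≤
                  4 * D * wsum Δ (λ W → ⟦ indepSmall? W ×-dec (v ∈? W) ⟧)
    small-bound = ℕ.*-cancelˡ-≤ _ {{ℕ.m^n≢0 (suc Δ) (card P)}} (begin
      c * (τ * wsum Δ g)             ≡⟨ shuffle c τ (wsum Δ g) ⟩
      τ * (c * wsum Δ g)             ≡⟨ cong (τ *_) (wsum-resample Δ P g) ⟨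
      τ * wsum Δ (resample Δ P g)    ≡⟨ wsum-* Δ τ (resample Δ P g) ⟨
      wsum Δ (λ W → τ * resample Δ P g W) ≤⟨ wsum-mono Δ resample-small ⟩
      wsum Δ (λ W → 4 * D * resample Δ P h W) ≡⟨ wsum-* Δ (4 * D) (resample Δ P h) ⟩
      4 * D * wsum Δ (resample Δ P h) ≡⟨ cong (4 * D *_) (wsum-resample Δ P h) ⟩
      4 * D * (c * wsum Δ h)         ≡⟨ shuffle (4 * D) c (wsum Δ h) ⟩
      c * (4 * D * wsum Δ h)         ∎)
      where
      open ℕ.≤-Reasoning
      c = suc Δ ^ card P
      g h : Subset N → ℕ
      g W = ⟦ indepSmall? W ⟧
      h W = ⟦ indepSmall? W ×-dec (v ∈? W) ⟧
      shuffle : ∀ a b c → a * (b * c) ≡ b * (a * c)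
      shuffle a b c = trans (sym (ℕ.*-assoc a b c)) (trans (cong (_* c) (ℕ.*-comm a b)) (ℕ.*-assoc b a c))

    Free : Subset N → Fin N → Set
    Free W u = u ∈ P × u ∉ W × (∀ w → w ∈ W → ¬ Adjacent G u w)

    free? : ∀ W → Decidable (Free W)
    free? W u = (u ∈? P) ×-dec ¬? (u ∈? W) ×-dec Fin.all? λ w → (w ∈? W) →-dec ¬? (adjacent? u w)

    Near : Subset N → Subset N
    Near W = W ∩ nbrs G v

    -- The vertices that a neighbour `w` of `v` can keep from being free once it is chosen: itself,
    -- `v`, and the common neighbours of the two.
    reach : Fin N → Fin N → ℕ
    reach w u = ⟦ u ∈? ⁅ w ⁆ ⟧ + ⟦ u ∈? ⁅ v ⁆ ⟧ + ⟦ u ∈? (U ∩ nbrs G v ∩ nbrs G w) ⟧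

    reach-total : ∀ {w} → w ∈ U → Adjacent G v w → sum (reach w) ≤ 2 * δ
    reach-total {w} w∈U a = begin
      sum (reach w)
        ≡⟨ ∑-distrib-+ (λ u → ⟦ u ∈? ⁅ w ⁆ ⟧ + ⟦ u ∈? ⁅ v ⁆ ⟧) _ ⟩
      sum (λ u → ⟦ u ∈? ⁅ w ⁆ ⟧ + ⟦ u ∈? ⁅ v ⁆ ⟧) + sum (λ u → ⟦ u ∈? C ⟧)
        ≡⟨ cong₂ _+_ (∑-distrib-+ (λ u → ⟦ u ∈? ⁅ w ⁆ ⟧) _) (sym (card≡sum C)) ⟩
      sum (λ u → ⟦ u ∈? ⁅ w ⁆ ⟧) + sum (λ u → ⟦ u ∈? ⁅ v ⁆ ⟧) + card C
        ≡⟨ cong (_+ card C) (cong₂ _+_ (single w) (single v)) ⟩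
      2 + card C
        ≤⟨ codegree v∈U w∈U a ⟩
      2 * δ ∎
      where
      open ℕ.≤-Reasoning
      C = U ∩ nbrs G v ∩ nbrs G w
      single : ∀ i → sum (λ u → ⟦ u ∈? ⁅ i ⁆ ⟧) ≡ 1
      single i = trans (sym (card≡sum ⁅ i ⁆)) (∣⁅x⁆∣≡1 i)

    -- If `v ∈ W`, the last term covers all of `P`. Otherwise `u` is free, lies in `W`, or has a
    -- neighbour in `W`; since `u` is open, that neighbour is in `P`, and now `W ∩ P` consists of
    -- neighbours of `v`.
    cover : ∀ W u → Open W u →
      1 ≤ ⟦ free? W u ⟧ + sum (λ w → ⟦ w ∈? Near W ⟧ * reach w u) + ⟦ v ∈? W ⟧ * ⟦ u ∈? P ⟧
    cover W u (u∈P , far) = go (v ∈? W)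
      where
      Goal = 1 ≤ ⟦ free? W u ⟧ + sum (λ w → ⟦ w ∈? Near W ⟧ * reach w u) + ⟦ v ∈? W ⟧ * ⟦ u ∈? P ⟧
      via : ∀ w → w ∈ Near W → 1 ≤ reach w u → Goal
      via w w∈ r = ℕ.≤-trans (ℕ.≤-trans
        (ℕ.*-mono-≤ (1≤⟦⟧ (w ∈? Near W) w∈) r)
        (ℕ.≤-trans (≤-sum (λ w → ⟦ w ∈? Near W ⟧ * reach w u) w) (ℕ.m≤n+m _ ⟦ free? W u ⟧)))
        (ℕ.m≤m+n _ _)
      near : ∀ {w} → v ∉ W → w ∈ W → w ∈ P → w ∈ Near W
      near v∉W w∈W w∈P = x∈p∩q⁺ (w∈W , ⇒∈nbrs G (∈P⇒adjacent w∈P λ { refl → v∉W w∈W }))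
      one : ∀ {S : Subset N} → u ∈ S → 1 ≤ ⟦ u ∈? S ⟧
      one {S} u∈S = 1≤⟦⟧ (u ∈? S) u∈S
      go : Dec (v ∈ W) → Goal
      go (yes v∈W) = ℕ.≤-trans (ℕ.*-mono-≤ (1≤⟦⟧ (v ∈? W) v∈W) (one u∈P))
                               (ℕ.m≤n+m _ _)
      go (no v∉W) = search (u ∈? W) (Fin.any? λ w → (w ∈? W) ×-dec adjacent? u w)
        where
        reached : ∀ w → Adjacent G u w → Dec (u ≡ v) → 1 ≤ reach w u
        reached w a (yes refl) = ℕ.≤-trans (one (x∈⁅x⁆ u)) (ℕ.≤-trans (ℕ.m≤n+m _ ⟦ u ∈? ⁅ w ⁆ ⟧) (ℕ.m≤m+n _ _))
        reached w a (no u≢v)   = ℕ.≤-trans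
          (one (x∈p∩q⁺ (P⊆U u∈P , x∈p∩q⁺ (⇒∈nbrs G (∈P⇒adjacent u∈P u≢v) , ⇒∈nbrs G (flipAdj G a)))))
          (ℕ.m≤n+m _ _)
        search : Dec (u ∈ W) → Dec (∃ λ w → w ∈ W × Adjacent G u w) → Goal
        search (yes u∈W) _ = via u (near v∉W u∈W u∈P)
          (ℕ.≤-trans (one (x∈⁅x⁆ u)) (ℕ.≤-trans (ℕ.m≤m+n _ _) (ℕ.m≤m+n _ _)))
        search (no u∉W) (no none) = ℕ.≤-trans
          (1≤⟦⟧ (free? W u) (u∈P , u∉W , λ w w∈W a → none (w , w∈W , a)))
          (ℕ.≤-trans (ℕ.m≤m+n _ _) (ℕ.m≤m+n _ _))
        search (no u∉W) (yes (w , w∈W , a)) = via w (near v∉W w∈W w∈P) (reached w a (u Fin.≟ v))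
          where
          w∈P : w ∈ P
          w∈P = decidable-stable (w ∈? P) λ w∉P → far w (w∈W , w∉P) a

    X-card : ∀ W → Indep W →
      card (X W) ≤ sum (λ u → ⟦ free? W u ⟧) + 2 * δ * card (Near W) + suc D * ⟦ v ∈? W ⟧
    X-card W (W⊆U , _) = begin
      card (X W)
        ≡⟨ card≡sum (X W) ⟩
      sum (λ u → ⟦ u ∈? X W ⟧)
        ≤⟨ sum-mono (λ u → ⟦⟧-≤ (u ∈? X W) (cover W u ∘ ∈-select⁻ (open? W))) ⟩
      sum (λ u → ⟦ free? W u ⟧ + reached u + ⟦ v ∈? W ⟧ * ⟦ u ∈? P ⟧)
        ≡⟨ ∑-distrib-+ (λ u → ⟦ free? W u ⟧ + reached u) _ ⟩
      sum (λ u → ⟦ free? W u ⟧ + reached u) + sum (λ u → ⟦ v ∈? W ⟧ * ⟦ u ∈? P ⟧)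
        ≡⟨ cong (_+ sum (λ u → ⟦ v ∈? W ⟧ * ⟦ u ∈? P ⟧)) (∑-distrib-+ (λ u → ⟦ free? W u ⟧) reached) ⟩
      free + sum reached + sum (λ u → ⟦ v ∈? W ⟧ * ⟦ u ∈? P ⟧)
        ≤⟨ ℕ.+-mono-≤ (ℕ.+-monoʳ-≤ free total) occupied ⟩
      free + 2 * δ * card (Near W) + suc D * ⟦ v ∈? W ⟧ ∎
      where
      open ℕ.≤-Reasoning
      free = sum (λ u → ⟦ free? W u ⟧)
      reached : Fin N → ℕ
      reached u = sum (λ w → ⟦ w ∈? Near W ⟧ * reach w u)
      total : sum reached ≤ 2 * δ * card (Near W)
      total = begin
        sum reached
          ≡⟨ ∑-comm (λ u w → ⟦ w ∈? Near W ⟧ * reach w u) ⟩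
        sum (λ w → sum (λ u → ⟦ w ∈? Near W ⟧ * reach w u))
          ≡⟨ sum-cong-≗ (λ w → sym (*-distribˡ-sum ⟦ w ∈? Near W ⟧ (reach w))) ⟩
        sum (λ w → ⟦ w ∈? Near W ⟧ * sum (reach w))
          ≤⟨ sum-mono (λ w → ⟦⟧*-≤ (w ∈? Near W) λ w∈ → let (w∈W , w∈v) = x∈p∩q⁻ W _ w∈ in
               reach-total (W⊆U w∈W) (∈nbrs⇒ G w∈v)) ⟩
        sum (λ w → ⟦ w ∈? Near W ⟧ * (2 * δ))
          ≡⟨ *-distribʳ-sum (2 * δ) (λ w → ⟦ w ∈? Near W ⟧) ⟨
        sum (λ w → ⟦ w ∈? Near W ⟧) * (2 * δ)
          ≡⟨ cong (_* (2 * δ)) (card≡sum (Near W)) ⟨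
        card (Near W) * (2 * δ)
          ≡⟨ ℕ.*-comm (card (Near W)) (2 * δ) ⟩
        2 * δ * card (Near W) ∎
      P≤ : card P ≤ suc D
      P≤ = subst (_≤ suc D) (sym (card-insert v (U ∩ nbrs G v) λ v∈ → ¬loop G v (∈nbrs⇒ G (p∩q⊆q U _ v∈))))
        (s≤s (degree v∈U))
      occupied : sum (λ u → ⟦ v ∈? W ⟧ * ⟦ u ∈? P ⟧) ≤ suc D * ⟦ v ∈? W ⟧
      occupied = begin
        sum (λ u → ⟦ v ∈? W ⟧ * ⟦ u ∈? P ⟧)   ≡⟨ *-distribˡ-sum ⟦ v ∈? W ⟧ (λ u → ⟦ u ∈? P ⟧) ⟨
        ⟦ v ∈? W ⟧ * sum (λ u → ⟦ u ∈? P ⟧)   ≡⟨ cong (⟦ v ∈? W ⟧ *_) (card≡sum P) ⟨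
        ⟦ v ∈? W ⟧ * card P                   ≤⟨ ℕ.*-monoʳ-≤ ⟦ v ∈? W ⟧ P≤ ⟩
        ⟦ v ∈? W ⟧ * suc D                    ≡⟨ ℕ.*-comm ⟦ v ∈? W ⟧ (suc D) ⟩
        suc D * ⟦ v ∈? W ⟧                    ∎

    W∩P-card : ∀ W → card (W ∩ P) ≤ card (Near W) + ⟦ v ∈? W ⟧
    W∩P-card W = begin
      card (W ∩ P)
        ≡⟨ card≡sum (W ∩ P) ⟩
      sum (λ u → ⟦ u ∈? (W ∩ P) ⟧)
        ≤⟨ sum-mono (λ u → ⟦⟧-≤ (u ∈? (W ∩ P)) (cases u)) ⟩
      sum (λ u → ⟦ u ∈? Near W ⟧ + ⟦ v ∈? W ⟧ * ⟦ u ∈? ⁅ v ⁆ ⟧)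
        ≡⟨ ∑-distrib-+ (λ u → ⟦ u ∈? Near W ⟧) _ ⟩
      sum (λ u → ⟦ u ∈? Near W ⟧) + sum (λ u → ⟦ v ∈? W ⟧ * ⟦ u ∈? ⁅ v ⁆ ⟧)
        ≡⟨ cong₂ _+_ (card≡sum (Near W)) (*-distribˡ-sum ⟦ v ∈? W ⟧ (λ u → ⟦ u ∈? ⁅ v ⁆ ⟧)) ⟨
      card (Near W) + ⟦ v ∈? W ⟧ * sum (λ u → ⟦ u ∈? ⁅ v ⁆ ⟧)
        ≡⟨ cong (λ z → card (Near W) + ⟦ v ∈? W ⟧ * z) (trans (sym (card≡sum ⁅ v ⁆)) (∣⁅x⁆∣≡1 v)) ⟩
      card (Near W) + ⟦ v ∈? W ⟧ * 1
        ≡⟨ cong (card (Near W) +_) (ℕ.*-identityʳ _) ⟩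
      card (Near W) + ⟦ v ∈? W ⟧ ∎
      where
      open ℕ.≤-Reasoning
      one : ∀ {S : Subset N} {u} → u ∈ S → 1 ≤ ⟦ u ∈? S ⟧
      one {S} {u} u∈S = 1≤⟦⟧ (u ∈? S) u∈S
      cases : ∀ u → u ∈ W ∩ P → 1 ≤ ⟦ u ∈? Near W ⟧ + ⟦ v ∈? W ⟧ * ⟦ u ∈? ⁅ v ⁆ ⟧
      cases u u∈ with x∈p∩q⁻ W P u∈
      ... | u∈W , u∈P with insertElim G u∈P
      ...   | inj₁ refl = ℕ.≤-trans (ℕ.*-mono-≤ (one u∈W) (one (x∈⁅x⁆ u))) (ℕ.m≤n+m _ _)
      ...   | inj₂ u∈′  = ℕ.≤-trans (one (x∈p∩q⁺ (u∈W , p∩q⊆q U _ u∈′))) (ℕ.m≤m+n _ _)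

    J : Subset N → ℕ
    J W = ⟦ indepLarge? W ⟧

    -- A pair of `W` and a free `u` is sent to `W` with `u` added and marked, at the price of a
    -- factor `Δ`. As `u ∈ P`, nothing changes off `P`, so large sets stay large.
    free-bound : wsum Δ (λ W → J W * sum (λ u → ⟦ free? W u ⟧)) ≤ Δ * wsum Δ (λ W → J W * card (W ∩ P))
    free-bound = begin
      wsum Δ (λ W → J W * sum (λ u → ⟦ free? W u ⟧))
        ≡⟨ wsum-cong Δ (λ W → *-distribˡ-sum (J W) (λ u → ⟦ free? W u ⟧)) ⟩
      wsum Δ (λ W → sum (λ u → J W * ⟦ free? W u ⟧))
        ≡⟨ wsum-sum Δ (λ u W → J W * ⟦ free? W u ⟧) ⟩
      sum (λ u → wsum Δ (λ W → J W * ⟦ free? W u ⟧))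
        ≤⟨ sum-mono (λ u → wsum-insert Δ u (λ W u∉W → step u W) (λ W u∈W → vanish u W u∈W)) ⟩
      sum (λ u → Δ * wsum Δ (λ W → J W * ⟦ u ∈? (W ∩ P) ⟧))
        ≡⟨ *-distribˡ-sum Δ (λ u → wsum Δ (λ W → J W * ⟦ u ∈? (W ∩ P) ⟧)) ⟨
      Δ * sum (λ u → wsum Δ (λ W → J W * ⟦ u ∈? (W ∩ P) ⟧))
        ≡⟨ cong (Δ *_) (wsum-sum Δ (λ u W → J W * ⟦ u ∈? (W ∩ P) ⟧)) ⟨
      Δ * wsum Δ (λ W → sum (λ u → J W * ⟦ u ∈? (W ∩ P) ⟧))
        ≡⟨ cong (Δ *_) (wsum-cong Δ λ W → trans (sym (*-distribˡ-sum (J W) (λ u → ⟦ u ∈? (W ∩ P) ⟧)))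
             (cong (J W *_) (sym (card≡sum (W ∩ P))))) ⟩
      Δ * wsum Δ (λ W → J W * card (W ∩ P)) ∎
      where
      open ℕ.≤-Reasoning
      step : ∀ u W → J W * ⟦ free? W u ⟧ ≤ J (W [ u ]≔ inside) * ⟦ u ∈? ((W [ u ]≔ inside) ∩ P) ⟧
      step u W with indepLarge? W | free? W u
      ... | no _ | _ = z≤n
      ... | yes _ | no _ = z≤n
      ... | yes (I , ¬s) | yes (u∈P , u∉W , far) = ℕ.≤-reflexive (sym (cong₂ _*_
              (⟦⟧-yes (indepLarge? W⁺) (I⁺ , ¬s ∘ small-agree {W⁺} {W} (agree-sym {P = P} {W} {W⁺} (agree-insert W u∈P))))
              (⟦⟧-yes (u ∈? (W⁺ ∩ P)) (x∈p∩q⁺ ([]≔-updates W u , u∈P)))))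
        where
        W⁺ = W [ u ]≔ inside
        I⁺ : Indep W⁺
        I⁺ = indep-insert I (P⊆U u∈P) far (∈-insert⁻ W)
      vanish : ∀ u W → u ∈ W → J W * ⟦ free? W u ⟧ ≡ 0
      vanish u W u∈W = trans (cong (J W *_) (⟦⟧-no (free? W u) λ (_ , u∉W , _) → u∉W u∈W)) (ℕ.*-zeroʳ (J W))

    -- A large `W` has more than `τ * δ` open vertices. On average the free ones amount to at most
    -- `2 * δ` for each element of `W ∩ P`, the blocked ones to `2 * δ` for each element of
    -- `Near W`; together they make the 4, and `δ` cancels.
    large-bound : τ * wsum Δ J ≤
      4 * (D * wsum Δ (λ W → ⟦ indepLarge? W ×-dec (v ∈? W) ⟧) + wsum Δ (λ W → J W * card (Near W)))
    large-bound = ℕ.*-cancelˡ-≤ δ (begin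
      δ * (τ * wsum Δ J)
        ≡⟨ trans (sym (ℕ.*-assoc δ τ _)) (cong (_* wsum Δ J) (ℕ.*-comm δ τ)) ⟩
      τ * δ * wsum Δ J
        ≡⟨ wsum-* Δ (τ * δ) J ⟨
      wsum Δ (λ W → τ * δ * J W)
        ≤⟨ wsum-mono Δ pointwise-bound ⟩
      wsum Δ (λ W → J W * free W + (2 * δ * (J W * card (Near W)) + suc D * O W))
        ≡⟨ trans (wsum-+ Δ (λ W → J W * free W) _) (cong (wsum Δ (λ W → J W * free W) +_) (linear (2 * δ) (suc D))) ⟩
      wsum Δ (λ W → J W * free W) + (2 * δ * near + suc D * occ)
        ≤⟨ ℕ.+-monoˡ-≤ _ free-bound ⟩
      2 * δ * wsum Δ (λ W → J W * card (W ∩ P)) + (2 * δ * near + suc D * occ)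
        ≤⟨ ℕ.+-monoˡ-≤ _ (ℕ.*-monoʳ-≤ (2 * δ) (wsum-mono Δ split)) ⟩
      2 * δ * wsum Δ (λ W → 1 * (J W * card (Near W)) + 1 * O W) + (2 * δ * near + suc D * occ)
        ≡⟨ cong (λ z → 2 * δ * z + (2 * δ * near + suc D * occ)) (linear 1 1) ⟩
      2 * δ * (1 * near + 1 * occ) + (2 * δ * near + suc D * occ)
        ≡⟨ solve 4 (λ d a o D → con 2 :* d :* (con 1 :* a :+ con 1 :* o) :+ (con 2 :* d :* a :+ (con 1 :+ D) :* o)
                              := con 4 :* d :* a :+ (con 2 :* d :+ con 1 :+ D) :* o) refl δ near occ D ⟩
      4 * δ * near + (2 * δ + 1 + D) * occ
        ≤⟨ ℕ.+-monoʳ-≤ (4 * δ * near) (ℕ.*-monoˡ-≤ occ constants) ⟩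
      4 * δ * near + (4 * (δ * D)) * occ
        ≡⟨ solve 4 (λ d a o D → con 4 :* d :* a :+ (con 4 :* (d :* D)) :* o
                              := d :* (con 4 :* (D :* o :+ a))) refl δ near occ D ⟩
      δ * (4 * (D * occ + near)) ∎)
      where
      open ℕ.≤-Reasoning
      free O : Subset N → ℕ
      free W = sum (λ u → ⟦ free? W u ⟧)
      O W = ⟦ indepLarge? W ×-dec (v ∈? W) ⟧
      near = wsum Δ (λ W → J W * card (Near W))
      occ = wsum Δ O
      linear : ∀ a b → wsum Δ (λ W → a * (J W * card (Near W)) + b * O W) ≡ a * near + b * occ
      linear a b = trans (wsum-+ Δ (λ W → a * (J W * card (Near W))) (λ W → b * O W))
        (cong₂ _+_ (wsum-* Δ a (λ W → J W * card (Near W))) (wsum-* Δ b O))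
      JO : ∀ W → J W * ⟦ v ∈? W ⟧ ≤ O W
      JO W = ⟦⟧-×≤ (indepLarge? W) (v ∈? W) (indepLarge? W ×-dec (v ∈? W)) _,_
      pointwise-bound : ∀ W → τ * δ * J W ≤ J W * free W + (2 * δ * (J W * card (Near W)) + suc D * O W)
      pointwise-bound W = begin
        τ * δ * J W
          ≡⟨ ℕ.*-comm (τ * δ) (J W) ⟩
        J W * (τ * δ)
          ≤⟨ ⟦⟧*-≤ (indepLarge? W) (λ (I , ¬s) → ℕ.≤-trans (ℕ.<⇒≤ (ℕ.≰⇒> ¬s)) (X-card W I)) ⟩
        J W * (free W + 2 * δ * card (Near W) + suc D * ⟦ v ∈? W ⟧)
          ≡⟨ solve 6 (λ j f d c D o → j :* (f :+ con 2 :* d :* c :+ (con 1 :+ D) :* o)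
                                   := j :* f :+ (con 2 :* d :* (j :* c) :+ (con 1 :+ D) :* (j :* o)))
               refl (J W) (free W) δ (card (Near W)) D ⟦ v ∈? W ⟧ ⟩
        J W * free W + (2 * δ * (J W * card (Near W)) + suc D * (J W * ⟦ v ∈? W ⟧))
          ≤⟨ ℕ.+-monoʳ-≤ (J W * free W) (ℕ.+-monoʳ-≤ (2 * δ * (J W * card (Near W))) (ℕ.*-monoʳ-≤ (suc D) (JO W))) ⟩
        J W * free W + (2 * δ * (J W * card (Near W)) + suc D * O W) ∎
      split : ∀ W → J W * card (W ∩ P) ≤ 1 * (J W * card (Near W)) + 1 * O W
      split W = begin
        J W * card (W ∩ P)
          ≤⟨ ℕ.*-monoʳ-≤ (J W) (W∩P-card W) ⟩
        J W * (card (Near W) + ⟦ v ∈? W ⟧)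
          ≡⟨ ℕ.*-distribˡ-+ (J W) (card (Near W)) ⟦ v ∈? W ⟧ ⟩
        J W * card (Near W) + J W * ⟦ v ∈? W ⟧
          ≤⟨ ℕ.+-monoʳ-≤ (J W * card (Near W)) (JO W) ⟩
        J W * card (Near W) + O W
          ≡⟨ cong₂ _+_ (ℕ.*-identityˡ (J W * card (Near W))) (ℕ.*-identityˡ (O W)) ⟨
        1 * (J W * card (Near W)) + 1 * O W ∎
      constants : 2 * δ + 1 + D ≤ 4 * (δ * D)
      constants = begin
        2 * δ + 1 + D
          ≤⟨ ℕ.+-mono-≤ (ℕ.+-mono-≤ (ℕ.*-monoʳ-≤ 2 (ℕ.m≤m*n δ D)) (>-nonZero⁻¹ (δ * D) {{ℕ.m*n≢0 δ D}})) (ℕ.m≤n*m D δ) ⟩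
        2 * (δ * D) + δ * D + δ * D
          ≡⟨ solve 1 (λ x → con 2 :* x :+ x :+ x := con 4 :* x) refl (δ * D) ⟩
        4 * (δ * D) ∎

    -- `Small` splits the independent sets in two, and each part satisfies its own inequality.
    local-occupancy : τ * wsum Δ (λ W → ⟦ indep? W ⟧) ≤
      4 * (D * wsum Δ (λ W → ⟦ indep? W ⟧ * ⟦ v ∈? W ⟧) + wsum Δ (λ W → ⟦ indep? W ⟧ * card (Near W)))
    local-occupancy = begin
      τ * wsum Δ (λ W → ⟦ indep? W ⟧)
        ≤⟨ ℕ.*-monoʳ-≤ τ (wsum-mono Δ total) ⟩
      τ * wsum Δ (λ W → ⟦ indepSmall? W ⟧ + J W)
        ≡⟨ cong (τ *_) (wsum-+ Δ (λ W → ⟦ indepSmall? W ⟧) J) ⟩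
      τ * (wsum Δ (λ W → ⟦ indepSmall? W ⟧) + wsum Δ J)
        ≡⟨ ℕ.*-distribˡ-+ τ _ _ ⟩
      τ * wsum Δ (λ W → ⟦ indepSmall? W ⟧) + τ * wsum Δ J
        ≤⟨ ℕ.+-mono-≤ small-bound large-bound ⟩
      4 * D * occ₁ + 4 * (D * occ₂ + near)
        ≡⟨ solve 4 (λ D a b c → con 4 :* D :* a :+ con 4 :* (D :* b :+ c) := con 4 :* (D :* (a :+ b) :+ c)) refl D occ₁ occ₂ near ⟩
      4 * (D * (occ₁ + occ₂) + near)
        ≤⟨ ℕ.*-monoʳ-≤ 4 (ℕ.+-mono-≤ (ℕ.*-monoʳ-≤ D occupied) (wsum-mono Δ λ W →
             ℕ.*-monoˡ-≤ (card (Near W)) (⟦⟧-mono (indepLarge? W) (indep? W) proj₁))) ⟩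
      4 * (D * wsum Δ (λ W → ⟦ indep? W ⟧ * ⟦ v ∈? W ⟧) + wsum Δ (λ W → ⟦ indep? W ⟧ * card (Near W))) ∎
      where
      open ℕ.≤-Reasoning
      occ₁ = wsum Δ (λ W → ⟦ indepSmall? W ×-dec (v ∈? W) ⟧)
      occ₂ = wsum Δ (λ W → ⟦ indepLarge? W ×-dec (v ∈? W) ⟧)
      near = wsum Δ (λ W → J W * card (Near W))
      total : ∀ W → ⟦ indep? W ⟧ ≤ ⟦ indepSmall? W ⟧ + J W
      total W = ⟦⟧-≤ (indep? W) λ I → pick I (small? W)
        where
        pick : Indep W → Dec (Small W) → 1 ≤ ⟦ indepSmall? W ⟧ + J W
        pick I (yes s) = ℕ.≤-trans (1≤⟦⟧ (indepSmall? W) (I , s)) (ℕ.m≤m+n _ _)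
        pick I (no ¬s) = ℕ.≤-trans (1≤⟦⟧ (indepLarge? W) (I , ¬s)) (ℕ.m≤n+m _ _)
      occupied : occ₁ + occ₂ ≤ wsum Δ (λ W → ⟦ indep? W ⟧ * ⟦ v ∈? W ⟧)
      occupied = ℕ.≤-trans (ℕ.≤-reflexive (sym (wsum-+ Δ (λ W → ⟦ indepSmall? W ×-dec (v ∈? W) ⟧) (λ W → ⟦ indepLarge? W ×-dec (v ∈? W) ⟧))))
          (wsum-mono Δ λ W → merge (indep? W) (small? W) (v ∈? W))
        where
        merge : ∀ {A B C : Set} (a? : Dec A) (b? : Dec B) (c? : Dec C) →
          ⟦ (a? ×-dec b?) ×-dec c? ⟧ + ⟦ (a? ×-dec ¬? b?) ×-dec c? ⟧ ≤ ⟦ a? ⟧ * ⟦ c? ⟧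
        merge (no _)  b?      c?      = z≤n
        merge (yes _) (yes _) (yes _) = s≤s z≤n
        merge (yes _) (yes _) (no _)  = z≤n
        merge (yes _) (no _)  (yes _) = s≤s z≤n
        merge (yes _) (no _)  (no _)  = z≤n

  -- The partition function of the hard-core model, up to a factor `Δ ^ N`.
  Z : ℕ
  Z = wsum Δ (λ W → ⟦ indep? W ⟧)

  Z>0 : 1 ≤ Z
  Z>0 = positive-at-∅ (λ W → ⟦ indep? W ⟧) (1≤⟦⟧ (indep? ∅)
    ((λ i∈ → contradiction i∈ ∉⊥) , λ i j i∈ → contradiction i∈ ∉⊥))
    where
    positive-at-∅ : ∀ {N} (g : Subset N → ℕ) → 1 ≤ g ∅ → 1 ≤ wsum Δ g
    positive-at-∅ {zero}  g 1≤ = 1≤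
    positive-at-∅ {suc N} g 1≤ = ℕ.≤-trans
      (ℕ.*-mono-≤ (>-nonZero⁻¹ Δ {{ℕ.m*n≢0 2 δ}}) (positive-at-∅ (g ∘ (outside ∷_)) 1≤))
      (ℕ.m≤m+n _ _)

  -- Over all `v ∈ U` the probabilities of `v ∈ W` add up to E|W|, which is at most `n`; the sizes
  -- of W ∩ N(v) count the edges between `W` and `U`, at most `D` for each element of `W`. Each sum
  -- contributes `4 * D * n`.
  card-bound : card U * τ ≤ 8 * D * n
  card-bound = ℕ.*-cancelʳ-≤ _ _ Z {{>-nonZero Z>0}} (begin
    card U * τ * Z
      ≡⟨ trans (ℕ.*-assoc (card U) τ Z) (trans (cong (_* (τ * Z)) (card≡sum U)) (*-distribʳ-sum (τ * Z) (λ v → ⟦ v ∈? U ⟧))) ⟩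
    sum (λ v → ⟦ v ∈? U ⟧ * (τ * Z))
      ≤⟨ sum-mono (λ v → ⟦⟧*-≤ (v ∈? U) (Around.local-occupancy v)) ⟩
    sum (λ v → ⟦ v ∈? U ⟧ * (4 * (D * occ v + near v)))
      ≤⟨ sum-mono (λ v → spread v) ⟩
    sum (λ v → 4 * D * occ v + 4 * (⟦ v ∈? U ⟧ * near v))
      ≡⟨ trans (∑-distrib-+ (λ v → 4 * D * occ v) _)
           (cong₂ _+_ (sym (*-distribˡ-sum (4 * D) occ)) (sym (*-distribˡ-sum 4 (λ v → ⟦ v ∈? U ⟧ * near v)))) ⟩
    4 * D * sum occ + 4 * sum (λ v → ⟦ v ∈? U ⟧ * near v)
      ≤⟨ ℕ.+-mono-≤ (ℕ.*-monoʳ-≤ (4 * D) occ-total) (ℕ.*-monoʳ-≤ 4 near-total) ⟩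
    4 * D * (n * Z) + 4 * (D * n * Z)
      ≡⟨ solve 3 (λ D n z → con 4 :* D :* (n :* z) :+ con 4 :* (D :* n :* z) := con 8 :* D :* n :* z) refl D n Z ⟩
    8 * D * n * Z ∎)
    where
    open ℕ.≤-Reasoning
    I : Subset N → ℕ
    I W = ⟦ indep? W ⟧
    occ near : Fin N → ℕ
    occ v = wsum Δ (λ W → I W * ⟦ v ∈? W ⟧)
    near v = wsum Δ (λ W → I W * card (W ∩ nbrs G v))
    spread : ∀ v → ⟦ v ∈? U ⟧ * (4 * (D * occ v + near v)) ≤ 4 * D * occ v + 4 * (⟦ v ∈? U ⟧ * near v)
    spread v = begin
      u * (4 * (D * occ v + near v))
        ≡⟨ solve 4 (λ u D a b → u :* (con 4 :* (D :* a :+ b)) := u :* (con 4 :* D :* a) :+ con 4 :* (u :* b)) refl u D (occ v) (near v) ⟩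
      u * (4 * D * occ v) + 4 * (u * near v)
        ≤⟨ ℕ.+-monoˡ-≤ _ (ℕ.*-monoˡ-≤ (4 * D * occ v) (⟦⟧≤1 (v ∈? U))) ⟩
      1 * (4 * D * occ v) + 4 * (u * near v)
        ≡⟨ cong (_+ 4 * (u * near v)) (ℕ.*-identityˡ (4 * D * occ v)) ⟩
      4 * D * occ v + 4 * (u * near v) ∎
      where u = ⟦ v ∈? U ⟧
    occ-total : sum occ ≤ n * Z
    occ-total = begin
      sum occ
        ≡⟨ wsum-sum Δ (λ v W → I W * ⟦ v ∈? W ⟧) ⟨
      wsum Δ (λ W → sum (λ v → I W * ⟦ v ∈? W ⟧))
        ≡⟨ wsum-cong Δ (λ W → trans (sym (*-distribˡ-sum (I W) (λ v → ⟦ v ∈? W ⟧))) (cong (I W *_) (sym (card≡sum W)))) ⟩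
      wsum Δ (λ W → I W * card W)
        ≤⟨ wsum-mono Δ (λ W → ℕ.≤-trans (⟦⟧*-≤ (indep? W) indep-card) (ℕ.≤-reflexive (ℕ.*-comm (I W) n))) ⟩
      wsum Δ (λ W → n * I W)
        ≡⟨ wsum-* Δ n I ⟩
      n * Z ∎
    near-total : sum (λ v → ⟦ v ∈? U ⟧ * near v) ≤ D * n * Z
    near-total = begin
      sum (λ v → ⟦ v ∈? U ⟧ * near v)
        ≡⟨ sum-cong-≗ (λ v → sym (wsum-* Δ ⟦ v ∈? U ⟧ (λ W → I W * card (W ∩ nbrs G v)))) ⟩
      sum (λ v → wsum Δ (λ W → ⟦ v ∈? U ⟧ * (I W * card (W ∩ nbrs G v))))
        ≡⟨ wsum-sum Δ (λ v W → ⟦ v ∈? U ⟧ * (I W * card (W ∩ nbrs G v))) ⟨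
      wsum Δ (λ W → sum (λ v → ⟦ v ∈? U ⟧ * (I W * card (W ∩ nbrs G v))))
        ≡⟨ wsum-cong Δ (λ W → trans
             (sum-cong-≗ λ v → solve 3 (λ u i c → u :* (i :* c) := i :* (u :* c)) refl ⟦ v ∈? U ⟧ (I W) (card (W ∩ nbrs G v)))
             (sym (*-distribˡ-sum (I W) (λ v → ⟦ v ∈? U ⟧ * card (W ∩ nbrs G v))))) ⟩
      wsum Δ (λ W → I W * sum (λ v → ⟦ v ∈? U ⟧ * card (W ∩ nbrs G v)))
        ≤⟨ wsum-mono Δ (λ W → ℕ.≤-trans (⟦⟧*-≤ (indep? W) (edges W)) (ℕ.≤-reflexive (ℕ.*-comm (I W) (D * n)))) ⟩
      wsum Δ (λ W → D * n * I W)
        ≡⟨ wsum-* Δ (D * n) I ⟩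
      D * n * Z ∎
      where
      edges : ∀ W → Indep W → sum (λ v → ⟦ v ∈? U ⟧ * card (W ∩ nbrs G v)) ≤ D * n
      edges W i@(W⊆U , _) = begin
        sum (λ v → ⟦ v ∈? U ⟧ * card (W ∩ nbrs G v))
          ≡⟨ sum-cong-≗ (λ v → trans (cong (⟦ v ∈? U ⟧ *_) (card≡sum (W ∩ nbrs G v))) (*-distribˡ-sum ⟦ v ∈? U ⟧ (λ u → ⟦ u ∈? (W ∩ nbrs G v) ⟧))) ⟩
        sum (λ v → sum (λ u → ⟦ v ∈? U ⟧ * ⟦ u ∈? (W ∩ nbrs G v) ⟧))
          ≡⟨ ∑-comm (λ v u → ⟦ v ∈? U ⟧ * ⟦ u ∈? (W ∩ nbrs G v) ⟧) ⟩
        sum (λ u → sum (λ v → ⟦ v ∈? U ⟧ * ⟦ u ∈? (W ∩ nbrs G v) ⟧))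
          ≤⟨ sum-mono (λ u → sum-mono (λ v → swap u v)) ⟩
        sum (λ u → sum (λ v → ⟦ u ∈? W ⟧ * ⟦ v ∈? (U ∩ nbrs G u) ⟧))
          ≡⟨ sum-cong-≗ (λ u → trans (sym (*-distribˡ-sum ⟦ u ∈? W ⟧ (λ v → ⟦ v ∈? (U ∩ nbrs G u) ⟧)))
              (cong (⟦ u ∈? W ⟧ *_) (sym (card≡sum (U ∩ nbrs G u))))) ⟩
        sum (λ u → ⟦ u ∈? W ⟧ * card (U ∩ nbrs G u))
          ≤⟨ sum-mono (λ u → ⟦⟧*-≤ (u ∈? W) (degree ∘ W⊆U)) ⟩
        sum (λ u → ⟦ u ∈? W ⟧ * D)
          ≡⟨ trans (sym (*-distribʳ-sum D (λ u → ⟦ u ∈? W ⟧))) (cong (_* D) (sym (card≡sum W))) ⟩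
        card W * D
          ≤⟨ ℕ.*-monoˡ-≤ D (indep-card i) ⟩
        n * D
          ≡⟨ ℕ.*-comm n D ⟩
        D * n ∎
        where
        swap : ∀ u v → ⟦ v ∈? U ⟧ * ⟦ u ∈? (W ∩ nbrs G v) ⟧ ≤ ⟦ u ∈? W ⟧ * ⟦ v ∈? (U ∩ nbrs G u) ⟧
        swap u v with v ∈? U | u ∈? (W ∩ nbrs G v)
        ... | no _    | _      = z≤n
        ... | yes _   | no _   = z≤n
        ... | yes v∈U | yes u∈ = let (u∈W , a) = x∈p∩q⁻ W _ u∈ in ℕ.≤-reflexive (sym (cong₂ _*_
              (⟦⟧-yes (u ∈? W) u∈W)
              (⟦⟧-yes (v ∈? (U ∩ nbrs G u)) (x∈p∩q⁺ (v∈U , ⇒∈nbrs G (flipAdj G (∈nbrs⇒ G a)))))))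

-- Clique-free sets in graphs without large independent sets

-- Q stands for a constant multiple of n / log n.
cliqueBound : ℕ → ℕ → ℕ → ℕ
cliqueBound n Q zero          = 0
cliqueBound n Q (suc zero)    = 0
cliqueBound n Q (suc (suc i)) = n * Q ^ i

module _ (G : Graph N) where
  empty-clique : ∀ {U} → CliqueIn G 0 U
  empty-clique = ∅ , ⊥⊆ , ∣⊥∣≡0 N , λ i j i∈ → contradiction i∈ ∉⊥

  vertex-clique : ∀ {U v} → v ∈ U → CliqueIn G 1 U
  vertex-clique v∈U = extendClique G {W = ∅} v∈U ⊥⊆ ⊥⊆ empty-clique

  neighbour-clique : ∀ {k U v} → v ∈ U → CliqueIn G k (U ∩ nbrs G v) → CliqueIn G (suc k) U
  neighbour-clique {U = U} v∈U = extendClique G v∈U (p∩q⊆p U _) (p∩q⊆q U _)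

  1-clique-free : ∀ U → ¬ CliqueIn G 1 U → card U ≤ 0
  1-clique-free U free with 1 ℕ.≤? card U
  ... | no ¬1≤  = ℕ.≤-pred (ℕ.≰⇒> ¬1≤)
  ... | yes 1≤ = contradiction (vertex-clique (proj₂ (nonempty U 1≤))) free

-- `8n≤Qτ` turns the bound 8Dn / τ of `card-bound` into `D * Q`. `τ2^τ≤Q` supplies `sparse` in the
-- general step, `τ2^τ≤2n` in the triangle-free case.
module CliqueFree (G : Graph N) (n Q τ : ℕ) (2≤n : 2 ≤ n) .{{_ : NonZero Q}} .{{_ : NonZero τ}}
  (¬indep : ¬ HasIndependent n G) (8n≤Qτ : 8 * n ≤ Q * τ) (τ2^τ≤Q : τ * 2 ^ τ ≤ Q) (τ2^τ≤2n : τ * 2 ^ τ ≤ 2 * n)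
  where

  private instance
    n≢0 : NonZero n
    n≢0 = >-nonZero (ℕ.≤-trans (s≤s z≤n) 2≤n)

  private
    rescale : ∀ D (U : Subset N) → card U * τ ≤ 8 * D * n → card U ≤ D * Q
    rescale D U h = ℕ.*-cancelʳ-≤ _ _ τ (begin
      card U * τ     ≤⟨ h ⟩
      8 * D * n      ≡⟨ solve 2 (λ D n → con 8 :* D :* n := D :* (con 8 :* n)) refl D n ⟩
      D * (8 * n)    ≤⟨ ℕ.*-monoʳ-≤ D 8n≤Qτ ⟩
      D * (Q * τ)    ≡⟨ ℕ.*-assoc D Q τ ⟨
      D * Q * τ      ∎)
      where open ℕ.≤-Reasoning

    Bound : ℕ → Set
    Bound j = ∀ U → ¬ CliqueIn G j U → card U ≤ cliqueBound n Q j

    bound₂ : Bound 2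
    bound₂ U free with ℕ.≤-total n (card U)
    ... | inj₂ ≤n = ℕ.≤-trans ≤n (ℕ.≤-reflexive (sym (ℕ.*-identityʳ n)))
    ... | inj₁ n≤ with subset-of-card n U n≤
    ...   | R , R⊆U , c = contradiction (R , c , λ i j i∈ j∈ a → free
              (neighbour-clique G (R⊆U i∈) (vertex-clique G (x∈p∩q⁺ (R⊆U j∈ , ⇒∈nbrs G a))))) ¬indep

    -- This case stands apart because `cliqueBound` is 0 at 1: an edge in a triangle-free set has no
    -- common neighbours, and `δ = 1` leaves room for just its two endpoints.
    bound₃ : Bound 3
    bound₃ U free = begin
      card U         ≤⟨ rescale n U (HardCore.card-bound G U n n 1 τ ¬indep degree codegree sparse) ⟩
      n * Q          ≡⟨ cong (n *_) (ℕ.*-identityʳ Q) ⟨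
      n * (Q * 1)    ∎
      where
      open ℕ.≤-Reasoning
      degree : ∀ {v} → v ∈ U → card (U ∩ nbrs G v) ≤ n
      degree v∈U = ℕ.≤-trans (bound₂ _ (free ∘ neighbour-clique G v∈U)) (ℕ.≤-reflexive (ℕ.*-identityʳ n))
      codegree : ∀ {v w} → v ∈ U → w ∈ U → Adjacent G v w → 2 + card (U ∩ nbrs G v ∩ nbrs G w) ≤ 2
      codegree {v} {w} v∈U w∈U a = s≤s (s≤s (subst (λ S → card S ≤ 0) (∩-assoc U (nbrs G v) (nbrs G w))
        (1-clique-free G _ λ c → free (neighbour-clique G v∈U (neighbour-clique G (x∈p∩q⁺ (w∈U , ⇒∈nbrs G a)) c)))))
      sparse : τ * 2 ^ τ * 2 ≤ 4 * n
      sparse = ℕ.≤-trans (ℕ.*-monoˡ-≤ 2 τ2^τ≤2n) (ℕ.≤-reflexive (solve 1 (λ n → con 2 :* n :* con 2 := con 4 :* n) refl n))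

    bound-step : ∀ i → Bound (suc (suc i)) → Bound (suc (suc (suc i))) → Bound (suc (suc (suc (suc i))))
    bound-step i bound bound′ U free = begin
      card U             ≤⟨ rescale D U (HardCore.card-bound G U n D δ τ {{nz (suc i)}} {{nz i}} ¬indep degree codegree sparse) ⟩
      n * Q ^ suc i * Q  ≡⟨ trans (ℕ.*-assoc n (Q ^ suc i) Q) (cong (n *_) (ℕ.*-comm (Q ^ suc i) Q)) ⟩
      n * Q ^ suc (suc i) ∎
      where
      open ℕ.≤-Reasoning
      D = n * Q ^ suc i
      δ = n * Q ^ i
      nz : ∀ j → NonZero (n * Q ^ j)
      nz j = ℕ.m*n≢0 n (Q ^ j) {{n≢0}} {{ℕ.m^n≢0 Q j}}
      degree : ∀ {v} → v ∈ U → card (U ∩ nbrs G v) ≤ D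
      degree v∈U = bound′ _ (free ∘ neighbour-clique G v∈U)
      codegree : ∀ {v w} → v ∈ U → w ∈ U → Adjacent G v w → 2 + card (U ∩ nbrs G v ∩ nbrs G w) ≤ 2 * δ
      codegree {v} {w} v∈U w∈U a = begin
        2 + card (U ∩ nbrs G v ∩ nbrs G w)
          -- The two endpoints are absorbed by a second `δ`, since `2 ≤ n ≤ δ`.
          ≤⟨ ℕ.+-mono-≤ (ℕ.≤-trans 2≤n (ℕ.m≤m*n n (Q ^ i) {{ℕ.m^n≢0 Q i}}))
               (subst (λ S → card S ≤ δ) (∩-assoc U (nbrs G v) (nbrs G w))
                 (bound _ λ c →
                   free (neighbour-clique G v∈U (neighbour-clique G (x∈p∩q⁺ (w∈U , ⇒∈nbrs G a)) c)))) ⟩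
        δ + δ ≡⟨ cong (δ +_) (ℕ.+-identityʳ δ) ⟨
        2 * δ ∎
      sparse : τ * 2 ^ τ * (2 * δ) ≤ 4 * D
      sparse = begin
        τ * 2 ^ τ * (2 * δ)   ≤⟨ ℕ.*-monoˡ-≤ (2 * δ) τ2^τ≤Q ⟩
        Q * (2 * (n * Q ^ i)) ≡⟨ solve 3 (λ q n x → q :* (con 2 :* (n :* x)) := con 2 :* (n :* (q :* x))) refl Q n (Q ^ i) ⟩
        2 * D                 ≤⟨ ℕ.*-monoˡ-≤ D (s≤s (s≤s (z≤n {2}))) ⟩
        4 * D                 ∎

  card-cliqueFree : ∀ j U → ¬ CliqueIn G j U → card U ≤ cliqueBound n Q j
  card-cliqueFree zero                   U free = contradiction (empty-clique G) free
  card-cliqueFree (suc zero)             U free = 1-clique-free G U free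
  card-cliqueFree (suc (suc zero))       = bound₂
  card-cliqueFree (suc (suc (suc zero))) = bound₃
  card-cliqueFree (suc (suc (suc (suc i)))) =
    bound-step i (card-cliqueFree (suc (suc i))) (card-cliqueFree (suc (suc (suc i))))

-- Cliques in blow-ups

length-filter-map : ∀ {A B : Set} {P : B → Set} (P? : Decidable P) (g : A → B) xs →
  length (filter P? (map g xs)) ≡ length (filter (P? ∘ g) xs)
length-filter-map P? g []       = refl
length-filter-map P? g (x ∷ xs) with does (P? (g x))
... | true  = cong suc (length-filter-map P? g xs)
... | false = length-filter-map P? g xs

-- With `Δ = 1` the weighted sum is plain counting, which makes the tools for `wsum` available for
-- cliques.
length-filter-subsets : {P : Subset N → Set} (P? : Decidable P) →
  length (filter P? (subsets N)) ≡ wsum 1 (λ S → ⟦ P? S ⟧)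
length-filter-subsets {zero}  P? with P? []
... | yes _ = refl
... | no _  = refl
length-filter-subsets {suc N} P? = begin
  length (filter P? (map (outside ∷_) (subsets N) ++ map (inside ∷_) (subsets N)))
    ≡⟨ trans (cong length (List.filter-++ P? (map (outside ∷_) (subsets N)) _)) (List.length-++ (filter P? (map (outside ∷_) (subsets N)))) ⟩
  length (filter P? (map (outside ∷_) (subsets N))) + length (filter P? (map (inside ∷_) (subsets N)))
    ≡⟨ cong₂ _+_ (half outside) (half inside) ⟩
  wsum 1 (λ S → ⟦ P? (outside ∷ S) ⟧) + wsum 1 (λ S → ⟦ P? (inside ∷ S) ⟧)
    ≡⟨ cong (_+ wsum 1 (λ S → ⟦ P? (inside ∷ S) ⟧)) (ℕ.+-identityʳ _) ⟨
  wsum 1 (λ S → ⟦ P? S ⟧) ∎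
  where
  open ≡-Reasoning
  half : ∀ b → length (filter P? (map (b ∷_) (subsets N))) ≡ wsum 1 (λ S → ⟦ P? (b ∷ S) ⟧)
  half b = trans (length-filter-map P? (b ∷_) (subsets N)) (length-filter-subsets (P? ∘ (b ∷_)))

card-delete : ∀ {v} (S : Subset N) → v ∈ S → suc (card (S [ v ]≔ outside)) ≡ card S
card-delete (inside ∷ S)  here        = refl
card-delete (inside ∷ S)  (there v∈S) = cong suc (card-delete S v∈S)
card-delete (outside ∷ S) (there v∈S) = card-delete S v∈S

-- Counting cliques one vertex at a time

module Counting (G : Graph N) where
  CliqueOf : ℕ → Subset N → Subset N → Set
  CliqueOf i U S = S ⊆ U × IsKClique i G S

  cliqueOf? : ∀ i U → Decidable (CliqueOf i U)
  cliqueOf? i U S = (S ⊆? U) ×-dec isKClique? i G S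

  count : ℕ → Subset N → ℕ
  count i U = wsum 1 (λ S → ⟦ cliqueOf? i U S ⟧)

  cliqueCount≤count : ∀ k → cliqueCount k G ≤ count k full
  cliqueCount≤count k = ℕ.≤-trans (ℕ.≤-reflexive (length-filter-subsets (isKClique? k G)))
    (wsum-mono 1 λ S → ⟦⟧-mono (isKClique? k G S) (cliqueOf? k full S) λ c → (λ _ → ∈⊤) , c)

  count-zero : ∀ U → count 0 U ≤ 1
  count-zero U = ℕ.≤-trans (wsum-mono 1 λ S → ⟦⟧-mono (cliqueOf? 0 U S) (card S ℕ.≟ 0) (proj₁ ∘ proj₂)) (only-∅ N)
    where
    only-∅ : ∀ N → wsum {N} 1 (λ S → ⟦ card S ℕ.≟ 0 ⟧) ≤ 1
    only-∅ zero    = ℕ.≤-refl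
    only-∅ (suc N) = begin
      1 * wsum {N} 1 (λ S → ⟦ card S ℕ.≟ 0 ⟧) + wsum {N} 1 (λ _ → 0)
        ≡⟨ cong₂ _+_ (ℕ.*-identityˡ _) (wsum-zero 1 {N}) ⟩
      wsum {N} 1 (λ S → ⟦ card S ℕ.≟ 0 ⟧) + 0
        ≡⟨ ℕ.+-identityʳ _ ⟩
      wsum {N} 1 (λ S → ⟦ card S ℕ.≟ 0 ⟧)
        ≤⟨ only-∅ N ⟩
      1 ∎
      where open ℕ.≤-Reasoning

  -- Deleting a vertex of a clique leaves a clique among its neighbours. Each clique is counted once
  -- for every vertex, which costs only a constant depending on `i`.
  count-suc : ∀ i U → count (suc i) U ≤ sum (λ v → ⟦ v ∈? U ⟧ * count i (U ∩ nbrs G v))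
  count-suc i U = begin
    count (suc i) U
      ≤⟨ wsum-mono 1 (λ S → ⟦⟧-≤ (cliqueOf? (suc i) U S) (pick S)) ⟩
    wsum 1 (λ S → sum (λ v → ⟦ (v ∈? S) ×-dec cliqueOf? (suc i) U S ⟧))
      ≡⟨ wsum-sum 1 (λ v S → ⟦ (v ∈? S) ×-dec cliqueOf? (suc i) U S ⟧) ⟩
    sum (λ v → wsum 1 (λ S → ⟦ (v ∈? S) ×-dec cliqueOf? (suc i) U S ⟧))
      ≤⟨ sum-mono (λ v → ℕ.≤-trans (ℕ.≤-reflexive (sym (ℕ.*-identityˡ _)))
           (wsum-delete 1 v (λ S → remove v S) (λ S v∉S → ⟦⟧-no ((v ∈? S) ×-dec cliqueOf? (suc i) U S) (v∉S ∘ proj₁)))) ⟩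
    sum (λ v → wsum 1 (λ S → ⟦ v ∈? U ⟧ * ⟦ cliqueOf? i (U ∩ nbrs G v) S ⟧))
      ≡⟨ sum-cong-≗ (λ v → wsum-* 1 ⟦ v ∈? U ⟧ (λ S → ⟦ cliqueOf? i (U ∩ nbrs G v) S ⟧)) ⟩
    sum (λ v → ⟦ v ∈? U ⟧ * count i (U ∩ nbrs G v)) ∎
    where
    open ℕ.≤-Reasoning
    pick : ∀ S → CliqueOf (suc i) U S → 1 ≤ sum (λ v → ⟦ (v ∈? S) ×-dec cliqueOf? (suc i) U S ⟧)
    pick S c@(_ , s , _) with nonempty S (subst (1 ≤_) (sym s) (s≤s z≤n))
    ... | v , v∈S = ℕ.≤-trans (1≤⟦⟧ ((v ∈? S) ×-dec cliqueOf? (suc i) U S) (v∈S , c))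
      (≤-sum (λ v → ⟦ (v ∈? S) ×-dec cliqueOf? (suc i) U S ⟧) v)
    remove : ∀ v S → v ∈ S → ⟦ (v ∈? S) ×-dec cliqueOf? (suc i) U S ⟧ ≤
                             ⟦ v ∈? U ⟧ * ⟦ cliqueOf? i (U ∩ nbrs G v) (S [ v ]≔ outside) ⟧
    remove v S v∈S = ⟦⟧-≤ ((v ∈? S) ×-dec cliqueOf? (suc i) U S) λ (_ , S⊆U , s , q) →
      ℕ.≤-reflexive (sym (cong₂ _*_ (⟦⟧-yes (v ∈? U) (S⊆U v∈S))
        (⟦⟧-yes (cliqueOf? i (U ∩ nbrs G v) (S [ v ]≔ outside))
          ( (λ {j} j∈ → let (j≢v , j∈S) = ∈-delete⁻ S j∈ in
              x∈p∩q⁺ (S⊆U j∈S , ⇒∈nbrs G (q v j v∈S j∈S (j≢v ∘ sym))))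
          , ℕ.suc-injective (trans (card-delete S v∈S) s)
          , λ a b a∈ b∈ → q a b (proj₂ (∈-delete⁻ S a∈)) (proj₂ (∈-delete⁻ S b∈))))))

-- Preimages are recorded because independence in the target is checked by pulling points back to
-- `S`.
image : (φ : Fin N → Fin M) (S : Subset N) → (∀ i j → i ∈ S → j ∈ S → φ i ≡ φ j → i ≡ j) →
        ∃ λ R → card R ≡ card S × (∀ y → y ∈ R → ∃ λ i → i ∈ S × φ i ≡ y)
image {M = M} φ [] inj = ∅ , ∣⊥∣≡0 M , λ y y∈ → contradiction y∈ ∉⊥
image φ (outside ∷ S) inj
  with image (φ ∘ suc) S (λ i j i∈ j∈ e → Fin.suc-injective (inj _ _ (there i∈) (there j∈) e))
... | R , c , back = R , c , λ y y∈ → let (i , i∈ , e) = back y y∈ in suc i , there i∈ , e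
image {N = suc N} {M} φ (inside ∷ S) inj
  with image (φ ∘ suc) S (λ i j i∈ j∈ e → Fin.suc-injective (inj _ _ (there i∈) (there j∈) e))
... | R , c , back = ⁅ φ zero ⁆ ∪ R , trans (card-insert (φ zero) R fresh) (cong suc c) , back′
  where
  fresh : φ zero ∉ R
  fresh φ0∈ with back (φ zero) φ0∈
  ... | i , i∈ , e = contradiction (inj _ _ (there i∈) here e) λ ()
  back′ : ∀ y → y ∈ ⁅ φ zero ⁆ ∪ R → ∃ λ i → i ∈ inside ∷ S × φ i ≡ y
  back′ y y∈ with x∈p∪q⁻ ⁅ φ zero ⁆ R y∈
  ... | inj₁ y∈φ0 = zero , here , sym (x∈⁅y⁆⇒x≡y (φ zero) y∈φ0)
  ... | inj₂ y∈R  = let (i , i∈ , e) = back y y∈R in suc i , there i∈ , e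

-- The blow-up of a graph

module BlowUp (H : Graph M) (s : ℕ) (N≤sM : N ≤ s * M) where
  private
    -- `Fin N` is placed inside `Fin (s * M)`, read as `s` copies of the vertex set of `H`: a copy
    -- number and a vertex.
    φψ : Fin N → Fin s × Fin M
    φψ i = remQuot {s} M (inject≤ i N≤sM)

    φψ-injective : ∀ {i j} → φψ i ≡ φψ j → i ≡ j
    φψ-injective {i} {j} e = Fin.inject≤-injective N≤sM N≤sM i j
      (trans (sym (Fin.combine-remQuot {s} M _)) (trans (cong (uncurry combine) e) (Fin.combine-remQuot {s} M _)))

  φ : Fin N → Fin M
  φ = proj₂ ∘ φψ

  blowUp : Graph N
  blowUp = record
    { adj    = λ i j → distinct i j ∧ (same i j ∨ adj H (φ i) (φ j))
    ; symm   = λ i j → cong₂ _∧_ (distinct-sym i j) (cong₂ _∨_ (same-sym i j) (Graph.symm H (φ i) (φ j)))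
    ; irrefl = λ i → cong (_∧ (same i i ∨ adj H (φ i) (φ i))) (distinct-irrefl i)
    }
    where
    same = λ i j → ⌊ φ i Fin.≟ φ j ⌋
    same-sym : ∀ i j → same i j ≡ same j i
    same-sym i j with φ i Fin.≟ φ j | φ j Fin.≟ φ i
    ... | yes _  | yes _  = refl
    ... | no _   | no _   = refl
    ... | yes e  | no ¬e  = contradiction (sym e) ¬e
    ... | no ¬e  | yes e  = contradiction (sym e) ¬e

  adjacent⁻ : ∀ {i j} → Adjacent blowUp i j → φ i ≡ φ j ⊎ Adjacent H (φ i) (φ j)
  adjacent⁻ {i} {j} a with i Fin.≟ j | φ i Fin.≟ φ j
  ... | no _ | yes e = inj₁ e
  ... | no _ | no _  = inj₂ a

  adjacent⁺ : ∀ {i j} → i ≢ j → φ i ≡ φ j ⊎ Adjacent H (φ i) (φ j) → Adjacent blowUp i j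
  adjacent⁺ {i} {j} i≢j h with i Fin.≟ j | φ i Fin.≟ φ j | h
  ... | yes i≡j | _     | _      = contradiction i≡j i≢j
  ... | no _    | yes _ | _      = _
  ... | no _    | no ¬e | inj₁ e = contradiction e ¬e
  ... | no _    | no _  | inj₂ a = a

  -- The fibres of `φ` are cliques, so an independent set meets each of them at most once and `φ` is
  -- injective on it.
  blowUp-independent : ∀ {n} → HasIndependent n blowUp → HasIndependent n H
  blowUp-independent (S , c , q) = R , trans |R| c , indep
    where
    injective : ∀ i j → i ∈ S → j ∈ S → φ i ≡ φ j → i ≡ j
    injective i j i∈ j∈ e = decidable-stable (i Fin.≟ j) λ i≢j → q i j i∈ j∈ (adjacent⁺ i≢j (inj₁ e))
    img = image φ S injective
    R = proj₁ img
    |R| = proj₁ (proj₂ img)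
    indep : IsIndependent H R
    indep x y x∈ y∈ a with proj₂ (proj₂ img) x x∈ | proj₂ (proj₂ img) y y∈
    ... | i , i∈ , refl | j , j∈ , refl = q i j i∈ j∈ (adjacent⁺ (λ { refl → ¬loop H (φ i) a }) (inj₂ a))

  fibre : ∀ y → sum (λ i → ⟦ φ i Fin.≟ y ⟧) ≤ s
  fibre y = begin
    sum (λ i → ⟦ φ i Fin.≟ y ⟧)
      ≡⟨ sum-cong-≗ (λ i → ⟦⟧-cong (φ i Fin.≟ y) (i ∈? F) (∈-select⁺ F?) (∈-select⁻ F?)) ⟩
    sum (λ i → ⟦ i ∈? F ⟧)
      ≡⟨ card≡sum F ⟨
    card F
      ≡⟨ proj₁ (proj₂ img) ⟨
    card (proj₁ img)
      ≤⟨ ∣p∣≤n (proj₁ img) ⟩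
    s ∎
    where
    open ℕ.≤-Reasoning
    F? : Decidable (λ i → φ i ≡ y)
    F? i = φ i Fin.≟ y
    F = select F?
    -- Within a fibre the copy number determines the vertex.
    img = image (proj₁ ∘ φψ) F λ i j i∈ j∈ e →
      φψ-injective (cong₂ _,_ e (trans (∈-select⁻ F? i∈) (sym (∈-select⁻ F? j∈))))

  preimage : ∀ Y → sum (λ i → ⟦ φ i ∈? Y ⟧) ≤ s * card Y
  preimage Y = begin
    sum (λ i → ⟦ φ i ∈? Y ⟧)
      ≤⟨ sum-mono (λ i → ⟦⟧-≤ (φ i ∈? Y) λ φi∈ → ℕ.≤-trans
           (ℕ.≤-reflexive (sym (cong₂ _*_ (⟦⟧-yes (φ i ∈? Y) φi∈) (⟦⟧-yes (φ i Fin.≟ φ i) refl))))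
           (≤-sum (λ y → ⟦ y ∈? Y ⟧ * ⟦ φ i Fin.≟ y ⟧) (φ i))) ⟩
    sum (λ i → sum (λ y → ⟦ y ∈? Y ⟧ * ⟦ φ i Fin.≟ y ⟧))
      ≡⟨ ∑-comm (λ i y → ⟦ y ∈? Y ⟧ * ⟦ φ i Fin.≟ y ⟧) ⟩
    sum (λ y → sum (λ i → ⟦ y ∈? Y ⟧ * ⟦ φ i Fin.≟ y ⟧))
      ≡⟨ sum-cong-≗ (λ y → sym (*-distribˡ-sum ⟦ y ∈? Y ⟧ (λ i → ⟦ φ i Fin.≟ y ⟧))) ⟩
    sum (λ y → ⟦ y ∈? Y ⟧ * sum (λ i → ⟦ φ i Fin.≟ y ⟧))
      ≤⟨ sum-mono (λ y → ℕ.*-monoʳ-≤ ⟦ y ∈? Y ⟧ (fibre y)) ⟩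
    sum (λ y → ⟦ y ∈? Y ⟧ * s)
      ≡⟨ trans (sym (*-distribʳ-sum s (λ y → ⟦ y ∈? Y ⟧))) (cong (_* s) (sym (card≡sum Y))) ⟩
    card Y * s
      ≡⟨ ℕ.*-comm (card Y) s ⟩
    s * card Y ∎
    where open ℕ.≤-Reasoning

  open Counting blowUp

  module _ (k : ℕ) (ρ : ℕ → ℕ) (ρ≥1 : ∀ j → 1 ≤ ρ (suc (suc j)))
    (bound : ∀ j Y → ¬ CliqueIn H j Y → card Y ≤ ρ j) where
    -- The product ρ_(l+1) ⋯ ρ_2 bounds the choices of the new images still to come when the common
    -- neighbours of the old ones are K_(l+1)-free.
    Π : ℕ → ℕ
    Π zero    = 1
    Π (suc l) = ρ (suc (suc l)) * Π l

    private
      C = suc k * s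

      Π≥1 : ∀ l → 1 ≤ Π l
      Π≥1 zero    = ℕ.≤-refl
      Π≥1 (suc l) = ℕ.*-mono-≤ (ρ≥1 l) (Π≥1 l)

      -- A vertex is charged to `K` whenever possible. One charged to `Y` thus has its image outside
      -- `K`, so that `count-bound` can add this image to `K` as a new element.
      split-count : ∀ i U K Y A B → (∀ u → u ∈ U → φ u ∈ K ⊎ φ u ∈ Y) →
        (∀ v → v ∈ U → count i (U ∩ nbrs blowUp v) ≤ A) →
        (∀ v → v ∈ U → φ v ∉ K → φ v ∈ Y → count i (U ∩ nbrs blowUp v) ≤ B) →
        count (suc i) U ≤ s * card K * A + s * card Y * B
      split-count i U K Y A B U⊆ ≤A ≤B = begin
        count (suc i) U
          ≤⟨ count-suc i U ⟩
        sum (λ v → ⟦ v ∈? U ⟧ * count i (U ∩ nbrs blowUp v))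
          ≤⟨ sum-mono (λ v → term v (v ∈? U) (φ v ∈? K)) ⟩
        sum (λ v → ⟦ φ v ∈? K ⟧ * A + ⟦ φ v ∈? Y ⟧ * B)
          ≡⟨ trans (∑-distrib-+ (λ v → ⟦ φ v ∈? K ⟧ * A) _)
               (sym (cong₂ _+_ (*-distribʳ-sum A (λ v → ⟦ φ v ∈? K ⟧)) (*-distribʳ-sum B (λ v → ⟦ φ v ∈? Y ⟧)))) ⟩
        sum (λ v → ⟦ φ v ∈? K ⟧) * A + sum (λ v → ⟦ φ v ∈? Y ⟧) * B
          ≤⟨ ℕ.+-mono-≤ (ℕ.*-monoˡ-≤ A (preimage K)) (ℕ.*-monoˡ-≤ B (preimage Y)) ⟩
        s * card K * A + s * card Y * B ∎
        where
        open ℕ.≤-Reasoning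
        term : ∀ v (u? : Dec (v ∈ U)) (k? : Dec (φ v ∈ K)) →
          ⟦ u? ⟧ * count i (U ∩ nbrs blowUp v) ≤ ⟦ φ v ∈? K ⟧ * A + ⟦ φ v ∈? Y ⟧ * B
        term v (no _)    _         = z≤n
        term v (yes v∈U) (yes φv∈K) = ℕ.≤-trans
          (ℕ.*-mono-≤ (1≤⟦⟧ (φ v ∈? K) φv∈K) (≤A v v∈U)) (ℕ.m≤m+n _ _)
        term v (yes v∈U) (no φv∉K) with U⊆ v v∈U
        ... | inj₁ φv∈K = contradiction φv∈K φv∉K
        ... | inj₂ φv∈Y = ℕ.≤-trans
          (ℕ.*-mono-≤ (1≤⟦⟧ (φ v ∈? Y) φv∈Y) (≤B v v∈U φv∉K φv∈Y)) (ℕ.m≤n+m _ _)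

    -- K holds the images of the vertices chosen so far and Y their common
    -- neighbours.  A new vertex is mapped into K (at most ks choices) or into Y,
    -- which is (l + 1)-clique-free.
    count-bound : ∀ i U K Y l → (∀ u → u ∈ U → φ u ∈ K ⊎ φ u ∈ Y) → ¬ CliqueIn H (suc l) Y →
                  card K + suc l ≤ k → count i U ≤ C ^ i * Π l
    count-bound zero    U K Y l U⊆ free small =
      ℕ.≤-trans (count-zero U) (ℕ.≤-trans (Π≥1 l) (ℕ.≤-reflexive (sym (ℕ.*-identityˡ _))))
    count-bound (suc i) U K Y l U⊆ free small = go l free small
      where
      open ℕ.≤-Reasoning
      restrict : ∀ v u → u ∈ U ∩ nbrs blowUp v → φ u ∈ K ⊎ φ u ∈ Y
      restrict v u u∈ = U⊆ u (p∩q⊆p U _ u∈)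
      K≤k : ∀ l → card K + suc l ≤ k → card K ≤ k
      K≤k l = ℕ.≤-trans (ℕ.m≤m+n _ _)
      go : ∀ l → ¬ CliqueIn H (suc l) Y → card K + suc l ≤ k → count (suc i) U ≤ C ^ suc i * Π l
      -- Here `Y` is empty, so every further vertex repeats an image in `K`.
      go zero free small = begin
        count (suc i) U
          ≤⟨ split-count i U K Y (C ^ i * 1) 0 U⊆
               (λ v _ → count-bound i _ K Y zero (restrict v) free small)
               (λ v _ _ φv∈Y → contradiction (vertex-clique H φv∈Y) free) ⟩
        s * card K * (C ^ i * 1) + s * card Y * 0
          ≤⟨ ℕ.+-mono-≤ (ℕ.*-monoˡ-≤ (C ^ i * 1) (ℕ.*-monoʳ-≤ s (ℕ.m≤n⇒m≤1+n (K≤k 0 small)))) (ℕ.≤-reflexive (ℕ.*-zeroʳ (s * card Y))) ⟩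
        s * suc k * (C ^ i * 1) + 0
          ≡⟨ solve 3 (λ s k c → s :* (con 1 :+ k) :* (c :* con 1) :+ con 0 := (con 1 :+ k) :* s :* c :* con 1) refl s k (C ^ i) ⟩
        C ^ suc i * 1 ∎
      go (suc l) free small = begin
        count (suc i) U
          ≤⟨ split-count i U K Y (C ^ i * (ρₗ * Π l)) (C ^ i * Π l) U⊆
               (λ v _ → count-bound i _ K Y (suc l) (restrict v) free small) fresh ⟩
        s * card K * (C ^ i * (ρₗ * Π l)) + s * card Y * (C ^ i * Π l)
          ≤⟨ ℕ.+-mono-≤ (ℕ.*-monoˡ-≤ (C ^ i * (ρₗ * Π l)) (ℕ.*-monoʳ-≤ s (K≤k _ small)))
                        (ℕ.*-monoˡ-≤ (C ^ i * Π l) (ℕ.*-monoʳ-≤ s (bound _ Y free))) ⟩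
        -- Both terms contain `C ^ i * (ρₗ * Π l)`: a fresh image supplies the factor `ρₗ` that its
        -- smaller `Π l` lacks. At most `k` repetitions and one fresh image give the `suc k` in `C`.
        s * k * (C ^ i * (ρₗ * Π l)) + s * ρₗ * (C ^ i * Π l)
          ≡⟨ solve 5 (λ s k c r p → s :* k :* (c :* (r :* p)) :+ s :* r :* (c :* p) := (con 1 :+ k) :* s :* c :* (r :* p))
               refl s k (C ^ i) ρₗ (Π l) ⟩
        C ^ suc i * (ρₗ * Π l) ∎
        where
        ρₗ = ρ (suc (suc l))
        fresh : ∀ v → v ∈ U → φ v ∉ K → φ v ∈ Y → count i (U ∩ nbrs blowUp v) ≤ C ^ i * Π l
        fresh v v∈U φv∉K φv∈Y = count-bound i _ (⁅ φ v ⁆ ∪ K) (Y ∩ nbrs H (φ v)) l enter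
          (free ∘ neighbour-clique H φv∈Y)
          (subst (_≤ k) (trans (ℕ.+-suc (card K) (suc l)) (cong (_+ suc l) (sym (card-insert (φ v) K φv∉K)))) small)
          where
          enter : ∀ u → u ∈ U ∩ nbrs blowUp v → φ u ∈ ⁅ φ v ⁆ ∪ K ⊎ φ u ∈ Y ∩ nbrs H (φ v)
          enter u u∈ with x∈p∩q⁻ U _ u∈
          ... | u∈U , u∈v with adjacent⁻ (∈nbrs⇒ blowUp u∈v)
          ...   | inj₁ e = inj₁ (x∈p∪q⁺ (inj₁ (subst (_∈ ⁅ φ v ⁆) e (x∈⁅x⁆ (φ v)))))
          ...   | inj₂ a with U⊆ u u∈U
          ...     | inj₁ φu∈K = inj₁ (x∈p∪q⁺ {p = ⁅ φ v ⁆} (inj₂ φu∈K))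
          ...     | inj₂ φu∈Y = inj₂ (x∈p∩q⁺ (φu∈Y , ⇒∈nbrs H a))

    cliqueCount-blowUp : ∀ l → suc l ≤ k → ¬ HasClique (suc l) H → cliqueCount k blowUp ≤ C ^ k * Π l
    cliqueCount-blowUp l l<k free = ℕ.≤-trans (cliqueCount≤count k)
      (count-bound k full ∅ full l (λ _ _ → inj₂ ∈⊤) (λ (S , _ , c) → free (S , c))
        (subst (λ z → z + suc l ≤ k) (sym (∣⊥∣≡0 M)) l<k))

-- Ramsey numbers and binomial coefficients

absorption : ∀ n k → suc k * (suc n C suc k) ≡ suc n * (n C k)
absorption zero    zero    = refl
absorption zero    (suc k) = trans (cong (suc (suc k) *_) (k>n⇒nCk≡0 {1} {suc (suc k)} (s≤s (s≤s z≤n))))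
  (trans (ℕ.*-zeroʳ (suc (suc k))) (sym (cong (1 *_) (k>n⇒nCk≡0 {0} {suc k} (s≤s z≤n)))))
absorption (suc n) zero    = trans (ℕ.*-identityˡ _) (trans (nC1≡n (suc (suc n))) (sym (ℕ.*-identityʳ _)))
absorption (suc n) (suc k) = begin
  suc (suc k) * (suc (suc n) C suc (suc k))
    ≡⟨ cong (suc (suc k) *_) (nCk+nC[k+1]≡[n+1]C[k+1] (suc n) (suc k)) ⟨
  suc (suc k) * (a + suc n C suc (suc k))
    ≡⟨ solve 3 (λ k a b → (con 1 :+ (con 1 :+ k)) :* (a :+ b) := (con 1 :+ k) :* a :+ a :+ (con 1 :+ (con 1 :+ k)) :* b)
        refl k a (suc n C suc (suc k)) ⟩
  suc k * a + a + suc (suc k) * (suc n C suc (suc k))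
    ≡⟨ cong₂ (λ x y → x + a + y) (absorption n k) (absorption n (suc k)) ⟩
  suc n * (n C k) + a + suc n * (n C suc k)
    ≡⟨ solve 4 (λ n x y a → (con 1 :+ n) :* x :+ a :+ (con 1 :+ n) :* y := a :+ (con 1 :+ n) :* (x :+ y)) refl n (n C k) (n C suc k) a ⟩
  a + suc n * (n C k + n C suc k)
    ≡⟨ cong (λ z → a + suc n * z) (nCk+nC[k+1]≡[n+1]C[k+1] n k) ⟩
  suc (suc n) * a ∎
  where
  open ≡-Reasoning
  a = suc n C suc k

-- The shift j makes the induction go through: at j = 0 this is (n/k)^k ≤ n C k.
^≤^*C : ∀ k n j → k ≤ n → (n + j) ^ k ≤ (k + j) ^ k * (n C k)
^≤^*C zero    n       j k≤n       = ℕ.≤-refl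
^≤^*C (suc k) (suc n) j (s≤s k≤n) = ℕ.*-cancelˡ-≤ (suc k) (begin
  suc k * ((suc n + j) * (suc n + j) ^ k)
    ≡⟨ ℕ.*-assoc (suc k) (suc n + j) _ ⟨
  suc k * (suc n + j) * (suc n + j) ^ k
    ≤⟨ ℕ.*-mono-≤ ratio (subst₂ (λ x y → x ^ k ≤ y ^ k * (n C k)) (ℕ.+-suc n j) (ℕ.+-suc k j) (^≤^*C k n (suc j) k≤n)) ⟩
  (suc k + j) * suc n * ((suc k + j) ^ k * (n C k))
    ≡⟨ solve 4 (λ a n x c → a :* (con 1 :+ n) :* (x :* c) := a :* x :* ((con 1 :+ n) :* c)) refl (suc k + j) n ((suc k + j) ^ k) (n C k) ⟩
  (suc k + j) * (suc k + j) ^ k * (suc n * (n C k))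
    ≡⟨ cong ((suc k + j) ^ suc k *_) (absorption n k) ⟨
  (suc k + j) ^ suc k * (suc k * (suc n C suc k))
    ≡⟨ solve 3 (λ x k c → x :* (k :* c) := k :* (x :* c)) refl ((suc k + j) ^ suc k) (suc k) (suc n C suc k) ⟩
  suc k * ((suc k + j) ^ suc k * (suc n C suc k)) ∎)
  where
  open ℕ.≤-Reasoning
  ratio : suc k * (suc n + j) ≤ (suc k + j) * suc n
  ratio = begin
    suc k * (suc n + j)         ≡⟨ ℕ.*-distribˡ-+ (suc k) (suc n) j ⟩
    suc k * suc n + suc k * j   ≤⟨ ℕ.+-monoʳ-≤ (suc k * suc n) (ℕ.*-monoˡ-≤ j (s≤s k≤n)) ⟩
    suc k * suc n + suc n * j   ≡⟨ cong (suc k * suc n +_) (ℕ.*-comm (suc n) j) ⟩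
    suc k * suc n + j * suc n   ≡⟨ ℕ.*-distribʳ-+ (suc n) (suc k) j ⟨
    (suc k + j) * suc n         ∎

^≤C : ∀ k n → k ≤ n → n ^ k ≤ k ^ k * (n C k)
^≤C k n k≤n = subst₂ (λ x y → x ^ k ≤ y ^ k * (n C k)) (ℕ.+-identityʳ n) (ℕ.+-identityʳ k) (^≤^*C k n 0 k≤n)

-- Graphs that bound `f` from above

cliqueCount-free : ∀ k (G : Graph N) → ¬ HasClique k G → cliqueCount k G ≡ 0
cliqueCount-free {N} k G free = trans (length-filter-subsets (isKClique? k G))
  (trans (wsum-cong 1 λ S → ⟦⟧-no (isKClique? k G S) λ c → free (S , c)) (wsum-zero 1 {N}))

cliqueCount≤^ : ∀ k (G : Graph N) → cliqueCount k G ≤ N ^ k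
cliqueCount≤^ {N} k G = ℕ.≤-trans (cliqueCount≤count k) (count≤ k _)
  where
  open Counting G
  sum-const : ∀ M m → sum {M} (λ _ → m) ≡ M * m
  sum-const zero    m = refl
  sum-const (suc M) m = cong (m +_) (sum-const M m)
  count≤ : ∀ i U → count i U ≤ N ^ i
  count≤ zero    U = count-zero U
  count≤ (suc i) U = ℕ.≤-trans (count-suc i U) (ℕ.≤-trans
    (sum-mono λ v → ℕ.≤-trans (ℕ.*-monoˡ-≤ _ (⟦⟧≤1 (v ∈? U))) (ℕ.≤-trans (ℕ.≤-reflexive (ℕ.*-identityˡ _)) (count≤ i (U ∩ nbrs G v))))
    (ℕ.≤-reflexive (sum-const N (N ^ i))))

f≤cliqueCount : ∀ {k n} .{{_ : NonTrivial n}} (G : Graph N) → ¬ HasIndependent n G → f N k n ≤ cliqueCount k G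
f≤cliqueCount {N} {k} {n} G ¬I = proj₂ (proj₂ (minimumCliqueCount N k n)) _ (G , ¬I , refl)

f≡0 : ∀ {k n} .{{_ : NonTrivial n}} (G : Graph N) → ¬ HasIndependent n G → ¬ HasClique k G → f N k n ≡ 0
f≡0 {k = k} G ¬I ¬K = ℕ.n≤0⇒n≡0 (ℕ.≤-trans (f≤cliqueCount {k = k} G ¬I) (ℕ.≤-reflexive (cliqueCount-free k G ¬K)))

f-few-vertices : ∀ {k n} .{{_ : NonTrivial n}} → N < k → f N k n ≡ 0
f-few-vertices {N} {k} {n} N<k = f≡0 (complete N) (complete-independent n) λ (S , c , _) →
  contradiction (subst (_≤ N) c (∣p∣≤n S)) (ℕ.<⇒≱ N<k)

-- The graph is found by exhaustive search; if there were none, `N` would have the Ramsey property,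
-- against the minimality of `r k n`.
ramseyGraph : ∀ k n → N < r k n → ∃ λ (G : Graph N) → ¬ HasClique k G × ¬ HasIndependent n G
ramseyGraph {N} k n N<r = go (searchGraph resp bad?)
  where
  Bad : Graph N → Set
  Bad G = ¬ HasClique k G × ¬ HasIndependent n G
  bad? : Decidable Bad
  bad? G = ¬? (hasClique? k G) ×-dec ¬? (hasIndependent? n G)
  resp : ∀ {G H : Graph N} → G ≗ᴳ H → Bad G → Bad H
  resp {G} {H} e (¬K , ¬I) =
    (λ (S , c) → ¬K (S , IsKClique-resp (≗ᴳ-sym e) c)) , (λ I → ¬I (HasIndependent-resp (≗ᴳ-sym e) I))
  go : Dec (∃ Bad) → ∃ Bad
  go (yes bad) = bad
  go (no none) = contradiction (proj₂ (proj₂ (ramseyNumber k n)) N ramsey-N) (ℕ.<⇒≱ N<r)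
    where
    ramsey-N : RamseyProperty k n N
    ramsey-N G with hasClique? k G | hasIndependent? n G
    ... | yes K | _     = inj₁ K
    ... | no _  | yes I = inj₂ I
    ... | no ¬K | no ¬I = contradiction (G , ¬K , ¬I) none

f-below-ramsey : ∀ {k n} .{{_ : NonTrivial n}} → N < r k n → f N k n ≡ 0
f-below-ramsey {k = k} {n} N<r with ramseyGraph k n N<r
... | G , ¬K , ¬I = f≡0 G ¬I ¬K

-- A complete graph has no independent `n`-set, so it must contain the clique. This ensures that the
-- graph to be blown up, on `r` - 1 vertices, is nonempty.
2≤r : ∀ m n .{{_ : NonTrivial n}} → 2 ≤ r (2 + m) n
2≤r m n with proj₁ (proj₂ (ramseyNumber (2 + m) n)) (complete (r (2 + m) n))
... | inj₂ I           = contradiction I (complete-independent n)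
... | inj₁ (S , c , _) = ℕ.≤-trans (s≤s (s≤s z≤n)) (subst (_≤ r (2 + m) n) c (∣p∣≤n S))

-- Elementary integer estimates

log-bracket : ∀ b n .{{_ : NonZero n}} → 2 ≤ b → ∃ λ τ → b ^ τ ≤ n × n < b ^ suc τ
log-bracket b (suc zero)    2≤b = 0 , ℕ.≤-refl , ℕ.≤-trans 2≤b (ℕ.≤-reflexive (sym (ℕ.*-identityʳ b)))
log-bracket b (suc n@(suc _)) 2≤b with log-bracket b n 2≤b
... | τ , low , high with suc n ℕ.<? b ^ suc τ
...   | yes lt = τ , ℕ.m≤n⇒m≤1+n low , lt
...   | no ¬lt = suc τ , ℕ.≮⇒≥ ¬lt , (begin-strict
        suc n            ≤⟨ high ⟩
        b ^ suc τ        <⟨ ℕ.^-monoʳ-< b 2≤b (ℕ.n<1+n (suc τ)) ⟩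
        b ^ suc (suc τ)  ∎)
        where open ℕ.≤-Reasoning

choose₂ : ∀ m → 2 * (suc m C 2) ≡ suc m * m
choose₂ m = trans (absorption m 1) (cong (suc m *_) (nC1≡n m))

n≤2^n : ∀ n → n ≤ 2 ^ n
n≤2^n zero    = z≤n
n≤2^n (suc n) = ℕ.≤-trans (ℕ.+-mono-≤ (ℕ.m^n>0 2 n) (n≤2^n n)) (ℕ.≤-reflexive (cong (2 ^ n +_) (sym (ℕ.+-identityʳ _))))

*-^-distrib : ∀ a b n → (a * b) ^ n ≡ a ^ n * b ^ n
*-^-distrib a b zero    = refl
*-^-distrib a b (suc n) = trans (cong (a * b *_) (*-^-distrib a b n))
  (solve 4 (λ a b x y → a :* b :* (x :* y) := a :* x :* (b :* y)) refl a b (a ^ n) (b ^ n))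

-- The bound with ⌊log₈ n⌋ for log n

m≤[1+m/n]*n : ∀ m n .{{_ : NonZero n}} → m ≤ suc (m / n) * n
m≤[1+m/n]*n m n = begin
  m                   ≡⟨ m≡m%n+[m/n]*n m n ⟩
  m % n + m / n * n   ≤⟨ ℕ.+-monoˡ-≤ (m / n * n) (ℕ.<⇒≤ (m%n<n m n)) ⟩
  suc (m / n) * n     ∎
  where open ℕ.≤-Reasoning

[1+m/n]*n≤2m : ∀ m n .{{_ : NonZero n}} → n ≤ m → suc (m / n) * n ≤ 2 * m
[1+m/n]*n≤2m m n n≤m = ℕ.≤-trans (ℕ.+-mono-≤ n≤m (m/n*n≤m m n)) (ℕ.≤-reflexive (cong (m +_) (sym (ℕ.+-identityʳ m))))

8^≡ : ∀ τ → 8 ^ τ ≡ 2 ^ τ * 2 ^ τ * 2 ^ τ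
8^≡ τ = trans (*-^-distrib 4 2 τ) (cong (_* 2 ^ τ) (*-^-distrib 2 2 τ))

module _ (m n : ℕ) .{{_ : NonTrivial n}} (τ : ℕ) .{{_ : NonZero τ}} (8^τ≤n : 8 ^ τ ≤ n) where
  private
    k = 2 + m
    e = suc m C 2
    instance
      n≢0 : NonZero n
      n≢0 = >-nonZero (ℕ.≤-trans (ℕ.m^n>0 8 τ) 8^τ≤n)

    -- `q * τ` lies between `n` and `2 * n`; the 8 is the one in `HardCore.card-bound`.
    q Q : ℕ
    q = suc (n / τ)
    Q = 8 * q

    τ≤n : τ ≤ n
    τ≤n = ℕ.≤-trans (n≤2^n τ) (ℕ.≤-trans (ℕ.^-monoˡ-≤ τ (s≤s (s≤s (z≤n {6})))) 8^τ≤n)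

    -- The origin of base 8: `τ ≤ 2 ^ τ` leaves a product of three factors `2 ^ τ`.
    τ2^ττ≤n : τ * 2 ^ τ * τ ≤ n
    τ2^ττ≤n = begin
      τ * 2 ^ τ * τ             ≤⟨ ℕ.*-mono-≤ (ℕ.*-monoˡ-≤ (2 ^ τ) (n≤2^n τ)) (n≤2^n τ) ⟩
      2 ^ τ * 2 ^ τ * 2 ^ τ     ≡⟨ 8^≡ τ ⟨
      8 ^ τ                     ≤⟨ 8^τ≤n ⟩
      n                         ∎
      where open ℕ.≤-Reasoning

    τ2^τ≤Q : τ * 2 ^ τ ≤ Q
    τ2^τ≤Q = ℕ.≤-trans (ℕ.*-cancelʳ-≤ _ q τ (ℕ.≤-trans τ2^ττ≤n (m≤[1+m/n]*n n τ))) (ℕ.m≤n*m q 8)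

    τ2^τ≤2n : τ * 2 ^ τ ≤ 2 * n
    τ2^τ≤2n = ℕ.≤-trans (ℕ.m≤m*n (τ * 2 ^ τ) τ) (ℕ.≤-trans τ2^ττ≤n (ℕ.m≤n*m n 2))

    8n≤Qτ : 8 * n ≤ Q * τ
    8n≤Qτ = ℕ.≤-trans (ℕ.*-monoʳ-≤ 8 (m≤[1+m/n]*n n τ)) (ℕ.≤-reflexive (sym (ℕ.*-assoc 8 q τ)))

    Qτ≤16n : Q * τ ≤ 16 * n
    Qτ≤16n = begin
      8 * q * τ       ≡⟨ ℕ.*-assoc 8 q τ ⟩
      8 * (q * τ)     ≤⟨ ℕ.*-monoʳ-≤ 8 ([1+m/n]*n≤2m n τ τ≤n) ⟩
      8 * (2 * n)     ≡⟨ ℕ.*-assoc 8 2 n ⟨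
      16 * n          ∎
      where open ℕ.≤-Reasoning

  module _ {M N s : ℕ} (H : Graph M) (¬K : ¬ HasClique k H) (¬I : ¬ HasIndependent n H)
           (N≤sM : N ≤ s * M) where
    private
      open BlowUp H s N≤sM
      ρ≥1 : ∀ j → 1 ≤ n * Q ^ j
      ρ≥1 j = ℕ.*-mono-≤ (>-nonZero⁻¹ n) (ℕ.m^n>0 Q j)
      bound = CliqueFree.card-cliqueFree H n Q τ (nonTrivial⇒n>1 n) ¬I 8n≤Qτ τ2^τ≤Q τ2^τ≤2n

      -- The exponents of `Q` add up to 0 + 1 + ⋯ + (l - 1).
      Π≡ : ∀ l → Π k (cliqueBound n Q) ρ≥1 bound l ≡ n ^ l * Q ^ (l C 2)
      Π≡ zero    = refl
      Π≡ (suc l) = begin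
        n * Q ^ l * Π k (cliqueBound n Q) ρ≥1 bound l   ≡⟨ cong (n * Q ^ l *_) (Π≡ l) ⟩
        n * Q ^ l * (n ^ l * Q ^ (l C 2))
            ≡⟨ solve 4 (λ n a b c → n :* a :* (b :* c) := n :* b :* (a :* c)) refl n (Q ^ l) (n ^ l) (Q ^ (l C 2)) ⟩
        n ^ suc l * (Q ^ l * Q ^ (l C 2))               ≡⟨ cong (n ^ suc l *_) (ℕ.^-distribˡ-+-* Q l (l C 2)) ⟨
        n ^ suc l * Q ^ (l + l C 2)                     ≡⟨ cong (λ z → n ^ suc l * Q ^ (z + l C 2)) (nC1≡n l) ⟨
        n ^ suc l * Q ^ (l C 1 + l C 2)                 ≡⟨ cong (λ z → n ^ suc l * Q ^ z) (nCk+nC[k+1]≡[n+1]C[k+1] l 1) ⟩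
        n ^ suc l * Q ^ (suc l C 2)                     ∎
        where open ≡-Reasoning

    f-blowUp : f N k n ≤ (suc k * s) ^ k * (n ^ suc m * Q ^ e)
    f-blowUp = begin
      f N k n                                                        ≤⟨ f≤cliqueCount blowUp (¬I ∘ blowUp-independent) ⟩
      cliqueCount k blowUp                                           ≤⟨ cliqueCount-blowUp k (cliqueBound n Q) ρ≥1 bound (suc m) ℕ.≤-refl ¬K ⟩
      (suc k * s) ^ k * Π k (cliqueBound n Q) ρ≥1 bound (suc m)      ≡⟨ cong ((suc k * s) ^ k *_) (Π≡ (suc m)) ⟩
      (suc k * s) ^ k * (n ^ suc m * Q ^ e)                          ∎
      where open ℕ.≤-Reasoning

  -- Here M = r - 1 and `s = suc (N / M)`. From 1 ≤ M ≤ N follow s M ≤ 2N and r ≤ 2M, which make the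
  -- 4.
  f-above-ramsey : r k n ≤ N → f N k n * r k n ^ k ≤ (4 * suc k * N) ^ k * (n ^ suc m * Q ^ e)
  f-above-ramsey {N} r≤N = go (r k n) refl (2≤r m n)
    where
    go : ∀ R → R ≡ r k n → 2 ≤ R → f N k n * R ^ k ≤ (4 * suc k * N) ^ k * (n ^ suc m * Q ^ e)
    go (suc zero)      _   (s≤s ())
    go (suc M@(suc _)) R≡r _ with ramseyGraph {M} k n (subst (suc M ≤_) R≡r ℕ.≤-refl)
    ... | H , ¬K , ¬I = begin
      f N k n * suc M ^ k
        ≤⟨ ℕ.*-mono-≤ (f-blowUp H ¬K ¬I (m≤[1+m/n]*n N M)) (ℕ.^-monoˡ-≤ k (ℕ.+-monoˡ-≤ M (s≤s z≤n))) ⟩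
      (suc k * s) ^ k * E * (M + M) ^ k
        ≡⟨ solve 3 (λ a b c → a :* b :* c := a :* c :* b) refl ((suc k * s) ^ k) E ((M + M) ^ k) ⟩
      (suc k * s) ^ k * (M + M) ^ k * E
        ≡⟨ cong (_* E) (*-^-distrib (suc k * s) (M + M) k) ⟨
      (suc k * s * (M + M)) ^ k * E
        ≤⟨ ℕ.*-monoˡ-≤ E (ℕ.^-monoˡ-≤ k base) ⟩
      (4 * suc k * N) ^ k * E ∎
      where
      open ℕ.≤-Reasoning
      s = suc (N / M)
      E = n ^ suc m * Q ^ e
      base : suc k * s * (M + M) ≤ 4 * suc k * N
      base = begin
        suc k * s * (M + M)         ≡⟨ solve 3 (λ k s M → k :* s :* (M :+ M) := con 2 :* k :* (s :* M)) refl (suc k) s M ⟩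
        2 * suc k * (s * M)         ≤⟨ ℕ.*-monoʳ-≤ (2 * suc k) ([1+m/n]*n≤2m N M (ℕ.≤-trans (ℕ.n≤1+n M) (ℕ.≤-trans (ℕ.≤-reflexive R≡r) r≤N))) ⟩
        2 * suc k * (2 * N)         ≡⟨ solve 2 (λ k N → con 2 :* k :* (con 2 :* N) := con 4 :* k :* N) refl (suc k) N ⟩
        4 * suc k * N               ∎

  -- A second factor `n ^ (k C 2)` completes the power to `(n ^ suc m) ^ k`, to which `growth-r`
  -- applies; `f-above-ramsey` then trades `r k n ^ k` for `N ^ k`. The powers `n ^ suc m` and
  -- `n ^ e` left on the right make up the factor that is cancelled.
  f-upper-explicit : ∀ B → n ^ suc m ≤ B * r k n * τ ^ m → ∀ N →
            f N k n * n ^ (k C 2) ≤ (B * (4 * suc k)) ^ k * 16 ^ e * k ^ k * (N C k) * τ ^ (m + e)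
  f-upper-explicit B growth-r N with N ℕ.<? k | N ℕ.<? r k n
  -- The right side is zero here, and `^≤C` below needs `k ≤ N`.
  ... | yes N<k | _       = ℕ.≤-trans (ℕ.≤-reflexive (cong (_* n ^ (k C 2)) (f-few-vertices {k = k} {n} N<k))) z≤n
  ... | no _    | yes N<r = ℕ.≤-trans (ℕ.≤-reflexive (cong (_* n ^ (k C 2)) (f-below-ramsey {k = k} {n} N<r))) z≤n
  ... | no k≤N  | no r≤N  = ℕ.*-cancelʳ-≤ _ _ (n ^ (k C 2)) {{ℕ.m^n≢0 n (k C 2)}} (begin
    F * n ^ c * n ^ c
      ≡⟨ trans (ℕ.*-assoc F (n ^ c) (n ^ c)) (cong (F *_) (sym (ℕ.^-distribˡ-+-* n c c))) ⟩
    F * n ^ (c + c)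
      ≡⟨ cong (λ z → F * n ^ z) (trans (cong (c +_) (sym (ℕ.+-identityʳ c))) (trans (choose₂ (suc m)) (ℕ.*-comm k (suc m)))) ⟩
    F * n ^ (suc m * k)
      ≡⟨ cong (F *_) (ℕ.^-*-assoc n (suc m) k) ⟨
    F * (n ^ suc m) ^ k
      ≤⟨ ℕ.*-monoʳ-≤ F (ℕ.^-monoˡ-≤ k growth-r) ⟩
    F * (B * R * τ ^ m) ^ k
      ≡⟨ cong (F *_) (trans (*-^-distrib (B * R) (τ ^ m) k) (cong₂ _*_ (*-^-distrib B R k) (ℕ.^-*-assoc τ m k))) ⟩
    F * (B ^ k * R ^ k * τ ^ (m * k))
      ≡⟨ solve 4 (λ f b r t → f :* (b :* r :* t) := b :* (f :* r) :* t) refl F (B ^ k) (R ^ k) (τ ^ (m * k)) ⟩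
    B ^ k * (F * R ^ k) * τ ^ (m * k)
      ≤⟨ ℕ.*-monoˡ-≤ (τ ^ (m * k)) (ℕ.*-monoʳ-≤ (B ^ k) (f-above-ramsey (ℕ.≮⇒≥ r≤N))) ⟩
    B ^ k * ((4 * suc k * N) ^ k * (n ^ suc m * Q ^ e)) * τ ^ (m * k)
      -- Of the exponent `m * k`, a part `e` turns `Q ^ e` into at most `(16 * n) ^ e`; the rest,
      -- `m + e`, is one less than `k C 2`.
      ≡⟨ cong₂ (λ x y → B ^ k * (x * (n ^ suc m * Q ^ e)) * y) (*-^-distrib (4 * suc k) N k)
           (trans (cong (τ ^_) mk≡) (ℕ.^-distribˡ-+-* τ e (m + e))) ⟩
    B ^ k * ((4 * suc k) ^ k * N ^ k * (n ^ suc m * Q ^ e)) * (τ ^ e * τ ^ (m + e))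
      ≡⟨ solve 7 (λ b a x y z t u → b :* (a :* x :* (y :* z)) :* (t :* u) := b :* a :* x :* y :* (z :* t) :* u) refl
           (B ^ k) ((4 * suc k) ^ k) (N ^ k) (n ^ suc m) (Q ^ e) (τ ^ e) (τ ^ (m + e)) ⟩
    B ^ k * (4 * suc k) ^ k * N ^ k * n ^ suc m * (Q ^ e * τ ^ e) * τ ^ (m + e)
      ≤⟨ ℕ.*-monoˡ-≤ (τ ^ (m + e)) (ℕ.*-mono-≤ (ℕ.*-monoˡ-≤ (n ^ suc m) (ℕ.*-monoʳ-≤ (B ^ k * (4 * suc k) ^ k) (^≤C k N (ℕ.≮⇒≥ k≤N))))
           (ℕ.≤-trans (ℕ.≤-reflexive (sym (*-^-distrib Q τ e))) (ℕ.^-monoˡ-≤ e Qτ≤16n))) ⟩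
    B ^ k * (4 * suc k) ^ k * (k ^ k * (N C k)) * n ^ suc m * (16 * n) ^ e * τ ^ (m + e)
      ≡⟨ cong₂ (λ x y → x * (k ^ k * (N C k)) * n ^ suc m * y * τ ^ (m + e)) (sym (*-^-distrib B (4 * suc k) k)) (*-^-distrib 16 n e) ⟩
    (B * (4 * suc k)) ^ k * (k ^ k * (N C k)) * n ^ suc m * (16 ^ e * n ^ e) * τ ^ (m + e)
      ≡⟨ solve 7 (λ a x y p s z t → a :* (x :* y) :* p :* (s :* z) :* t := a :* s :* x :* y :* t :* (p :* z)) refl
           ((B * (4 * suc k)) ^ k) (k ^ k) (N C k) (n ^ suc m) (16 ^ e) (n ^ e) (τ ^ (m + e)) ⟩
    (B * (4 * suc k)) ^ k * 16 ^ e * k ^ k * (N C k) * τ ^ (m + e) * (n ^ suc m * n ^ e)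
      ≡⟨ cong ((B * (4 * suc k)) ^ k * 16 ^ e * k ^ k * (N C k) * τ ^ (m + e) *_)
           (trans (sym (ℕ.^-distribˡ-+-* n (suc m) e)) (cong (n ^_) c≡)) ⟩
    (B * (4 * suc k)) ^ k * 16 ^ e * k ^ k * (N C k) * τ ^ (m + e) * n ^ c ∎)
    where
    open ℕ.≤-Reasoning
    c = k C 2
    F = f N k n
    R = r k n
    c≡ : suc m + e ≡ c
    c≡ = trans (cong (_+ e) (sym (nC1≡n (suc m)))) (nCk+nC[k+1]≡[n+1]C[k+1] (suc m) 1)
    mk≡ : m * k ≡ e + (m + e)
    mk≡ = begin-equality
      m * (2 + m)        ≡⟨ solve 1 (λ m → m :* (con 2 :+ m) := m :+ (con 1 :+ m) :* m) refl m ⟩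
      m + suc m * m      ≡⟨ cong (m +_) (choose₂ m) ⟨
      m + 2 * e          ≡⟨ solve 2 (λ m e → m :+ con 2 :* e := e :+ (m :+ e)) refl m e ⟩
      e + (m + e)        ∎

f-upper : ∀ m B → ∃ λ A → ∀ n .{{_ : NonTrivial n}} τ .{{_ : NonZero τ}} → 8 ^ τ ≤ n →
          n ^ suc m ≤ B * r (2 + m) n * τ ^ m → ∀ N →
          f N (2 + m) n * n ^ ((2 + m) C 2) ≤ A * (N C (2 + m)) * τ ^ (m + suc m C 2)
f-upper m B = (B * (4 * suc (2 + m))) ^ (2 + m) * 16 ^ (suc m C 2) * (2 + m) ^ (2 + m) ,
  λ n τ 8^τ≤n → f-upper-explicit m n τ 8^τ≤n B

-- Casts and logarithms

ℕ→ℚ-+ : ∀ a b → ℕ→ℚ (a + b) ≡ ℕ→ℚ a ℚ.+ ℕ→ℚ b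
ℕ→ℚ-+ zero    b = sym (ℚ.+-identityˡ (ℕ→ℚ b))
ℕ→ℚ-+ (suc a) b = begin
  ℕ→ℚ (suc (a + b))             ≡⟨ ℕ→ℚ-suc (a + b) ⟨
  ℕ→ℚ (a + b) ℚ.+ 1ℚ            ≡⟨ cong (ℚ._+ 1ℚ) (ℕ→ℚ-+ a b) ⟩
  (ℕ→ℚ a ℚ.+ ℕ→ℚ b) ℚ.+ 1ℚ      ≡⟨ ℚ.+-assoc (ℕ→ℚ a) (ℕ→ℚ b) 1ℚ ⟩
  ℕ→ℚ a ℚ.+ (ℕ→ℚ b ℚ.+ 1ℚ)      ≡⟨ cong (ℕ→ℚ a ℚ.+_) (ℚ.+-comm (ℕ→ℚ b) 1ℚ) ⟩
  ℕ→ℚ a ℚ.+ (1ℚ ℚ.+ ℕ→ℚ b)      ≡⟨ ℚ.+-assoc (ℕ→ℚ a) 1ℚ (ℕ→ℚ b) ⟨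
  (ℕ→ℚ a ℚ.+ 1ℚ) ℚ.+ ℕ→ℚ b      ≡⟨ cong (ℚ._+ ℕ→ℚ b) (ℕ→ℚ-suc a) ⟩
  ℕ→ℚ (suc a) ℚ.+ ℕ→ℚ b         ∎
  where open ≡-Reasoning

ℕ→ℚ-* : ∀ a b → ℕ→ℚ (a * b) ≡ ℕ→ℚ a ℚ.* ℕ→ℚ b
ℕ→ℚ-* zero    b = sym (ℚ.*-zeroˡ (ℕ→ℚ b))
ℕ→ℚ-* (suc a) b = begin
  ℕ→ℚ (b + a * b)                     ≡⟨ ℕ→ℚ-+ b (a * b) ⟩
  ℕ→ℚ b ℚ.+ ℕ→ℚ (a * b)               ≡⟨ cong₂ ℚ._+_ (sym (ℚ.*-identityˡ (ℕ→ℚ b))) (ℕ→ℚ-* a b) ⟩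
  1ℚ ℚ.* ℕ→ℚ b ℚ.+ ℕ→ℚ a ℚ.* ℕ→ℚ b    ≡⟨ ℚ.*-distribʳ-+ (ℕ→ℚ b) 1ℚ (ℕ→ℚ a) ⟨
  (1ℚ ℚ.+ ℕ→ℚ a) ℚ.* ℕ→ℚ b            ≡⟨ cong (ℚ._* ℕ→ℚ b) (trans (ℚ.+-comm 1ℚ (ℕ→ℚ a)) (ℕ→ℚ-suc a)) ⟩
  ℕ→ℚ (suc a) ℚ.* ℕ→ℚ b               ∎
  where open ≡-Reasoning

ℕ→ℚ-^ : ∀ a n → ℕ→ℚ (a ^ n) ≡ ℕ→ℚ a ^ℚ n
ℕ→ℚ-^ a zero    = refl
ℕ→ℚ-^ a (suc n) = trans (ℕ→ℚ-* a (a ^ n)) (cong (ℕ→ℚ a ℚ.*_) (ℕ→ℚ-^ a n))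

0≤ℕ→ℚ : ∀ a → 0ℚ ℚ.≤ ℕ→ℚ a
0≤ℕ→ℚ a = ℚ.nonNegative⁻¹ (ℕ→ℚ a) {{ℚ.normalize-nonNeg a 1}}

0<ℕ→ℚ : ∀ a .{{_ : NonZero a}} → 0ℚ ℚ.< ℕ→ℚ a
0<ℕ→ℚ (suc a) = ℚ.positive⁻¹ (ℕ→ℚ (suc a)) {{ℚ.normalize-pos (suc a) 1}}

ℕ→ℚ-mono : ∀ {a b} → a ≤ b → ℕ→ℚ a ℚ.≤ ℕ→ℚ b
ℕ→ℚ-mono {a} a≤b with ℕ.m≤n⇒∃[o]m+o≡n a≤b
... | o , refl = subst₂ ℚ._≤_ (ℚ.+-identityʳ (ℕ→ℚ a)) (sym (ℕ→ℚ-+ a o)) (ℚ.+-monoʳ-≤ (ℕ→ℚ a) (0≤ℕ→ℚ o))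

ℕ→ℚ-cancel : ∀ {a b} → ℕ→ℚ a ℚ.≤ ℕ→ℚ b → a ≤ b
ℕ→ℚ-cancel {a} {b} h with a ℕ.≤? b
... | yes a≤b = a≤b
... | no  a≰b = contradiction (ℚ.<-≤-trans b<a h) (ℚ.<-irrefl refl)
  where
  b<a : ℕ→ℚ b ℚ.< ℕ→ℚ a
  b<a = ℚ.<-≤-trans
    (subst₂ ℚ._<_ (ℚ.+-identityʳ (ℕ→ℚ b)) (ℕ→ℚ-suc b) (ℚ.+-monoʳ-< (ℕ→ℚ b) 0<1))
    (ℕ→ℚ-mono (ℕ.≰⇒> a≰b))

-- Dyadic Riemann sums

segment-upper : ∀ M .{{_ : NonZero M}} → ∑ M (λ i → unit (M + i)) ℚ.≤ 1ℚ
segment-upper M = begin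
  ∑ M (λ i → unit (M + i))   ≤⟨ ∑-mono M (λ i _ → unit-antimono (ℕ.m≤m+n M i)) ⟩
  ∑ M (λ _ → unit M)         ≡⟨ ∑-const M (unit M) ⟩
  ℕ→ℚ M ℚ.* unit M           ≡⟨ cong (λ z → ℕ→ℚ M ℚ.* unit z) (ℕ.*-identityˡ M) ⟨
  ℕ→ℚ M ℚ.* unit (1 * M)     ≡⟨ unit-scale 1 M ⟩
  1ℚ                         ∎
  where open ℚ.≤-Reasoning

segment-lower : ∀ M .{{_ : NonZero M}} → ½ ℚ.≤ ∑ M (λ i → unit (M + i))
segment-lower M = ℚ.≤-trans (riemann-pos 0 M)
  (ℚ.≤-reflexive (cong (λ z → ∑ z (λ i → unit (M + i))) (ℕ.*-identityˡ M)))

-- Scale invariance of dx/x: the part of the sum over the last doubling has the shape of a first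
-- segment with `2 ^ a * M` for `M`, so each doubling adds between ½ and 1.
riemann-double : ∀ a M → riemann (2 ^ suc a) M ≡
  riemann (2 ^ a) M ℚ.+ ∑ (2 ^ a * M) (λ i → unit (2 ^ a * M + i))
riemann-double a M = begin
  ∑ ((2 ^ suc a ∸ 1) * M) u
    ≡⟨ cong (λ z → ∑ z u) length≡ ⟩
  ∑ ((2 ^ a ∸ 1) * M + 2 ^ a * M) u
    ≡⟨ ∑-++ ((2 ^ a ∸ 1) * M) (2 ^ a * M) u ⟩
  riemann (2 ^ a) M ℚ.+ ∑ (2 ^ a * M) (λ i → unit (M + ((2 ^ a ∸ 1) * M + i)))
    ≡⟨ cong (riemann (2 ^ a) M ℚ.+_) (∑-cong (2 ^ a * M) λ i → cong unit (shift i)) ⟩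
  riemann (2 ^ a) M ℚ.+ ∑ (2 ^ a * M) (λ i → unit (2 ^ a * M + i)) ∎
  where
  open ≡-Reasoning
  u = λ i → unit (M + i)
  1≤2^a = ℕ.m^n>0 2 a
  length≡ : (2 ^ suc a ∸ 1) * M ≡ (2 ^ a ∸ 1) * M + 2 ^ a * M
  length≡ = trans (cong (_* M) (trans (ℕ.+-∸-comm (2 ^ a + 0) 1≤2^a) (cong (2 ^ a ∸ 1 +_) (ℕ.+-identityʳ (2 ^ a)))))
                  (ℕ.*-distribʳ-+ M (2 ^ a ∸ 1) (2 ^ a))
  shift : ∀ i → M + ((2 ^ a ∸ 1) * M + i) ≡ 2 ^ a * M + i
  shift i = trans (sym (ℕ.+-assoc M _ i)) (cong (λ z → z * M + i) (ℕ.m+[n∸m]≡n 1≤2^a))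

riemann-2^-upper : ∀ a M .{{_ : NonZero M}} → riemann (2 ^ a) M ℚ.≤ ℕ→ℚ a
riemann-2^-upper zero    M = ℚ.≤-refl
riemann-2^-upper (suc a) M = begin
  riemann (2 ^ suc a) M                                              ≡⟨ riemann-double a M ⟩
  riemann (2 ^ a) M ℚ.+ ∑ (2 ^ a * M) (λ i → unit (2 ^ a * M + i))   ≤⟨ ℚ.+-mono-≤ (riemann-2^-upper a M) (segment-upper (2 ^ a * M) {{nz}}) ⟩
  ℕ→ℚ a ℚ.+ 1ℚ                                                       ≡⟨ ℕ→ℚ-suc a ⟩
  ℕ→ℚ (suc a)                                                        ∎
  where
  open ℚ.≤-Reasoning
  nz : NonZero (2 ^ a * M)
  nz = ℕ.m*n≢0 (2 ^ a) M {{ℕ.m^n≢0 2 a}}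

riemann-2^-lower : ∀ a M .{{_ : NonZero M}} → ℕ→ℚ a ℚ.* ½ ℚ.≤ riemann (2 ^ a) M
riemann-2^-lower zero    M = ℚ.≤-refl
riemann-2^-lower (suc a) M = begin
  ℕ→ℚ (suc a) ℚ.* ½          ≡⟨ cong (ℚ._* ½) (ℕ→ℚ-suc a) ⟨
  (ℕ→ℚ a ℚ.+ 1ℚ) ℚ.* ½       ≡⟨ ℚ.*-distribʳ-+ ½ (ℕ→ℚ a) 1ℚ ⟩
  ℕ→ℚ a ℚ.* ½ ℚ.+ ½          ≤⟨ ℚ.+-mono-≤ (riemann-2^-lower a M) (segment-lower (2 ^ a * M) {{nz}}) ⟩
  riemann (2 ^ a) M ℚ.+ ∑ (2 ^ a * M) (λ i → unit (2 ^ a * M + i)) ≡⟨ riemann-double a M ⟨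
  riemann (2 ^ suc a) M      ∎
  where
  open ℚ.≤-Reasoning
  nz : NonZero (2 ^ a * M)
  nz = ℕ.m*n≢0 (2 ^ a) M {{ℕ.m^n≢0 2 a}}

riemann-mono : ∀ {n p} M → n ≤ p → riemann n M ℚ.≤ riemann p M
riemann-mono {n} {p} M n≤p with ℕ.m≤n⇒∃[o]m+o≡n (ℕ.*-monoˡ-≤ M (ℕ.∸-monoˡ-≤ 1 n≤p))
... | o , e = begin
  riemann n M                                            ≡⟨ ℚ.+-identityʳ _ ⟨
  riemann n M ℚ.+ 0ℚ                                     ≤⟨ ℚ.+-monoʳ-≤ (riemann n M) tail ⟩
  riemann n M ℚ.+ ∑ o (λ i → unit (M + ((n ∸ 1) * M + i))) ≡⟨ ∑-++ ((n ∸ 1) * M) o (λ i → unit (M + i)) ⟨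
  ∑ ((n ∸ 1) * M + o) (λ i → unit (M + i))               ≡⟨ cong (λ z → ∑ z (λ i → unit (M + i))) e ⟩
  riemann p M                                            ∎
  where
  open ℚ.≤-Reasoning
  tail : 0ℚ ℚ.≤ ∑ o (λ i → unit (M + ((n ∸ 1) * M + i)))
  tail = subst (ℚ._≤ ∑ o (λ i → unit (M + ((n ∸ 1) * M + i)))) (trans (∑-const o 0ℚ) (ℚ.*-zeroʳ (ℕ→ℚ o)))
    (∑-mono o λ i _ → unit-nonNeg (M + ((n ∸ 1) * M + i)))

-- Already `4 ^ τ`, which is at most `8 ^ τ`, allows 2τ doublings worth ½ each. The bound holds for
-- every term of the sequence, so no limit is involved.
log-lower : ∀ n τ j → 8 ^ τ ≤ n → ℕ→ℚ τ ℚ.≤ seq (log n) j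
log-lower n τ j 8^τ≤n = begin
  ℕ→ℚ τ                      ≡⟨ ℚ.*-identityʳ (ℕ→ℚ τ) ⟨
  ℕ→ℚ τ ℚ.* (ℕ→ℚ 2 ℚ.* ½)    ≡⟨ ℚ.*-assoc (ℕ→ℚ τ) (ℕ→ℚ 2) ½ ⟨
  ℕ→ℚ τ ℚ.* ℕ→ℚ 2 ℚ.* ½      ≡⟨ cong (ℚ._* ½) (ℕ→ℚ-* τ 2) ⟨
  ℕ→ℚ (τ * 2) ℚ.* ½          ≤⟨ riemann-2^-lower (τ * 2) (suc j) ⟩
  riemann (2 ^ (τ * 2)) (suc j) ≤⟨ riemann-mono (suc j) 4^τ≤n ⟩
  riemann n (suc j)          ∎
  where
  open ℚ.≤-Reasoning
  4^τ≤n : 2 ^ (τ * 2) ≤ n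
  4^τ≤n = ℕ.≤-trans (ℕ.≤-trans (ℕ.^-monoʳ-≤ 2 (ℕ.*-monoʳ-≤ τ (s≤s (s≤s (z≤n {1})))))
    (ℕ.≤-reflexive (trans (cong (2 ^_) (ℕ.*-comm τ 3)) (sym (ℕ.^-*-assoc 2 3 τ))))) 8^τ≤n

-- Fewer than 3(τ + 1) full doublings are passed, each worth at most 1, and 3(τ + 1) ≤ 6τ because τ
-- ≥ 1.
log-upper : ∀ n τ .{{_ : NonZero τ}} j → n < 8 ^ suc τ → seq (log n) j ℚ.≤ ℕ→ℚ (6 * τ)
log-upper n τ@(suc _) j n<8^ = begin
  riemann n (suc j)               ≤⟨ riemann-mono (suc j) n≤ ⟩
  riemann (2 ^ (3 * suc τ)) (suc j) ≤⟨ riemann-2^-upper (3 * suc τ) (suc j) ⟩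
  ℕ→ℚ (3 * suc τ)                 ≤⟨ ℕ→ℚ-mono (ℕ.≤-trans (ℕ.*-monoʳ-≤ 3 (ℕ.+-monoˡ-≤ τ (s≤s z≤n)))
                                       (ℕ.≤-reflexive (trans (cong (3 *_) (cong (τ +_) (sym (ℕ.+-identityʳ τ)))) (sym (ℕ.*-assoc 3 2 τ))))) ⟩
  ℕ→ℚ (6 * τ)                     ∎
  where
  open ℚ.≤-Reasoning
  n≤ : n ≤ 2 ^ (3 * suc τ)
  n≤ = ℕ.≤-trans (ℕ.<⇒≤ n<8^) (ℕ.≤-reflexive (ℕ.^-*-assoc 2 3 (suc τ)))

log≥½ : ∀ n .{{_ : NonTrivial n}} j → ½ ℚ.≤ seq (log n) j
log≥½ (suc (suc c)) j = riemann-pos c (suc j)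

-- The bound for real logarithms

*-monoˡ : ∀ {p q} s → 0ℚ ℚ.≤ s → p ℚ.≤ q → s ℚ.* p ℚ.≤ s ℚ.* q
*-monoˡ s 0≤s = ℚ.*-monoˡ-≤-nonNeg s {{ℚ.nonNegative 0≤s}}

*-monoʳ : ∀ {p q} s → 0ℚ ℚ.≤ s → p ℚ.≤ q → p ℚ.* s ℚ.≤ q ℚ.* s
*-monoʳ s 0≤s = ℚ.*-monoʳ-≤-nonNeg s {{ℚ.nonNegative 0≤s}}

*-assoc-swap : ∀ a b c → a ℚ.* b ℚ.* c ≡ a ℚ.* c ℚ.* b
*-assoc-swap a b c = trans (ℚ.*-assoc a b c) (trans (cong (a ℚ.*_) (ℚ.*-comm b c)) (sym (ℚ.*-assoc a c b)))

cancel-inverse : ∀ x {q} → 0ℚ ℚ.< q → x ℚ.* q ℚ.* (1/₀ q) ≡ x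
cancel-inverse x {q} 0<q = trans (ℚ.*-assoc x q (1/₀ q)) (trans (cong (x ℚ.*_) (inverseʳ 0<q)) (ℚ.*-identityʳ x))

≤-*-1/₀ : ∀ {x y q} → 0ℚ ℚ.< q → x ℚ.≤ y ℚ.* q → x ℚ.* (1/₀ q) ℚ.≤ y
≤-*-1/₀ {x} {y} {q} 0<q h = subst (x ℚ.* (1/₀ q) ℚ.≤_) (cancel-inverse y 0<q) (*-monoʳ (1/₀ q) (ℚ.<⇒≤ (1/₀-pos 0<q)) h)

1/₀-≤-* : ∀ {x y q} → 0ℚ ℚ.< q → x ℚ.* (1/₀ q) ℚ.≤ y → x ℚ.≤ y ℚ.* q
1/₀-≤-* {x} {y} {q} 0<q h = subst (ℚ._≤ y ℚ.* q) (trans (*-assoc-swap x (1/₀ q) q) (cancel-inverse x 0<q)) (*-monoʳ q (ℚ.<⇒≤ 0<q) h)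

^ℚ-*-distrib : ∀ a b n → (a ℚ.* b) ^ℚ n ≡ a ^ℚ n ℚ.* b ^ℚ n
^ℚ-*-distrib a b zero    = refl
^ℚ-*-distrib a b (suc n) = trans (cong (a ℚ.* b ℚ.*_) (^ℚ-*-distrib a b n))
  (S.solve 4 (λ a b x y → a S.:* b S.:* (x S.:* y) S.:= a S.:* x S.:* (b S.:* y)) refl a b (a ^ℚ n) (b ^ℚ n))
  where module S = ℚ-Solver

1^ℚ : ∀ n → 1ℚ ^ℚ n ≡ 1ℚ
1^ℚ zero    = refl
1^ℚ (suc n) = trans (ℚ.*-identityˡ _) (1^ℚ n)

2^*½^ : ∀ n → ℕ→ℚ (2 ^ n) ℚ.* ½ ^ℚ n ≡ 1ℚ
2^*½^ n = trans (cong (ℚ._* ½ ^ℚ n) (ℕ→ℚ-^ 2 n)) (trans (sym (^ℚ-*-distrib (ℕ→ℚ 2) ½ n)) (1^ℚ n))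

unit-pos : ∀ s .{{_ : NonZero s}} → 0ℚ ℚ.< unit s
unit-pos (suc s) = ℚ.positive⁻¹ (unit (suc s)) {{ℚ.normalize-pos 1 (suc s)}}

≤-+ε : ∀ {p q ε} → 0ℚ ℚ.< ε → p ℚ.≤ q → p ℚ.≤ q ℚ.+ ε
≤-+ε {p} {q} {ε} 0<ε p≤q = subst (ℚ._≤ q ℚ.+ ε) (ℚ.+-identityʳ p) (ℚ.+-mono-≤ p≤q (ℚ.<⇒≤ 0<ε))

0<½ : 0ℚ ℚ.< ½
0<½ = ℚ.positive⁻¹ ½

from-τ : ∀ {y w W x} m τ .{{_ : NonZero τ}} → y ≤ w * τ ^ m → w ≤ W → ℕ→ℚ τ ℚ.≤ x →
         ℕ→ℚ y ℚ.≤ ℕ→ℚ W ℚ.* x ^ℚ m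
from-τ {y} {w} {W} {x} m τ y≤ w≤W τ≤x = begin
  ℕ→ℚ y                       ≤⟨ ℕ→ℚ-mono y≤ ⟩
  ℕ→ℚ (w * τ ^ m)             ≡⟨ trans (ℕ→ℚ-* w (τ ^ m)) (cong (ℕ→ℚ w ℚ.*_) (ℕ→ℚ-^ τ m)) ⟩
  ℕ→ℚ w ℚ.* ℕ→ℚ τ ^ℚ m        ≤⟨ *-mono-≤ (0≤ℕ→ℚ w) (ℚ.<⇒≤ (^ℚ-pos m (0<ℕ→ℚ τ))) (ℕ→ℚ-mono w≤W) (^ℚ-mono m (0<ℕ→ℚ τ) τ≤x) ⟩
  ℕ→ℚ W ℚ.* x ^ℚ m            ∎
  where open ℚ.≤-Reasoning

-- Serves the bounded range of `n` in which no growth bound is available: as `1 ≤ 2x`, a constant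
-- `2 ^ m` pays for `x ^ m`.
from-½ : ∀ {y w W x} m → y ≤ w → w * 2 ^ m ≤ W → ½ ℚ.≤ x → ℕ→ℚ y ℚ.≤ ℕ→ℚ W ℚ.* x ^ℚ m
from-½ {y} {w} {W} {x} m y≤ w≤W ½≤x = begin
  ℕ→ℚ y                                  ≤⟨ ℕ→ℚ-mono y≤ ⟩
  ℕ→ℚ w                                  ≡⟨ trans (cong (ℕ→ℚ w ℚ.*_) (2^*½^ m)) (ℚ.*-identityʳ _) ⟨
  ℕ→ℚ w ℚ.* (ℕ→ℚ (2 ^ m) ℚ.* ½ ^ℚ m)     ≡⟨ trans (cong (ℚ._* ½ ^ℚ m) (ℕ→ℚ-* w (2 ^ m))) (ℚ.*-assoc (ℕ→ℚ w) (ℕ→ℚ (2 ^ m)) _) ⟨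
  ℕ→ℚ (w * 2 ^ m) ℚ.* ½ ^ℚ m             ≤⟨ *-mono-≤ (0≤ℕ→ℚ (w * 2 ^ m)) (ℚ.<⇒≤ (^ℚ-pos m 0<½)) (ℕ→ℚ-mono w≤W) (^ℚ-mono m 0<½ ½≤x) ⟩
  ℕ→ℚ W ℚ.* x ^ℚ m                       ∎
  where open ℚ.≤-Reasoning

0<fromℚ : ∀ {q} → 0ℚ ℚ.< q → 0ℝ <ℝ fromℚ q
0<fromℚ {q} 0<q = q , 0<q , 0 , λ _ _ → ℚ.≤-reflexive (ℚ.+-identityˡ q)

0<fromℕ : ∀ a .{{_ : NonZero a}} → 0ℝ <ℝ fromℕ a
0<fromℕ a = ℕ→ℚ a , 0<ℕ→ℚ a , 0 , λ _ _ → ℚ.≤-reflexive (ℚ.+-identityˡ (ℕ→ℚ a))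

*-rotate : ∀ a x y z → a * x * y * z ≡ a * y * z * x
*-rotate = solve 4 (λ a x y z → a :* x :* y :* z := a :* y :* z :* x) refl

LowerBound : ℕ → ℝ → Set
LowerBound m b = ∃ λ (n₀ : ℕ) → ∀ (n : ℕ) .{{_ : NonTrivial n}} → n₀ ≤ n →
  b *ℝ fromℕ n ^ℝ suc m /ℝ log n ^ℝ m ≤ℝ fromℕ (r (2 + m) n)

log-pos : ∀ n .{{_ : NonTrivial n}} j → 0ℚ ℚ.< seq (log n) j
log-pos n j = ℚ.<-≤-trans 0<½ (log≥½ n j)

GrowthBound : ℕ → ℕ → ℕ → Set
GrowthBound m n₁ B = ∀ n .{{_ : NonTrivial n}} → n₁ ≤ n →
  ∃ λ τ → NonZero τ × 8 ^ τ ≤ n × n ^ suc m ≤ B * r (2 + m) n * τ ^ m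

ramsey-growth : ∀ m b → 0ℝ <ℝ b → LowerBound m b → ∃ λ n₁ → ∃ λ B → GrowthBound m n₁ B
ramsey-growth m b (δ , 0<δ , M₀ , δ≤b) (n₀ , lower) = n₀ + 8 , B , growth-bound
  where
  k = 2 + m
  K = proj₁ (archimedean δ 0<δ)
  B : ℕ
  -- 1 / (K + 1) is a rational lower bound for the late terms of `b`, the 2 absorbs the tolerance in
  -- r + 1 ≤ 2r, and the 6 is that of `log-upper`.
  B = suc K * 2 * 6 ^ m
  growth-bound : GrowthBound m (n₀ + 8) B
  growth-bound n n₁≤n with log-bracket 8 n {{>-nonZero (ℕ.<⇒≤ (nonTrivial⇒n>1 n))}} (s≤s (s≤s z≤n))
  -- The 8 in `n₀ + 8` excludes `τ = 0`.
  ... | zero , _ , n<8 = contradiction (ℕ.≤-trans (ℕ.m≤n+m 8 n₀) n₁≤n) (ℕ.<⇒≱ n<8)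
  ... | τ@(suc _) , low , high = τ , _ , low , ℕ→ℚ-cancel (begin
    ℕ→ℚ (n ^ suc m)
      ≡⟨ trans (cong (ℚ._* ℕ→ℚ (n ^ suc m)) K*unit) (ℚ.*-identityˡ _) ⟨
    ℕ→ℚ (suc K) ℚ.* unit (suc K) ℚ.* ℕ→ℚ (n ^ suc m)
      ≡⟨ ℚ.*-assoc (ℕ→ℚ (suc K)) (unit (suc K)) (ℕ→ℚ (n ^ suc m)) ⟩
    ℕ→ℚ (suc K) ℚ.* (unit (suc K) ℚ.* ℕ→ℚ (n ^ suc m))
      ≤⟨ *-monoˡ (ℕ→ℚ (suc K)) (0≤ℕ→ℚ (suc K)) scaled ⟩
    ℕ→ℚ (suc K) ℚ.* ℕ→ℚ (2 * r k n * (6 * τ) ^ m)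
      ≡⟨ ℕ→ℚ-* (suc K) (2 * r k n * (6 * τ) ^ m) ⟨
    ℕ→ℚ (suc K * (2 * r k n * (6 * τ) ^ m))
      ≡⟨ cong ℕ→ℚ (trans (cong (λ z → suc K * (2 * r k n * z)) (*-^-distrib 6 τ m))
           (solve 4 (λ K r s t → K :* (con 2 :* r :* (s :* t)) := K :* con 2 :* s :* r :* t) refl (suc K) (r k n) (6 ^ m) (τ ^ m))) ⟩
    ℕ→ℚ (B * r k n * τ ^ m) ∎)
    where
    open ℚ.≤-Reasoning
    at-1 = lower n (ℕ.≤-trans (ℕ.m≤m+n n₀ 8) n₁≤n) 1ℚ 0<1
    j = proj₁ at-1 + M₀
    ℓ = seq (log n) j
    0<ℓ = log-pos n j
    K*unit : ℕ→ℚ (suc K) ℚ.* unit (suc K) ≡ 1ℚ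
    K*unit = trans (cong (λ z → ℕ→ℚ (suc K) ℚ.* unit z) (sym (ℕ.*-identityˡ (suc K)))) (unit-scale 1 (suc K))
    unit≤b : unit (suc K) ℚ.≤ seq b j
    unit≤b = ℚ.≤-trans (proj₂ (archimedean δ 0<δ))
      (subst (ℚ._≤ seq b j) (ℚ.+-identityˡ δ) (δ≤b j (ℕ.m≤n+m M₀ _)))
    r+1≤ : ℕ→ℚ (r k n) ℚ.+ 1ℚ ℚ.≤ ℕ→ℚ (2 * r k n)
    r+1≤ = subst (ℚ._≤ ℕ→ℚ (2 * r k n)) (sym (ℕ→ℚ-suc (r k n)))
      (ℕ→ℚ-mono (ℕ.+-mono-≤ (ℕ.≤-trans (s≤s z≤n) (2≤r m n)) (ℕ.m≤m+n (r k n) 0)))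
    scaled : unit (suc K) ℚ.* ℕ→ℚ (n ^ suc m) ℚ.≤ ℕ→ℚ (2 * r k n * (6 * τ) ^ m)
    scaled = begin
      unit (suc K) ℚ.* ℕ→ℚ (n ^ suc m)
        ≤⟨ *-monoʳ (ℕ→ℚ (n ^ suc m)) (0≤ℕ→ℚ (n ^ suc m)) unit≤b ⟩
      seq b j ℚ.* ℕ→ℚ (n ^ suc m)
        ≡⟨ cong (seq b j ℚ.*_) (ℕ→ℚ-^ n (suc m)) ⟩
      seq b j ℚ.* ℕ→ℚ n ^ℚ suc m
        ≤⟨ 1/₀-≤-* (^ℚ-pos m 0<ℓ) (proj₂ at-1 j (ℕ.m≤m+n _ M₀)) ⟩
      (ℕ→ℚ (r k n) ℚ.+ 1ℚ) ℚ.* ℓ ^ℚ m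
        ≤⟨ *-mono-≤ (ℚ.≤-trans (0≤ℕ→ℚ (suc (r k n))) (ℚ.≤-reflexive (sym (ℕ→ℚ-suc (r k n))))) (ℚ.<⇒≤ (^ℚ-pos m 0<ℓ))
             r+1≤ (^ℚ-mono m 0<ℓ (log-upper n τ j high)) ⟩
      ℕ→ℚ (2 * r k n) ℚ.* ℕ→ℚ (6 * τ) ^ℚ m
        ≡⟨ trans (ℕ→ℚ-* (2 * r k n) ((6 * τ) ^ m)) (cong (ℕ→ℚ (2 * r k n) ℚ.*_) (ℕ→ℚ-^ (6 * τ) m)) ⟨
      ℕ→ℚ (2 * r k n * (6 * τ) ^ m) ∎

module _ (m n₁ B : ℕ) (growth-bound : GrowthBound m n₁ B) where
  private
    k e c c′ : ℕ
    k = 2 + m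
    e = suc m C 2
    c = k C 2
    c′ = m + e

  ramsey-lower : ∃ λ W → NonZero W × ∀ n .{{_ : NonTrivial n}} j →
    ℕ→ℚ (n ^ suc m) ℚ.≤ ℕ→ℚ (W * r k n) ℚ.* seq (log n) j ^ℚ m
  ramsey-lower = W , _ , bound
    where
    -- `B` serves `n₁ ≤ n`. The other summand serves smaller `n`, where `n ^ suc m` is bounded, log
    -- n is at least ½ and r at least 1.
    W = suc (B + n₁ ^ suc m * 2 ^ m)
    bound : ∀ n .{{_ : NonTrivial n}} j → ℕ→ℚ (n ^ suc m) ℚ.≤ ℕ→ℚ (W * r k n) ℚ.* seq (log n) j ^ℚ m
    bound n j with n₁ ℕ.≤? n
    ... | yes n₁≤n = let (τ , τ≢0 , 8^τ≤n , g) = growth-bound n n₁≤n in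
      from-τ {w = B * r k n} {W = W * r k n} m τ {{τ≢0}} g
        (ℕ.*-monoˡ-≤ (r k n) (ℕ.≤-trans (ℕ.m≤m+n B _) (ℕ.n≤1+n _))) (log-lower n τ j 8^τ≤n)
    ... | no n₁≰n = from-½ {w = n₁ ^ suc m} {W = W * r k n} m (ℕ.^-monoˡ-≤ (suc m) (ℕ.<⇒≤ (ℕ.≰⇒> n₁≰n)))
      (ℕ.≤-trans (ℕ.≤-trans (ℕ.m≤n+m _ B) (ℕ.n≤1+n _)) (ℕ.m≤m*n W (r k n) {{>-nonZero (ℕ.≤-trans (s≤s z≤n) (2≤r m n))}}))
      (log≥½ n j)

  -- For bounded `n` any constant multiple of `N C k` will do, so the complete graph is good enough.
  f≤C : ∀ n N .{{_ : NonTrivial n}} → f N k n ≤ k ^ k * (N C k)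
  f≤C n N with N ℕ.<? k
  ... | yes N<k = ℕ.≤-trans (ℕ.≤-reflexive (f-few-vertices {k = k} {n} N<k)) z≤n
  ... | no  N≮k = ℕ.≤-trans (f≤cliqueCount {k = k} (complete N) (complete-independent n))
    (ℕ.≤-trans (cliqueCount≤^ k (complete N)) (^≤C k N (ℕ.≮⇒≥ N≮k)))

  count-upper : ∃ λ A → NonZero A × ∀ n N .{{_ : NonTrivial n}} j →
    ℕ→ℚ (f N k n * n ^ c) ℚ.≤ ℕ→ℚ (A * (N C k)) ℚ.* seq (log n) j ^ℚ c′
  count-upper = from-large (f-upper m B)
    where
    from-large : (∃ λ A₀ → ∀ n .{{_ : NonTrivial n}} τ .{{_ : NonZero τ}} → 8 ^ τ ≤ n →
        n ^ suc m ≤ B * r k n * τ ^ m → ∀ N → f N k n * n ^ c ≤ A₀ * (N C k) * τ ^ c′) →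
      ∃ λ A → NonZero A × ∀ n N .{{_ : NonTrivial n}} j →
        ℕ→ℚ (f N k n * n ^ c) ℚ.≤ ℕ→ℚ (A * (N C k)) ℚ.* seq (log n) j ^ℚ c′
    from-large (A₀ , large) = A , _ , bound
      where
      A = suc (A₀ + k ^ k * n₁ ^ c * 2 ^ c′)
      bound : ∀ n N .{{_ : NonTrivial n}} j →
        ℕ→ℚ (f N k n * n ^ c) ℚ.≤ ℕ→ℚ (A * (N C k)) ℚ.* seq (log n) j ^ℚ c′
      bound n N j with n₁ ℕ.≤? n
      ... | yes n₁≤n = let (τ , τ≢0 , 8^τ≤n , g) = growth-bound n n₁≤n in
        from-τ {w = A₀ * (N C k)} {W = A * (N C k)} c′ τ {{τ≢0}} (large n τ {{τ≢0}} 8^τ≤n g N)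
          (ℕ.*-monoˡ-≤ (N C k) (ℕ.≤-trans (ℕ.m≤m+n A₀ _) (ℕ.n≤1+n _))) (log-lower n τ j 8^τ≤n)
      ... | no n₁≰n = from-½ {w = k ^ k * (N C k) * n₁ ^ c} {W = A * (N C k)} c′
        (ℕ.*-mono-≤ (f≤C n N) (ℕ.^-monoˡ-≤ c (ℕ.<⇒≤ (ℕ.≰⇒> n₁≰n)))) (begin
        k ^ k * (N C k) * n₁ ^ c * 2 ^ c′
          ≡⟨ *-rotate (k ^ k) (N C k) (n₁ ^ c) (2 ^ c′) ⟩
        k ^ k * n₁ ^ c * 2 ^ c′ * (N C k)
          ≤⟨ ℕ.*-monoˡ-≤ (N C k) (ℕ.≤-trans (ℕ.m≤n+m _ A₀) (ℕ.n≤1+n _)) ⟩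
        A * (N C k) ∎) (log≥½ n j)
        where open ℕ.≤-Reasoning

  -- The 4 leaves room for the tolerance in `_≤ℝ_`: taken as ¼, it yields 4N ≤ r + 1, which excludes
  -- r ≤ N.
  no-cliques : ∀ W .{{_ : NonZero W}} →
    (∀ n .{{_ : NonTrivial n}} j → ℕ→ℚ (n ^ suc m) ℚ.≤ ℕ→ℚ (W * r k n) ℚ.* seq (log n) j ^ℚ m) →
    ∀ n N .{{_ : NonTrivial n}} →
    fromℕ N ≤ℝ fromℚ (unit (4 * W)) *ℝ fromℕ n ^ℝ suc m /ℝ log n ^ℝ m → f N k n ≡ 0
  no-cliques W W-bound n N N≤ = f-below-ramsey (ℕ.≰⇒> λ r≤N → contradiction (few r≤N) λ { (s≤s ()) })
    where
    α = unit (4 * W)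
    at-¼ = N≤ (unit 4) (ℚ.positive⁻¹ (unit 4))
    j = proj₁ at-¼
    R = r k n
    ℓ = seq (log n) j
    4N≤ : 4 * N ≤ suc R
    4N≤ = ℕ→ℚ-cancel (begin
      ℕ→ℚ (4 * N)
        ≡⟨ ℕ→ℚ-* 4 N ⟩
      ℕ→ℚ 4 ℚ.* ℕ→ℚ N
        ≤⟨ *-monoˡ (ℕ→ℚ 4) (0≤ℕ→ℚ 4) (proj₂ at-¼ j ℕ.≤-refl) ⟩
      ℕ→ℚ 4 ℚ.* (α ℚ.* ℕ→ℚ n ^ℚ suc m ℚ.* (1/₀ (ℓ ^ℚ m)) ℚ.+ unit 4)
        ≤⟨ *-monoˡ (ℕ→ℚ 4) (0≤ℕ→ℚ 4) (ℚ.+-monoˡ-≤ (unit 4) (≤-*-1/₀ {y = unit 4 ℚ.* ℕ→ℚ R} (^ℚ-pos m (log-pos n j)) scaled)) ⟩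
      ℕ→ℚ 4 ℚ.* (unit 4 ℚ.* ℕ→ℚ R ℚ.+ unit 4)
        ≡⟨ S.solve 3 (λ a u x → a S.:* (u S.:* x S.:+ u) S.:= (a S.:* u) S.:* (x S.:+ S.con 1ℚ)) refl (ℕ→ℚ 4) (unit 4) (ℕ→ℚ R) ⟩
      1ℚ ℚ.* (ℕ→ℚ R ℚ.+ 1ℚ)
        ≡⟨ trans (ℚ.*-identityˡ _) (ℕ→ℚ-suc R) ⟩
      ℕ→ℚ (suc R) ∎)
      where
      open ℚ.≤-Reasoning
      module S = ℚ-Solver
      scaled : α ℚ.* ℕ→ℚ n ^ℚ suc m ℚ.≤ unit 4 ℚ.* ℕ→ℚ R ℚ.* ℓ ^ℚ m
      scaled = begin
        α ℚ.* ℕ→ℚ n ^ℚ suc m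
          ≡⟨ cong (α ℚ.*_) (ℕ→ℚ-^ n (suc m)) ⟨
        α ℚ.* ℕ→ℚ (n ^ suc m)
          ≤⟨ *-monoˡ α (unit-nonNeg (4 * W)) (W-bound n j) ⟩
        α ℚ.* (ℕ→ℚ (W * R) ℚ.* ℓ ^ℚ m)
          ≡⟨ cong (λ z → α ℚ.* (z ℚ.* ℓ ^ℚ m)) (ℕ→ℚ-* W R) ⟩
        α ℚ.* (ℕ→ℚ W ℚ.* ℕ→ℚ R ℚ.* ℓ ^ℚ m)
          ≡⟨ S.solve 4 (λ a w x y → a S.:* (w S.:* x S.:* y) S.:= w S.:* a S.:* x S.:* y) refl α (ℕ→ℚ W) (ℕ→ℚ R) (ℓ ^ℚ m) ⟩
        ℕ→ℚ W ℚ.* α ℚ.* ℕ→ℚ R ℚ.* ℓ ^ℚ m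
          ≡⟨ cong (λ z → z ℚ.* ℕ→ℚ R ℚ.* ℓ ^ℚ m) (unit-scale 4 W) ⟩
        unit 4 ℚ.* ℕ→ℚ R ℚ.* ℓ ^ℚ m ∎
    few : R ≤ N → 3 ≤ 1
    few R≤N = ℕ.+-cancelʳ-≤ R 3 1 (begin
      3 + R           ≤⟨ ℕ.+-monoˡ-≤ R (ℕ.≤-trans (s≤s (s≤s (s≤s (z≤n {3})))) (ℕ.*-monoʳ-≤ 3 (2≤r m n))) ⟩
      3 * R + R       ≡⟨ ℕ.+-comm (3 * R) R ⟩
      4 * R           ≤⟨ ℕ.*-monoʳ-≤ 4 R≤N ⟩
      4 * N           ≤⟨ 4N≤ ⟩
      1 + R           ∎)
      where open ℕ.≤-Reasoning

  -- The exponent `c′` is one less than `c`; the missing factor is the 1 / log n of the conclusion.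
  -- The inequality holds term by term.
  few-cliques : ∀ A →
    (∀ n N .{{_ : NonTrivial n}} j →
      ℕ→ℚ (f N k n * n ^ c) ℚ.≤ ℕ→ℚ (A * (N C k)) ℚ.* seq (log n) j ^ℚ c′) →
    ∀ n N .{{_ : NonTrivial n}} → fromℕ (f N k n) ≤ℝ
    fromℕ A *ℝ fromℕ (N C k) *ℝ (log n /ℝ fromℕ n) ^ℝ c *ℝ (fromℕ 1 /ℝ log n)
  few-cliques A A-bound n N ε 0<ε = 0 , λ j _ →
    ≤-+ε 0<ε (bound j)
    where
    module S = ℚ-Solver
    open ℚ.≤-Reasoning
    0<n = 0<ℕ→ℚ n {{>-nonZero (ℕ.<⇒≤ (nonTrivial⇒n>1 n))}}
    F = f N k n
    c≡ : suc c′ ≡ c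
    c≡ = trans (cong (_+ e) (sym (nC1≡n (suc m)))) (nCk+nC[k+1]≡[n+1]C[k+1] (suc m) 1)
    bound : ∀ j → ℕ→ℚ F ℚ.≤ ℕ→ℚ A ℚ.* ℕ→ℚ (N C k) ℚ.*
      (seq (log n) j ℚ.* (1/₀ (ℕ→ℚ n))) ^ℚ c ℚ.* (ℕ→ℚ 1 ℚ.* (1/₀ (seq (log n) j)))
    bound j = begin
      ℕ→ℚ F
        ≡⟨ trans (cong (ℕ→ℚ F ℚ.*_) n^*v^) (ℚ.*-identityʳ (ℕ→ℚ F)) ⟨
      ℕ→ℚ F ℚ.* (ℕ→ℚ (n ^ c) ℚ.* v ^ℚ c)
        ≡⟨ trans (cong (ℚ._* v ^ℚ c) (ℕ→ℚ-* F (n ^ c))) (ℚ.*-assoc (ℕ→ℚ F) (ℕ→ℚ (n ^ c)) (v ^ℚ c)) ⟨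
      ℕ→ℚ (F * n ^ c) ℚ.* v ^ℚ c
        ≤⟨ *-monoʳ (v ^ℚ c) (ℚ.<⇒≤ (^ℚ-pos c (1/₀-pos 0<n))) (A-bound n N j) ⟩
      ℕ→ℚ (A * (N C k)) ℚ.* ℓ ^ℚ c′ ℚ.* v ^ℚ c
        ≡⟨ cong₂ (λ x y → x ℚ.* y ℚ.* v ^ℚ c) (ℕ→ℚ-* A (N C k)) ℓ^c′ ⟩
      ℕ→ℚ A ℚ.* ℕ→ℚ (N C k) ℚ.* (ℓ ^ℚ c ℚ.* (1/₀ ℓ)) ℚ.* v ^ℚ c
        ≡⟨ S.solve 4 (λ a x y z → a S.:* (x S.:* y) S.:* z S.:= a S.:* (x S.:* z) S.:* (S.con 1ℚ S.:* y)) refl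
             (ℕ→ℚ A ℚ.* ℕ→ℚ (N C k)) (ℓ ^ℚ c) (1/₀ ℓ) (v ^ℚ c) ⟩
      ℕ→ℚ A ℚ.* ℕ→ℚ (N C k) ℚ.* (ℓ ^ℚ c ℚ.* v ^ℚ c) ℚ.* (1ℚ ℚ.* (1/₀ ℓ))
        ≡⟨ cong (λ z → ℕ→ℚ A ℚ.* ℕ→ℚ (N C k) ℚ.* z ℚ.* (1ℚ ℚ.* (1/₀ ℓ))) (^ℚ-*-distrib ℓ v c) ⟨
      ℕ→ℚ A ℚ.* ℕ→ℚ (N C k) ℚ.* (ℓ ℚ.* v) ^ℚ c ℚ.* (1ℚ ℚ.* (1/₀ ℓ)) ∎
      where
      ℓ = seq (log n) j
      v = 1/₀ (ℕ→ℚ n)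
      n^*v^ : ℕ→ℚ (n ^ c) ℚ.* v ^ℚ c ≡ 1ℚ
      n^*v^ = trans (cong (ℚ._* v ^ℚ c) (ℕ→ℚ-^ n c)) (trans (sym (^ℚ-*-distrib (ℕ→ℚ n) v c))
        (trans (cong (_^ℚ c) (inverseʳ 0<n)) (1^ℚ c)))
      ℓ^c′ : ℓ ^ℚ c′ ≡ ℓ ^ℚ c ℚ.* (1/₀ ℓ)
      ℓ^c′ = trans (sym (cancel-inverse (ℓ ^ℚ c′) (log-pos n j)))
        (cong (ℚ._* (1/₀ ℓ)) (trans (ℚ.*-comm (ℓ ^ℚ c′) ℓ) (cong (ℓ ^ℚ_) c≡)))

  clique-count-threshold : ∃ λ (a₁ : ℝ) → ∃ λ (a₂ : ℝ) → 0ℝ <ℝ a₁ × 0ℝ <ℝ a₂ ×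
    (∀ (n N : ℕ) .{{_ : NonTrivial n}} →
      (fromℕ N ≤ℝ a₁ *ℝ fromℕ n ^ℝ suc m /ℝ log n ^ℝ m → f N k n ≡ 0) ×
      fromℕ (f N k n) ≤ℝ a₂ *ℝ fromℕ (N C k) *ℝ (log n /ℝ fromℕ n) ^ℝ c *ℝ (fromℕ 1 /ℝ log n))
  clique-count-threshold =
    let (W , W≢0 , W-bound) = ramsey-lower
        (A , A≢0 , A-bound) = count-upper
    in fromℚ (unit (4 * W)) , fromℕ A ,
       0<fromℚ (unit-pos (4 * W) {{ℕ.m*n≢0 4 W {{_}} {{W≢0}}}}) , 0<fromℕ A {{A≢0}} ,
       λ n N → no-cliques W {{W≢0}} W-bound n N , few-cliques A A-bound n N

theorem1p5 :
    ∀ (k : ℕ) → 5 ≤ k →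
    ∀ (b₁ b₂ : ℝ) → 0ℝ <ℝ b₁ → 0ℝ <ℝ b₂ →
    (∃ λ (n₀ : ℕ) → ∀ (n : ℕ) .{{_ : NonTrivial n}} → n₀ ≤ n →
      b₁ *ℝ fromℕ n ^ℝ (k ∸ 1) /ℝ log n ^ℝ (k ∸ 2) ≤ℝ fromℕ (r k n)
      × fromℕ (r k n) ≤ℝ b₂ *ℝ fromℕ n ^ℝ (k ∸ 1) /ℝ log n ^ℝ (k ∸ 2)) →
    ∃ λ (a₁ : ℝ) → ∃ λ (a₂ : ℝ) → 0ℝ <ℝ a₁ × 0ℝ <ℝ a₂ ×
      (∀ (n N : ℕ) .{{_ : NonTrivial n}} .{{_ : NonZero N}} →
        (fromℕ N ≤ℝ a₁ *ℝ fromℕ n ^ℝ (k ∸ 1) /ℝ log n ^ℝ (k ∸ 2) →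
          f N k n ≡ 0)
        × (a₁ *ℝ fromℕ n ^ℝ (k ∸ 1) /ℝ log n ^ℝ (k ∸ 2) ≤ℝ fromℕ N →
          fromℕ (f N k n)
            ≤ℝ a₂ *ℝ fromℕ (N C k) *ℝ (log n /ℝ fromℕ n) ^ℝ (k C 2) *ℝ (fromℕ 1 /ℝ log n)))
theorem1p5 zero       ()
theorem1p5 (suc zero) (s≤s ())
-- For `k` of this form `k ∸ 1` and `k ∸ 2` compute to `suc m` and `m`.
theorem1p5 (suc (suc m)) 5≤k b₁ b₂ 0<b₁ 0<b₂ (n₀ , ramsey) =
  let (n₁ , B , growth-bound) = ramsey-growth m b₁ 0<b₁ (n₀ , λ n n₀≤n → proj₁ (ramsey n n₀≤n))
      (a₁ , a₂ , 0<a₁ , 0<a₂ , bounds) =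
        clique-count-threshold m n₁ B growth-bound
  in a₁ , a₂ , 0<a₁ , 0<a₂ , λ n N → proj₁ (bounds n N) , λ _ → proj₂ (bounds n N)
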